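{- Let $k$ be a positive integer and let $q_{n,j}$ ($n\ge1$, $1\le j\le k$) be natural numbers with $$q_{1,1}<q_{1,2}<\cdots<q_{1,k}<q_{2,1}<q_{2,2}<\cdots<q_{2,k}<q_{3,1}<\cdots,$$ such that $q_{n,j}\mid q_{n,j+1}$ for $1\le j\le k-1$ and $q_{n,k}\mid q_{n+1,1}$ for all $n\ge1$, and such that $$\lim_{n\to\infty}\frac{\log q_{n+1,1}-\log q_{n,k}}{\log q_{n+1,k}}=\eta_1,\qquad \lim_{n\to\infty}\frac{\log q_{n+1,i}-\log q_{n+1,i-1}}{\log q_{n+1,k}}=\eta_i\ (2\le i\le k),\qquad \lim_{n\to\infty}\frac{\log q_{n+1,1}}{\log q_{n,k}}=\eta_{k+1}=\infty,$$ where the real numbers $\eta_1,\dots,\eta_k$ satisfy $\eta_1+\eta_2+\cdots+\eta_k=1$ and $\eta_k\ge\eta_{k-1}\ge\cdots\ge\eta_1>0$. Put $\zeta_j=\sum_{n\ge1}\frac{1}{q_{n,j}}$ for $1\le j\le k$. Then the approximation constants of $(\zeta_1,\dots,\zeta_k)$ are $$\omega_1=\infty,\qquad \omega_j=\max_{j-1\le m\le k}\frac{\eta_{m-j+2}}{\eta_1+\eta_2+\cdots+\eta_m}\quad(2\le j\le k+1),$$ $$\widehat\omega_1=\min_{1\le m\le k}\frac{\eta_m}{\eta_1+\eta_2+\cdots+\eta_m},\qquad \widehat\omega_j=0\quad(2\le j\le k+1).$$ (In particular $\omega_2=\max\{\eta_k/(\eta_k+\cdots+\eta_1),\eta_{k-1}/(\eta_{k-1}+\cdots+\eta_1),\dots,\eta_1/\eta_1\}$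 and $\omega_{k+1}=\eta_1/(\eta_k+\cdots+\eta_1)$.)
   Context: For real $\zeta_1,\dots,\zeta_k$, $1\le j\le k+1$ and $X>0$, let $\omega_j(X)$ be the supremum of all real $\nu$ such that the system $|x|\le X$, $|\zeta_ix-y_i|\le X^{ -\nu}$ ($1\le i\le k$) has $j$ linearly independent solutions $(x,y_1,\dots,y_k)\in\mathbb{Z}^{k+1}$. Then $\omega_j=\limsup_{X\to\infty}\omega_j(X)$ and $\widehat\omega_j=\liminf_{X\to\infty}\omega_j(X)$; also $\omega=\omega_1$, $\widehat\omega=\widehat\omega_1$. -}

module Defs where

open import Algebra.Bundles using (CommutativeRing; Semiring)
open import Axiom.ExcludedMiddle using (ExcludedMiddle)
open import Data.Empty using (⊥-elim)
open import Data.Fin.Base using (Fin; zero; suc)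
open import Data.Integer.Base as ℤ using (ℤ; +_; -[1+_])
open import Data.Nat.Base as ℕ using (ℕ; zero; suc; _∸_)
open import Data.Product.Base using (Σ; ∃; _×_; _,_; proj₁; proj₂)
open import Level using (0ℓ) renaming (suc to lsuc)
open import Relation.Binary.Bundles using (TotalOrder)
open import Relation.Binary.Core using (Rel)
open import Relation.Binary.PropositionalEquality.Core using (_≡_)
open import Relation.Binary.Structures using (IsTotalOrder)
open import Relation.Nullary using (¬_; Dec; yes; no)
open import Relation.Nullary.Construct.Add.Extrema using (_±; ⊥±; ⊤±; [_])
import Algebra.Construct.NaturalChoice.Max as NaturalMax
import Algebra.Construct.NaturalChoice.Min as NaturalMin
import Algebra.Definitions.RawSemiring as RawSemiringOps
import Relation.Binary.Construct.Add.Extrema.Equality as ExtremaEquality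
import Relation.Binary.Construct.Add.Extrema.NonStrict as ExtremaOrder
import Relation.Binary.Construct.Add.Supremum.NonStrict as SupremumOrder
import Relation.Binary.Construct.NonStrictToStrict as ToStrict

open RawSemiringOps ℤ.+-*-rawSemiring using () renaming (sum to sumℤ)

-- A Dedekind complete totally ordered field.  Classically there is exactly one
-- up to isomorphism, the field of real numbers.  The value 0# ⁻¹ is unspecified.
record CompleteOrderedField : Set (lsuc 0ℓ) where
  infix  4 _≤_
  infix  9 _⁻¹
  field
    commutativeRing : CommutativeRing 0ℓ 0ℓ

  open CommutativeRing commutativeRing public hiding (zero)

  field
    _≤_          : Rel Carrier 0ℓ
    isTotalOrder : IsTotalOrder _≈_ _≤_
    _⁻¹          : Carrier → Carrier
    ⁻¹-cong      : ∀ {x y} → x ≈ y → x ⁻¹ ≈ y ⁻¹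
    ⁻¹-inverseʳ  : ∀ x → ¬ (x ≈ 0#) → x * x ⁻¹ ≈ 1#
    0≉1          : ¬ (0# ≈ 1#)
    +-monoˡ-≤    : ∀ z {x y} → x ≤ y → x + z ≤ y + z
    *-nonneg     : ∀ {x y} → 0# ≤ x → 0# ≤ y → 0# ≤ x * y
    complete     : (P : Carrier → Set) → ∃ P → (∃ λ b → ∀ x → P x → x ≤ b) →
                   ∃ λ s → (∀ x → P x → x ≤ s) ×
                           (∀ b → (∀ x → P x → x ≤ b) → s ≤ b)

  totalOrder : TotalOrder 0ℓ 0ℓ 0ℓ
  totalOrder = record { isTotalOrder = isTotalOrder }

-- Excluded middle is what makes suprema in the extended line, limits and
-- logarithms total functions.
module Analysis (em : ExcludedMiddle 0ℓ) (𝔽 : CompleteOrderedField) where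

  open CompleteOrderedField 𝔽 public renaming (Carrier to ℝ)
  open ToStrict _≈_ _≤_ public using (_<_)
  open NaturalMax totalOrder public using (_⊔_)
  open NaturalMin totalOrder public using (_⊓_)
  open RawSemiringOps (Semiring.rawSemiring semiring) using (_^_) renaming (_×_ to _·_)
  open ExtremaEquality _≈_ public using (_≈±_)
  open ExtremaOrder _≤_ public using (_≤±_)
  private
    module O = IsTotalOrder isTotalOrder
    module E = ExtremaOrder _≤_

  infixl 7 _/_
  infixr 8 _^ʳ_
  infix  4 _⟶_

  fromℕ : ℕ → ℝ
  fromℕ n = n · 1#

  fromℤ : ℤ → ℝ
  fromℤ (+ n)    = fromℕ n
  fromℤ -[1+ n ] = - fromℕ (suc n)

  _/_ : ℝ → ℝ → ℝ
  x / y = x * y ⁻¹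

  ∣_∣ : ℝ → ℝ
  ∣ x ∣ = x ⊔ (- x)

  -- Σ₁ N f = f 1 + ⋯ + f N
  Σ₁ : ℕ → (ℕ → ℝ) → ℝ
  Σ₁ zero    f = 0#
  Σ₁ (suc N) f = Σ₁ N f + f (suc N)

  maxFrom minFrom : ℕ → ℕ → (ℕ → ℝ) → ℝ
  maxFrom a zero    f = f a
  maxFrom a (suc d) f = maxFrom a d f ⊔ f (a ℕ.+ suc d)
  minFrom a zero    f = f a
  minFrom a (suc d) f = minFrom a d f ⊓ f (a ℕ.+ suc d)

  -- The maximum and minimum of f m over a ≤ m ≤ b, for a ≤ b.
  max[_,_] min[_,_] : ℕ → ℕ → (ℕ → ℝ) → ℝ
  max[ a , b ] f = maxFrom a (b ∸ a) f
  min[ a , b ] f = minFrom a (b ∸ a) f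

  _⟶_ : (ℕ → ℝ) → ℝ → Set
  f ⟶ L = ∀ ε → 0# < ε → ∃ λ N → ∀ n → N ℕ.≤ n → ∣ f n - L ∣ < ε

  _⟶∞ : (ℕ → ℝ) → Set
  f ⟶∞ = ∀ M → ∃ λ N → ∀ n → N ℕ.≤ n → M < f n

  -- An element satisfying P if there is one, and 0# otherwise.
  choose : (ℝ → Set) → ℝ
  choose P with em {∃ P}
  ... | yes (x , _) = x
  ... | no _        = 0#

  choose-correct : (P : ℝ → Set) → ∃ P → P (choose P)
  choose-correct P ∃x with em {∃ P}
  ... | yes (_ , p) = p
  ... | no ∄x       = ⊥-elim (∄x ∃x)

  lim : (ℕ → ℝ) → ℝ
  lim f = choose (λ L → f ⟶ L)

  -- f 1 + f 2 + f 3 + ⋯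
  series₁ : (ℕ → ℝ) → ℝ
  series₁ f = lim (λ N → Σ₁ N f)

  exp : ℝ → ℝ
  exp x = lim (λ n → (1# + x / fromℕ n) ^ n)

  -- Meaningful for positive arguments only.
  log : ℝ → ℝ
  log x = choose (λ t → exp t ≈ x)

  -- Meaningful for positive base only.
  _^ʳ_ : ℝ → ℝ → ℝ
  x ^ʳ ν = exp (ν * log x)

  IsLUB : {I : Set} → (I → ℝ ±) → ℝ ± → Set
  IsLUB f s = (∀ i → f i ≤± s) × (∀ b → (∀ i → f i ≤± b) → s ≤± b)

  IsGLB : {I : Set} → (I → ℝ ±) → ℝ ± → Set
  IsGLB f s = (∀ i → s ≤± f i) × (∀ b → (∀ i → b ≤± f i) → b ≤± s)

  private
    ≤±-trans : ∀ {x y z} → x ≤± y → y ≤± z → x ≤± z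
    ≤±-trans = E.≤±-trans O.trans

    lub : {I : Set} (f : I → ℝ ±) →
          Dec (∃ λ b → ∀ i → f i ≤± [ b ]) →
          Dec (∃ λ r → ∃ λ i → [ r ] ≤± f i) →
          ∃ (IsLUB f)
    lub f (no unbounded) _ = ⊤± , (λ i → f i E.≤⊤±) , least
      where
      least : ∀ b → (∀ i → f i ≤± b) → ⊤± ≤± b
      least ⊥±    ub = ⊥-elim (unbounded (0# , λ i → ≤±-trans (ub i) E.⊥±≤[ 0# ]))
      least [ b ] ub = ⊥-elim (unbounded (b , ub))
      least ⊤±    ub = E.⊤±≤⊤±
    lub f (yes (b , ub)) (no none) = ⊥± , upper , (λ c _ → E.⊥±≤ c)
      where
      below : ∀ e → ¬ (∃ λ r → [ r ] ≤± e) → e ≤± ⊥±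
      below ⊥±    h = E.⊥±≤⊥±
      below [ r ] h = ⊥-elim (h (r , E.[ O.refl ]))
      below ⊤±    h = ⊥-elim (h (0# , E.[ 0# ]≤⊤±))
      upper : ∀ i → f i ≤± ⊥±
      upper i = below (f i) (λ { (r , p) → none (r , i , p) })
    lub f (yes (b , ub)) (yes inhabited) = [ s ] , upper , least
      where
      P : ℝ → Set
      P r = ∃ λ i → [ r ] ≤± f i
      bound : ∀ c → (∀ i → f i ≤± [ c ]) → ∀ r → P r → r ≤ c
      bound c uc r (i , p) = E.[≤]-injective (≤±-trans p (uc i))
      S = complete P inhabited (b , bound b ub)
      s = proj₁ S
      below : ∀ e → e ≤± [ b ] → (∀ r → [ r ] ≤± e → r ≤ s) → e ≤± [ s ]
      below ⊥±    _ _ = E.⊥±≤[ s ]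
      below [ r ] _ h = E.[ h r E.[ O.refl ] ]
      below ⊤±    () _
      upper : ∀ i → f i ≤± [ s ]
      upper i = below (f i) (ub i) (λ r p → proj₁ (proj₂ S) r (i , p))
      least : ∀ c → (∀ i → f i ≤± c) → [ s ] ≤± c
      least [ c ] uc = E.[ proj₂ (proj₂ S) c (bound c uc) ]
      least ⊤±    uc = E.[ s ]≤⊤±
      least ⊥±    uc with ≤±-trans (proj₂ (proj₂ inhabited)) (uc (proj₁ (proj₂ inhabited)))
      ... | SupremumOrder.[ () ]

  sup-exists : {I : Set} (f : I → ℝ ±) → ∃ (IsLUB f)
  sup-exists f = lub f em em

  inf-exists : {I : Set} (f : I → ℝ ±) → ∃ (IsGLB f)
  inf-exists f with sup-exists {I = ∃ λ b → ∀ i → b ≤± f i} proj₁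
  ... | s , upper , least =
        s , (λ i → least (f i) (λ { (b , lb) → lb i })) , (λ b lb → upper (b , lb))

  sup : {I : Set} → (I → ℝ ±) → ℝ ±
  sup f = proj₁ (sup-exists f)

  inf : {I : Set} → (I → ℝ ±) → ℝ ±
  inf f = proj₁ (inf-exists f)

  -- Upper and lower limits of f X as the positive real X tends to infinity.
  limsup : (ℝ → ℝ ±) → ℝ ±
  limsup f = inf {I = ∃ λ X₀ → 0# < X₀} λ (X₀ , _) →
             sup {I = ∃ λ X → X₀ ≤ X} λ (X , _) → f X

  liminf : (ℝ → ℝ ±) → ℝ ±
  liminf f = sup {I = ∃ λ X₀ → 0# < X₀} λ (X₀ , _) →
             inf {I = ∃ λ X → X₀ ≤ X} λ (X , _) → f X

  -- Independence over ℤ; for integer vectors this is the same as over ℚ or ℝ.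
  LinearlyIndependent : {j d : ℕ} → (Fin j → Fin d → ℤ) → Set
  LinearlyIndependent {j} {d} v =
    (c : Fin j → ℤ) →
    (∀ l → sumℤ (λ i → c i ℤ.* v i l) ≡ ℤ.0ℤ) →
    ∀ i → c i ≡ ℤ.0ℤ

  -- The vector (x , y₁ , … , y_k) is encoded as v with x = v zero, yᵢ = v (suc i).
  IsSolution : {k : ℕ} → (Fin k → ℝ) → ℝ → ℝ → (Fin (suc k) → ℤ) → Set
  IsSolution ζ X ν v =
    ∣ fromℤ (v zero) ∣ ≤ X ×
    (∀ i → ∣ ζ i * fromℤ (v zero) - fromℤ (v (suc i)) ∣ ≤ X ^ʳ (- ν))

  HasIndependentSolutions : {k : ℕ} → (Fin k → ℝ) → ℕ → ℝ → ℝ → Set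
  HasIndependentSolutions {k} ζ j X ν =
    Σ (Fin j → Fin (suc k) → ℤ) λ v →
      LinearlyIndependent v × (∀ i → IsSolution ζ X ν (v i))

  ω-at : {k : ℕ} → (Fin k → ℝ) → ℕ → ℝ → ℝ ±
  ω-at ζ j X = sup {I = ∃ (HasIndependentSolutions ζ j X)} λ (ν , _) → [ ν ]

  ω : {k : ℕ} → (Fin k → ℝ) → ℕ → ℝ ±
  ω ζ j = limsup (ω-at ζ j)

  ω̂ : {k : ℕ} → (Fin k → ℝ) → ℕ → ℝ ±
  ω̂ ζ j = liminf (ω-at ζ j)

{-# OPTIONS --safe #-}
module Submission where

-- Put a n 0 = q n k and a n m = q (n+1) m, write R = a n 0 and Q = a n k, and let σ be the partial sum
-- of ζᵢ that stops at q (n+1) i or at q n i.  Multiplying by a n m makes the truncations at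
-- q (n+1) i for i ≤ m and at q n i for i > m integral; the resulting k + 1 vectors of block n are
-- independent and the m-th one has error about a n m / a n (m+1) = Q^(- η (m+1) + o(1)).  This gives
-- all lower bounds.  Conversely, let (x , y) be a solution with |x| ≤ X and error δ.  If X is small
-- against a n i, the integer R (yᵢ - σ x) with σ stopping at q n i is zero.  The integers
-- a n i (yᵢ - σ x) with σ stopping at q (n+1) i are congruent to - x modulo a n i / R, so that
-- they vanish successively for i = 1, 2, … as long as δ is below Q^(- η i).  The exponents η being
-- increasing, counting these linear equations bounds the number of independent solutions.

open import Defs
open import Axiom.ExcludedMiddle using (ExcludedMiddle)
open import Level using (0ℓ)
open import Data.Empty using (⊥; ⊥-elim)
open import Data.Fin.Base as Fin using (Fin; toℕ)
open import Data.Integer.Base as ℤ using (ℤ; +_; -[1+_])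
open import Data.Bool.Base as Bool using (Bool; true; false)
open import Data.List.Base using (List; []; _∷_)
open import Data.Vec.Base as Vec using (Vec; []; _∷_)
open import Data.Vec.N-ary using (N-ary; _$ⁿ_)
open import Data.Nat.Base as ℕ using (ℕ; zero; suc; _∸_)
open import Data.Nat.Divisibility using (_∣_; divides; ∣-refl; ∣-trans)
open import Data.Product.Base using (Σ; ∃; _×_; _,_; proj₁; proj₂)
open import Data.Sum.Base using (_⊎_; inj₁; inj₂)
open import Relation.Binary.PropositionalEquality as ≡ using (_≡_)
open import Relation.Binary.Structures using (IsTotalOrder)
open import Relation.Nullary using (¬_; yes; no)
open import Relation.Nullary.Construct.Add.Extrema using (_±; ⊥±; ⊤±; [_])
import Algebra.Properties.Ring as RingProperties
import Algebra.Properties.Semiring.Exp as SemiringExp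
import Algebra.Properties.Semiring.Mult as SemiringMult
import Algebra.Properties.Monoid.Mult.TCOptimised as MultTC
import Data.Fin.Properties as Fin
import Data.Integer.Properties as ℤ
import Data.Nat.Properties as ℕ
import Data.Sign.Base as Sign
import Algebra.Construct.NaturalChoice.Max as NaturalMax
import Algebra.Construct.NaturalChoice.Min as NaturalMin
import Algebra.Construct.NaturalChoice.MaxOp as MaxOp
import Algebra.Construct.NaturalChoice.MinOp as MinOp
import Algebra.Properties.CommutativeSemiring.Exp as CommutativeSemiringExp
import Relation.Binary.Construct.Add.Extrema.NonStrict as Ext
import Relation.Binary.Construct.Add.Supremum.NonStrict as SupremumOrder
import Algebra.Definitions.RawSemiring as RawSemiringOps
import Algebra.Properties.CommutativeMonoid.Sum as CommutativeMonoidSum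
import Algebra.Properties.Semiring.Sum as SemiringSum
import Data.Vec.Functional as Functional
import Data.Vec.Functional.Properties as Functional
open import Data.Integer.Tactic.RingSolver using (solve-∀)
open import Relation.Nullary.Decidable using (¬?; decidable-stable)

-- That log q (n+1) 1 / log q n k tends to infinity does two jobs. It makes log R negligible against
-- log Q, so that factors R and 4 shift exponents by at most a small ε; and it makes the first
-- denominator after block n exceed every fixed power of Q, so that the tails behind block n are
-- harmless as long as X is at most a fixed power of Q. Which block serves a given X depends on the
-- exponent ν. The equations from the truncation at q n i need not only X below a n i / R but also
-- an error below 1 / R, and X^(-ν) is that small once X reaches R^(2/ν). Hence in the upper bounds
-- for `ω` block n is responsible for R^(2/ν) ≤ X ≤ Q^(2/ν) instead of R ≤ X ≤ Q. These windows
-- cover all large X because Q is the R of block n + 1. Since a n i and η i increase with i, the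
-- columns with an equation of this kind form a final segment M < i ≤ k ("late"), and those with one
-- from the truncation at q (n+1) i an initial segment i ≤ I ("early"). So 1 + (M - I) coordinates
-- stay free if I ≤ M, and the whole problem is to compare I with M.

module Development (em : ExcludedMiddle 0ℓ) (𝔽 : CompleteOrderedField) where

  open Analysis em 𝔽

  -- Integers in the field and a ring solver

  open SemiringExp semiring using (_^_; ^-congˡ)
  open CommutativeSemiringExp commutativeSemiring using (^-distrib-*)
  open SemiringMult semiring using () renaming (×-homo-+ to ·-homo-+; ×1-homo-* to ·1-homo-*)
  open MultTC +-monoid using (×ᵤ≈×) renaming (_×_ to _·′_)
  open RingProperties ring using (-‿distribˡ-*; -‿distribʳ-*; -‿involutive; -‿+-comm; -0#≈0#)
  open IsTotalOrder isTotalOrder using (≤-resp-≈) renaming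
    (refl to ≤-refl; trans to ≤-trans; reflexive to ≤-reflexive; antisym to ≤-antisym; total to
    ≤-total)
  open MaxOp (NaturalMax.maxOperator totalOrder) using (x≤x⊔y; x≤y⊔x; ⊔-lub; ⊔-sel)
  open MinOp (NaturalMin.minOperator totalOrder) using (x⊓y≤x; x⊓y≤y; ⊓-sel)

  fromℕ-+ : ∀ m n → fromℕ (m ℕ.+ n) ≈ fromℕ m + fromℕ n
  fromℕ-+ = ·-homo-+ 1#

  fromℕ-* : ∀ m n → fromℕ (m ℕ.* n) ≈ fromℕ m * fromℕ n
  fromℕ-* = ·1-homo-*

  fromℤ-⊖ : ∀ m n → fromℤ (m ℤ.⊖ n) ≈ fromℕ m - fromℕ n
  fromℤ-⊖ m       zero    = trans (sym (+-identityʳ _)) (+-congˡ (sym -0#≈0#))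
  fromℤ-⊖ zero    (suc n) = sym (+-identityˡ _)
  fromℤ-⊖ (suc m) (suc n) = begin
    fromℤ (suc m ℤ.⊖ suc n)             ≡⟨ ≡.cong fromℤ (ℤ.[1+m]⊖[1+n]≡m⊖n m n) ⟩
    fromℤ (m ℤ.⊖ n)                     ≈⟨ fromℤ-⊖ m n ⟩
    fromℕ m - fromℕ n                   ≈⟨ +-congʳ (+-identityˡ _) ⟨
    0# + fromℕ m - fromℕ n              ≈⟨ +-congʳ (+-congʳ (-‿inverseʳ 1#)) ⟨
    1# - 1# + fromℕ m - fromℕ n         ≈⟨ +-congʳ (+-assoc _ _ _) ⟩
    1# + (- 1# + fromℕ m) - fromℕ n     ≈⟨ +-congʳ (+-congˡ (+-comm _ _)) ⟩
    1# + (fromℕ m - 1#) - fromℕ n       ≈⟨ +-congʳ (+-assoc _ _ _) ⟨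
    1# + fromℕ m - 1# - fromℕ n         ≈⟨ +-assoc _ _ _ ⟩
    1# + fromℕ m + (- 1# - fromℕ n)     ≈⟨ +-congˡ (-‿+-comm _ _) ⟩
    fromℕ (suc m) - fromℕ (suc n)       ∎
    where open import Relation.Binary.Reasoning.Setoid setoid

  fromℤ-neg : ∀ i → fromℤ (ℤ.- i) ≈ - fromℤ i
  fromℤ-neg (+ zero)    = sym -0#≈0#
  fromℤ-neg (+ suc n)   = refl
  fromℤ-neg (-[1+ n ])  = sym (-‿involutive _)

  fromℤ-+ : ∀ i j → fromℤ (i ℤ.+ j) ≈ fromℤ i + fromℤ j
  fromℤ-+ (+ m)      (+ n)      = fromℕ-+ m n
  fromℤ-+ (+ m)      (-[1+ n ]) = fromℤ-⊖ m (suc n)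
  fromℤ-+ (-[1+ m ]) (+ n)      = trans (fromℤ-⊖ n (suc m)) (+-comm _ _)
  fromℤ-+ (-[1+ m ]) (-[1+ n ]) = trans
    (-‿cong (trans (reflexive (≡.cong (λ t → fromℕ (suc t)) (≡.sym (ℕ.+-suc m n))))
      (fromℕ-+ (suc m) (suc n))))
    (sym (-‿+-comm _ _))

  fromℤ-* : ∀ i j → fromℤ (i ℤ.* j) ≈ fromℤ i * fromℤ j
  fromℤ-* (+ m)      (+ n)      = trans (reflexive (≡.cong fromℤ (ℤ.+◃n≡+n (m ℕ.* n))))
    (fromℕ-* m n)
  fromℤ-* (+ m)      (-[1+ n ]) = begin
    fromℤ (Sign.- ℤ.◃ m ℕ.* suc n)  ≡⟨ ≡.cong fromℤ (ℤ.-◃n≡-n (m ℕ.* suc n)) ⟩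
    fromℤ (ℤ.- (+ (m ℕ.* suc n)))   ≈⟨ fromℤ-neg (+ (m ℕ.* suc n)) ⟩
    - fromℕ (m ℕ.* suc n)           ≈⟨ -‿cong (fromℕ-* m (suc n)) ⟩
    - (fromℕ m * fromℕ (suc n))     ≈⟨ -‿distribʳ-* _ _ ⟩
    fromℕ m * - fromℕ (suc n)       ∎
    where open import Relation.Binary.Reasoning.Setoid setoid
  fromℤ-* (-[1+ m ]) (+ n)      = begin
    fromℤ (Sign.- ℤ.◃ suc m ℕ.* n)  ≡⟨ ≡.cong fromℤ (ℤ.-◃n≡-n (suc m ℕ.* n)) ⟩
    fromℤ (ℤ.- (+ (suc m ℕ.* n)))   ≈⟨ fromℤ-neg (+ (suc m ℕ.* n)) ⟩
    - fromℕ (suc m ℕ.* n)           ≈⟨ -‿cong (fromℕ-* (suc m) n) ⟩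
    - (fromℕ (suc m) * fromℕ n)     ≈⟨ -‿distribˡ-* _ _ ⟩
    - fromℕ (suc m) * fromℕ n       ∎
    where open import Relation.Binary.Reasoning.Setoid setoid
  fromℤ-* (-[1+ m ]) (-[1+ n ]) = begin
    fromℕ (suc m ℕ.* suc n)             ≈⟨ fromℕ-* (suc m) (suc n) ⟩
    fromℕ (suc m) * fromℕ (suc n)       ≈⟨ -‿involutive _ ⟨
    - - (fromℕ (suc m) * fromℕ (suc n)) ≈⟨ -‿cong (-‿distribˡ-* _ _) ⟩
    - (- fromℕ (suc m) * fromℕ (suc n)) ≈⟨ -‿distribʳ-* _ _ ⟩
    - fromℕ (suc m) * - fromℕ (suc n)   ∎
    where open import Relation.Binary.Reasoning.Setoid setoid

  -- Unlike fromℤ this sends + 1 to 1# definitionally, so that 1# is a solver constant.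
  numeral : ℤ → ℝ
  numeral (+ n)    = n ·′ 1#
  numeral -[1+ n ] = - (suc n ·′ 1#)

  fromℤ≈numeral : ∀ i → fromℤ i ≈ numeral i
  fromℤ≈numeral (+ n)    = ×ᵤ≈× n 1#
  fromℤ≈numeral -[1+ n ] = -‿cong (×ᵤ≈× (suc n) 1#)

  numeral-+ : ∀ i j → numeral (i ℤ.+ j) ≈ numeral i + numeral j
  numeral-+ i j = trans (sym (fromℤ≈numeral (i ℤ.+ j)))
    (trans (fromℤ-+ i j) (+-cong (fromℤ≈numeral i) (fromℤ≈numeral j)))

  numeral-* : ∀ i j → numeral (i ℤ.* j) ≈ numeral i * numeral j
  numeral-* i j = trans (sym (fromℤ≈numeral (i ℤ.* j)))
    (trans (fromℤ-* i j) (*-cong (fromℤ≈numeral i) (fromℤ≈numeral j)))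

  -- The solver decides p - q = 0 on closed sparse normal forms.  Comparing the values of
  -- normal forms at open terms, as Algebra.Solver.Ring does, is too slow for the identities below.

  infixl 6 _:+_ _:-_
  infixl 7 _:*_
  infix  8 :-_
  infix  4 _:=_

  data Expr (n : ℕ) : Set where
    var       : Fin n → Expr n
    con       : ℤ → Expr n
    _:+_ _:*_ : Expr n → Expr n → Expr n
    :-_       : Expr n → Expr n

  _:-_ : ∀ {n} → Expr n → Expr n → Expr n
  p :- q = p :+ :- q

  κ : ∀ {n} → ℕ → Expr n
  κ c = con (+ c)

  _:=_ : ∀ {n} → Expr n → Expr n → Expr n × Expr n
  _:=_ = _,_

  ⟦_⟧ : ∀ {n} → Expr n → Vec ℝ n → ℝ
  ⟦ var i ⟧  ρ = Vec.lookup ρ i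
  ⟦ con c ⟧  ρ = numeral c
  ⟦ p :+ q ⟧ ρ = ⟦ p ⟧ ρ + ⟦ q ⟧ ρ
  ⟦ p :* q ⟧ ρ = ⟦ p ⟧ ρ * ⟦ q ⟧ ρ
  ⟦ :- p ⟧   ρ = - ⟦ p ⟧ ρ

  private
    Mono Poly : ℕ → Set
    Mono n = List (Fin n)
    Poly n = List (ℤ × Mono n)

    data Compared {A : Set} (x y : A) : Set where
      less greater : Compared x y
      equal        : x ≡ y → Compared x y

    compareFin : ∀ {n} (i j : Fin n) → Compared i j
    compareFin Fin.zero    Fin.zero    = equal ≡.refl
    compareFin Fin.zero    (Fin.suc _) = less
    compareFin (Fin.suc _) Fin.zero    = greater
    compareFin (Fin.suc i) (Fin.suc j) with compareFin i j
    ... | less         = less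
    ... | greater      = greater
    ... | equal ≡.refl = equal ≡.refl

    compareMono : ∀ {n} (l m : Mono n) → Compared l m
    compareMono []      []      = equal ≡.refl
    compareMono []      (_ ∷ _) = less
    compareMono (_ ∷ _) []      = greater
    compareMono (i ∷ l) (j ∷ m) with compareFin i j
    ... | less         = less
    ... | greater      = greater
    ... | equal ≡.refl with compareMono l m
    ...   | less         = less
    ...   | greater      = greater
    ...   | equal ≡.refl = equal ≡.refl

    insertVar : ∀ {n} → Fin n → Mono n → Mono n
    insertVar i []      = i ∷ []
    insertVar i (j ∷ m) with compareFin i j
    ... | greater = j ∷ insertVar i m
    ... | _       = i ∷ j ∷ m

    mulMono : ∀ {n} → Mono n → Mono n → Mono n
    mulMono []      m = m
    mulMono (i ∷ l) m = insertVar i (mulMono l m)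

    insertTerm : ∀ {n} → ℤ → Mono n → Poly n → Poly n
    insertTerm c l []            = (c , l) ∷ []
    insertTerm c l ((d , m) ∷ p) with compareMono l m
    ... | less    = (c , l) ∷ (d , m) ∷ p
    ... | equal _ = (c ℤ.+ d , m) ∷ p
    ... | greater = (d , m) ∷ insertTerm c l p

    addPoly : ∀ {n} → Poly n → Poly n → Poly n
    addPoly []            q = q
    addPoly ((c , l) ∷ p) q = insertTerm c l (addPoly p q)

    mulTerm : ∀ {n} → ℤ → Mono n → Poly n → Poly n
    mulTerm c l []            = []
    mulTerm c l ((d , m) ∷ p) = insertTerm (c ℤ.* d) (mulMono l m) (mulTerm c l p)

    mulPoly : ∀ {n} → Poly n → Poly n → Poly n
    mulPoly []            q = []
    mulPoly ((c , l) ∷ p) q = addPoly (mulTerm c l q) (mulPoly p q)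

    normalise : ∀ {n} → Expr n → Poly n
    normalise (var i)  = (+ 1 , i ∷ []) ∷ []
    normalise (con c)  = (c , []) ∷ []
    normalise (p :+ q) = addPoly (normalise p) (normalise q)
    normalise (p :* q) = mulPoly (normalise p) (normalise q)
    normalise (:- p)   = mulTerm -[1+ 0 ] [] (normalise p)

    -- Cancelled monomials stay in the list with coefficient 0, so zero is recognised by its
    -- coefficients and not by emptiness.
    isZero : ∀ {n} → Poly n → Bool
    isZero []                  = true
    isZero ((+ zero , _) ∷ p)  = isZero p
    isZero (_ ∷ _)             = false

    module _ {n : ℕ} (ρ : Vec ℝ n) where
      open import Relation.Binary.Reasoning.Setoid setoid

      ⟦_⟧ᵐ : Mono n → ℝ
      ⟦ [] ⟧ᵐ    = 1#
      ⟦ i ∷ l ⟧ᵐ = Vec.lookup ρ i * ⟦ l ⟧ᵐ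

      ⟦_⟧ᵖ : Poly n → ℝ
      ⟦ [] ⟧ᵖ          = 0#
      ⟦ (c , l) ∷ p ⟧ᵖ = numeral c * ⟦ l ⟧ᵐ + ⟦ p ⟧ᵖ

      swap-* : ∀ x y z → x * (y * z) ≈ y * (x * z)
      swap-* x y z = trans (sym (*-assoc x y z)) (trans (*-congʳ (*-comm x y)) (*-assoc y x z))

      swap-+ : ∀ x y z → x + (y + z) ≈ y + (x + z)
      swap-+ x y z = trans (sym (+-assoc x y z)) (trans (+-congʳ (+-comm x y)) (+-assoc y x z))

      insertVar-≈ : ∀ i m → ⟦ insertVar i m ⟧ᵐ ≈ Vec.lookup ρ i * ⟦ m ⟧ᵐ
      insertVar-≈ i []      = refl
      insertVar-≈ i (j ∷ m) with compareFin i j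
      ... | less    = refl
      ... | equal _ = refl
      ... | greater = trans (*-congˡ (insertVar-≈ i m)) (swap-* _ _ _)

      mulMono-≈ : ∀ l m → ⟦ mulMono l m ⟧ᵐ ≈ ⟦ l ⟧ᵐ * ⟦ m ⟧ᵐ
      mulMono-≈ []      m = sym (*-identityˡ _)
      mulMono-≈ (i ∷ l) m = trans (insertVar-≈ i (mulMono l m))
        (trans (*-congˡ (mulMono-≈ l m)) (sym (*-assoc _ _ _)))

      insertTerm-≈ : ∀ c l p → ⟦ insertTerm c l p ⟧ᵖ ≈ numeral c * ⟦ l ⟧ᵐ + ⟦ p ⟧ᵖ
      insertTerm-≈ c l []            = refl
      insertTerm-≈ c l ((d , m) ∷ p) with compareMono l m
      ... | less         = refl
      ... | equal ≡.refl = trans (+-congʳ (trans (*-congʳ (numeral-+ c d)) (distribʳ _ _ _)))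
        (+-assoc _ _ _)
      ... | greater      = trans (+-congˡ (insertTerm-≈ c l p)) (swap-+ _ _ _)

      addPoly-≈ : ∀ p q → ⟦ addPoly p q ⟧ᵖ ≈ ⟦ p ⟧ᵖ + ⟦ q ⟧ᵖ
      addPoly-≈ []            q = sym (+-identityˡ _)
      addPoly-≈ ((c , l) ∷ p) q = trans (insertTerm-≈ c l (addPoly p q))
        (trans (+-congˡ (addPoly-≈ p q)) (sym (+-assoc _ _ _)))

      mulTerm-≈ : ∀ c l p → ⟦ mulTerm c l p ⟧ᵖ ≈ (numeral c * ⟦ l ⟧ᵐ) * ⟦ p ⟧ᵖ
      mulTerm-≈ c l []            = sym (zeroʳ _)
      mulTerm-≈ c l ((d , m) ∷ p) = begin
        ⟦ insertTerm (c ℤ.* d) (mulMono l m) (mulTerm c l p) ⟧ᵖ                ≈⟨ insertTerm-≈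
          (c ℤ.* d) (mulMono l m) (mulTerm c l p) ⟩
        numeral (c ℤ.* d) * ⟦ mulMono l m ⟧ᵐ + ⟦ mulTerm c l p ⟧ᵖ              ≈⟨ +-cong
          (*-cong (numeral-* c d) (mulMono-≈ l m)) (mulTerm-≈ c l p) ⟩
        (numeral c * numeral d) * (⟦ l ⟧ᵐ * ⟦ m ⟧ᵐ) + (numeral c * ⟦ l ⟧ᵐ) * ⟦ p ⟧ᵖ ≈⟨ +-congʳ
          (trans (*-assoc _ _ _) (trans (*-congˡ (swap-* _ _ _)) (sym (*-assoc _ _ _)))) ⟩
        (numeral c * ⟦ l ⟧ᵐ) * (numeral d * ⟦ m ⟧ᵐ) + (numeral c * ⟦ l ⟧ᵐ) * ⟦ p ⟧ᵖ ≈⟨ distribˡ _ _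
          _ ⟨
        (numeral c * ⟦ l ⟧ᵐ) * (numeral d * ⟦ m ⟧ᵐ + ⟦ p ⟧ᵖ)                   ∎

      mulPoly-≈ : ∀ p q → ⟦ mulPoly p q ⟧ᵖ ≈ ⟦ p ⟧ᵖ * ⟦ q ⟧ᵖ
      mulPoly-≈ []            q = sym (zeroˡ _)
      mulPoly-≈ ((c , l) ∷ p) q = trans (addPoly-≈ (mulTerm c l q) (mulPoly p q))
        (trans (+-cong (mulTerm-≈ c l q) (mulPoly-≈ p q)) (sym (distribʳ _ _ _)))

      normalise-≈ : ∀ p → ⟦ normalise p ⟧ᵖ ≈ ⟦ p ⟧ ρ
      normalise-≈ (var i)  = trans (+-identityʳ _) (trans (*-identityˡ _) (*-identityʳ _))
      normalise-≈ (con c)  = trans (+-identityʳ _) (*-identityʳ _)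
      normalise-≈ (p :+ q) = trans (addPoly-≈ (normalise p) (normalise q))
        (+-cong (normalise-≈ p) (normalise-≈ q))
      normalise-≈ (p :* q) = trans (mulPoly-≈ (normalise p) (normalise q))
        (*-cong (normalise-≈ p) (normalise-≈ q))
      normalise-≈ (:- p)   = trans (mulTerm-≈ -[1+ 0 ] [] (normalise p))
        (trans (*-cong (*-identityʳ _) (normalise-≈ p))
          (trans (sym (-‿distribˡ-* _ _)) (-‿cong (*-identityˡ _))))

      isZero-≈ : ∀ p → Bool.T (isZero p) → ⟦ p ⟧ᵖ ≈ 0#
      isZero-≈ []                 _ = refl
      isZero-≈ ((+ zero , l) ∷ p) h = trans (+-cong (zeroˡ _) (isZero-≈ p h)) (+-identityˡ _)

    sides : ∀ n → N-ary n (Expr n) (Expr n × Expr n) → Expr n × Expr n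
    sides n f = f $ⁿ Vec.tabulate var

  -- For a valid identity the hidden argument has type `Bool.T true` after evaluation and is filled
  -- in by eta; for an invalid one it cannot be filled.
  solve : ∀ n (f : N-ary n (Expr n) (Expr n × Expr n)) →
          {_ : Bool.T (isZero (normalise (proj₁ (sides n f) :- proj₂ (sides n f))))} →
          (ρ : Vec ℝ n) → ⟦ proj₁ (sides n f) ⟧ ρ ≈ ⟦ proj₂ (sides n f) ⟧ ρ
  solve n f {zero-diff} ρ = begin
    ⟦ p ⟧ ρ                                ≈⟨ +-identityʳ _ ⟨
    ⟦ p ⟧ ρ + 0#                           ≈⟨ +-congˡ (-‿inverseˡ _) ⟨
    ⟦ p ⟧ ρ + (- ⟦ q ⟧ ρ + ⟦ q ⟧ ρ)        ≈⟨ +-assoc _ _ _ ⟨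
    ⟦ p :- q ⟧ ρ + ⟦ q ⟧ ρ                 ≈⟨ +-congʳ (normalise-≈ ρ (p :- q)) ⟨
    ⟦_⟧ᵖ ρ (normalise (p :- q)) + ⟦ q ⟧ ρ  ≈⟨ +-congʳ (isZero-≈ ρ (normalise (p :- q)) zero-diff) ⟩
    0# + ⟦ q ⟧ ρ                           ≈⟨ +-identityˡ _ ⟩
    ⟦ q ⟧ ρ                                ∎
    where
    open import Relation.Binary.Reasoning.Setoid setoid
    p = proj₁ (sides n f)
    q = proj₂ (sides n f)

  -- Inequalities by nonnegative certificates

  2# 3# 4# : ℝ
  2# = 1# + 1#
  3# = 2# + 1#
  4# = 3# + 1#

  ≤-diff : ∀ {x y} → x ≤ y → 0# ≤ y - x
  ≤-diff {x} {y} h = proj₁ ≤-resp-≈ refl (proj₂ ≤-resp-≈ (-‿inverseʳ x) (+-monoˡ-≤ (- x) h))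

  -- Inequalities below are proved by certificates: y - x is written as a sum of terms that are
  -- visibly nonnegative (equations enter with an arbitrary factor through eq-nonneg).
  ≤-by : ∀ {x y e} → 0# ≤ e → y - x ≈ e → x ≤ y
  ≤-by {x} {y} {e} h p = proj₁ ≤-resp-≈ (trans (+-congʳ (sym p))
    (solve 2 (λ y x → y :- x :+ x := y) (y ∷ x ∷ [])))
    (proj₂ ≤-resp-≈ (+-identityˡ x) (+-monoˡ-≤ x h))

  ≈-diff : ∀ w {u v} → u ≈ v → w * (u - v) ≈ 0#
  ≈-diff w {u} {v} p = trans (*-congˡ (trans (+-congʳ p) (-‿inverseʳ v)))
    (solve 1 (λ w → w :* κ 0 := κ 0) (w ∷ []))

  ≈0-+ : ∀ {x y} → x ≈ 0# → y ≈ 0# → x + y ≈ 0#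
  ≈0-+ p r = trans (+-cong p r) (+-identityˡ 0#)

  ≈-by : ∀ {x y e} → e ≈ 0# → x - y ≈ e → x ≈ y
  ≈-by {x} {y} {e} p r = trans (solve 2 (λ x y → x := x :- y :+ y) (x ∷ y ∷ []))
    (trans (+-congʳ (trans r p)) (+-identityˡ y))

  eq-nonneg : ∀ w {u v} → u ≈ v → 0# ≤ w * (u - v)
  eq-nonneg w p = ≤-reflexive (sym (≈-diff w p))

  +-nonneg : ∀ {x y} → 0# ≤ x → 0# ≤ y → 0# ≤ x + y
  +-nonneg {x} {y} p r = ≤-trans r (≤-by p (solve 2 (λ x y → x :+ y :- y := x) (x ∷ y ∷ [])))

  <⇒≤ : ∀ {x y} → x < y → x ≤ y
  <⇒≤ = proj₁

  <⇒≱ : ∀ {x y} → x < y → ¬ (y ≤ x)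
  <⇒≱ (p , n) r = n (≤-antisym p r)

  ≰⇒> : ∀ {x y} → ¬ (x ≤ y) → y < x
  ≰⇒> {x} {y} n with ≤-total x y
  ... | inj₁ p = ⊥-elim (n p)
  ... | inj₂ p = p , λ e → n (≤-reflexive (sym e))

  ≤⊎> : ∀ x y → x ≤ y ⊎ y < x
  ≤⊎> x y with em {x ≤ y}
  ... | yes p = inj₁ p
  ... | no n  = inj₂ (≰⇒> n)

  ≮⇒≥ : ∀ {x y} → ¬ (x < y) → y ≤ x
  ≮⇒≥ {x} {y} n with ≤⊎> y x
  ... | inj₁ p = p
  ... | inj₂ p = ⊥-elim (n p)

  ≤-<-trans : ∀ {x y z} → x ≤ y → y < z → x < z
  ≤-<-trans p r = ≰⇒> λ s → <⇒≱ r (≤-trans s p)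

  <-≤-trans : ∀ {x y z} → x < y → y ≤ z → x < z
  <-≤-trans p r = ≰⇒> λ s → <⇒≱ p (≤-trans r s)

  ≤-respˡ : ∀ {x y z} → x ≈ y → x ≤ z → y ≤ z
  ≤-respˡ e = proj₂ ≤-resp-≈ e

  ≤-respʳ : ∀ {x y z} → x ≈ y → z ≤ x → z ≤ y
  ≤-respʳ e = proj₁ ≤-resp-≈ e

  <-respˡ : ∀ {x y z} → x ≈ y → x < z → y < z
  <-respˡ e h = ≤-<-trans (≤-reflexive (sym e)) h

  <-respʳ : ∀ {x y z} → x ≈ y → z < x → z < y
  <-respʳ e h = <-≤-trans h (≤-reflexive e)

  <-diff : ∀ {x y} → x < y → 0# < y - x
  <-diff {x} {y} h = ≰⇒> λ p → <⇒≱ h (≤-by (≤-diff p)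
    (solve 2 (λ x y → x :- y := κ 0 :- (y :- x)) (x ∷ y ∷ [])))

  <-by : ∀ {x y e} → 0# < e → y - x ≈ e → x < y
  <-by {x} {y} {e} h p = ≰⇒> λ r → <⇒≱ h (≤-by (≤-diff r)
    (trans (solve 1 (λ e → κ 0 :- e := :- e) (e ∷ []))
    (trans (-‿cong (sym p)) (solve 2 (λ y x → :- (y :- x) := x :- y) (y ∷ x ∷ [])))))

  +-pos-nonneg : ∀ {x y} → 0# < x → 0# ≤ y → 0# < x + y
  +-pos-nonneg {x} {y} p r = <-≤-trans p (≤-by r (solve 2 (λ x y → x :+ y :- x := y) (x ∷ y ∷ [])))

  *-pos : ∀ {x y} → 0# < x → 0# < y → 0# < x * y
  *-pos {x} {y} (p , p≢) (r , r≢) = *-nonneg p r , λ e → p≢ (sym (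
    (≈-by (≈0-+ (≈-diff (y ⁻¹) (sym e)) (≈-diff (- x) (⁻¹-inverseʳ y (λ y≈0 → r≢ (sym y≈0)))))
      (solve 3 (λ x a y → x :- κ 0 := a :* (x :* y :- κ 0) :+ :- x :* (y :* a :- κ 1))
      (x ∷ (y ⁻¹) ∷ y ∷ [])))))

  -- Order, the Archimedean property and limits

  0≤x*x : ∀ x → 0# ≤ x * x
  0≤x*x x with ≤-total 0# x
  ... | inj₁ p = *-nonneg p p
  ... | inj₂ p = (≤-by (*-nonneg (≤-diff p) (≤-diff p))
    (solve 1 (λ x → x :* x :- κ 0 := (κ 0 :- x) :* (κ 0 :- x)) (x ∷ [])))

  0<1 : 0# < 1#
  0<1 = ≤-respʳ (*-identityˡ 1#) (0≤x*x 1#) , 0≉1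

  0≤1 : 0# ≤ 1#
  0≤1 = <⇒≤ 0<1

  0<2 : 0# < 2#
  0<2 = +-pos-nonneg 0<1 0≤1

  0<4 : 0# < 4#
  0<4 = +-pos-nonneg (+-pos-nonneg 0<2 0≤1) 0≤1

  pos⇒≉0 : ∀ {x} → 0# < x → ¬ (x ≈ 0#)
  pos⇒≉0 h e = proj₂ h (sym e)

  pos-⁻¹ : ∀ {x} → 0# < x → x * x ⁻¹ ≈ 1#
  pos-⁻¹ h = ⁻¹-inverseʳ _ (pos⇒≉0 h)

  ⁻¹-pos : ∀ {x} → 0# < x → 0# < x ⁻¹
  ⁻¹-pos {x} h = ≰⇒> λ p → <⇒≱ 0<1
    (≤-by (+-nonneg (*-nonneg (<⇒≤ h) (≤-diff p)) (eq-nonneg 1# (pos-⁻¹ h)))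
      (solve 2 (λ x a → κ 0 :- κ 1 := x :* (κ 0 :- a) :+ κ 1 :* (x :* a :- κ 1)) (x ∷ (x ⁻¹) ∷ [])))

  /-nonneg : ∀ {x y} → 0# ≤ x → 0# < y → 0# ≤ x / y
  /-nonneg p h = *-nonneg p (<⇒≤ (⁻¹-pos h))

  /-pos : ∀ {x y} → 0# < x → 0# < y → 0# < x / y
  /-pos p h = *-pos p (⁻¹-pos h)

  *-cancelʳ-≤ : ∀ {x y z} → 0# < z → x * z ≤ y * z → x ≤ y
  *-cancelʳ-≤ {x} {y} {z} h p = (≤-by (+-nonneg (*-nonneg (≤-diff p) (<⇒≤ (⁻¹-pos h)))
    (eq-nonneg (x - y) (pos-⁻¹ h))) (solve 4 (λ y x z a →
    y :- x := (y :* z :- x :* z) :* a :+ (x :- y) :* (z :* a :- κ 1)) (y ∷ x ∷ z ∷ (z ⁻¹) ∷ [])))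

  *-cancelʳ-< : ∀ {x y z} → 0# ≤ z → x * z < y * z → x < y
  *-cancelʳ-< {x} {y} {z} h p = ≰⇒> λ r → <⇒≱ p
    (≤-by (*-nonneg (≤-diff r) h) (solve 3 (λ x z y → x :* z :- y :* z := (x :- y) :* z)
    (x ∷ z ∷ y ∷ [])))

  *-cancelʳ-≈ : ∀ {x y z} → 0# < z → x * z ≈ y * z → x ≈ y
  *-cancelʳ-≈ h e = ≤-antisym (*-cancelʳ-≤ h (≤-reflexive e)) (*-cancelʳ-≤ h (≤-reflexive (sym e)))

  x/z*z : ∀ {x z} → 0# < z → x / z * z ≈ x
  x/z*z {x} {z} h = (≈-by (≈-diff x (pos-⁻¹ h))
    (solve 3 (λ x a z → x :* a :* z :- x := x :* (z :* a :- κ 1)) (x ∷ (z ⁻¹) ∷ z ∷ [])))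

  fromℕ-nonneg : ∀ n → 0# ≤ fromℕ n
  fromℕ-nonneg zero    = ≤-refl
  fromℕ-nonneg (suc n) = +-nonneg 0≤1 (fromℕ-nonneg n)

  fromℕ-pos : ∀ {n} → 1 ℕ.≤ n → 0# < fromℕ n
  fromℕ-pos {suc n} _ = +-pos-nonneg 0<1 (fromℕ-nonneg n)

  fromℕ-mono-≤ : ∀ {m n} → m ℕ.≤ n → fromℕ m ≤ fromℕ n
  fromℕ-mono-≤ {m} {n} h = (≤-by (+-nonneg (fromℕ-nonneg (n ∸ m))
    (eq-nonneg 1# (trans (reflexive (≡.cong fromℕ (≡.sym (ℕ.m+[n∸m]≡n h)))) (fromℕ-+ m (n ∸ m)))))
    (solve 3 (λ a b c → a :- b := c :+ κ 1 :* (a :- (b :+ c)))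
    ((fromℕ n) ∷ (fromℕ m) ∷ (fromℕ (n ∸ m)) ∷ [])))

  1≤fromℕ : ∀ {n} → 1 ℕ.≤ n → 1# ≤ fromℕ n
  1≤fromℕ {n} h = ≤-respˡ (+-identityʳ 1#) (fromℕ-mono-≤ h)

  -- Discreteness of the integers: every linear equation for solutions is obtained from it, through
  -- `isInt-small`.
  fromℤ-small : ∀ i → fromℤ i < 1# → - fromℤ i < 1# → i ≡ ℤ.0ℤ
  fromℤ-small (+ zero)  _ _ = ≡.refl
  fromℤ-small (+ suc n) h _ = ⊥-elim (<⇒≱ h (1≤fromℕ {suc n} (ℕ.s≤s ℕ.z≤n)))
  fromℤ-small -[1+ n ]  _ h = ⊥-elim (<⇒≱ h (≤-trans (1≤fromℕ {suc n} (ℕ.s≤s ℕ.z≤n))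
    (≤-reflexive (solve 1 (λ x → x := :- (:- x)) (fromℕ (suc n) ∷ [])))))

  fromℤ-injective : ∀ i j → fromℤ i ≈ fromℤ j → i ≡ j
  fromℤ-injective i j e = ℤ.i-j≡0⇒i≡j i j (fromℤ-small (i ℤ.- j)
    (<-respˡ (sym zero-diff) 0<1) (<-respˡ (trans (sym (solve 0 (:- (κ 0) := κ 0) []))
      (-‿cong (sym zero-diff))) 0<1))
    where
    zero-diff : fromℤ (i ℤ.- j) ≈ 0#
    zero-diff = trans (fromℤ-+ i (ℤ.- j)) (trans (+-cong e (fromℤ-neg j)) (-‿inverseʳ _))

  x≤∣x∣ : ∀ x → x ≤ ∣ x ∣
  x≤∣x∣ x = x≤x⊔y x (- x)

  -x≤∣x∣ : ∀ x → - x ≤ ∣ x ∣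
  -x≤∣x∣ x = x≤y⊔x x (- x)

  ∣x∣≤ : ∀ {x b} → x ≤ b → - x ≤ b → ∣ x ∣ ≤ b
  ∣x∣≤ = ⊔-lub

  ∣x∣< : ∀ {x b} → x < b → - x < b → ∣ x ∣ < b
  ∣x∣< {x} {b} p r with ⊔-sel x (- x)
  ... | inj₁ e = <-respˡ (sym e) p
  ... | inj₂ e = <-respˡ (sym e) r

  ∣∣-nonneg : ∀ x → 0# ≤ ∣ x ∣
  ∣∣-nonneg x with ≤-total 0# x
  ... | inj₁ p = ≤-trans p (x≤∣x∣ x)
  ... | inj₂ p = ≤-trans (≤-by (≤-diff p) (solve 1 (λ x → :- x :- κ 0 := κ 0 :- x) (x ∷ [])))
    (-x≤∣x∣ x)

  pos-⊓ : ∀ {x y} → 0# < x → 0# < y → 0# < x ⊓ y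
  pos-⊓ {x} {y} p r with ⊓-sel x y
  ... | inj₁ e = <-respʳ (sym e) p
  ... | inj₂ e = <-respʳ (sym e) r

  -- Otherwise the set of naturals has a supremum s. Since n + 1 ≤ s for every n, already s - 1 is
  -- an upper bound.
  archimedean : ∀ x → ∃ λ n → x < fromℕ n
  archimedean x with em {∃ λ n → x < fromℕ n}
  ... | yes p = p
  ... | no ∄n = ⊥-elim (<⇒≱ s-1<s (least (s - 1#) s-1-upper))
    where
    P : ℝ → Set
    P y = ∃ λ n → y ≤ fromℕ n
    S = complete P (0# , 0 , ≤-refl) (x , λ y (n , p) → ≤-trans p (≮⇒≥ λ h → ∄n (n , h)))
    s = proj₁ S
    least = proj₂ (proj₂ S)
    s-1<s : s - 1# < s
    s-1<s = (<-by 0<1 (solve 1 (λ s → s :- (s :- κ 1) := κ 1) (s ∷ [])))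
    s-1-upper : ∀ y → P y → y ≤ s - 1#
    s-1-upper y (n , p) = (≤-by (+-nonneg (≤-diff p)
      (≤-diff (proj₁ (proj₂ S) (fromℕ (suc n)) (suc n , ≤-refl))))
      (solve 3 (λ s y a → s :- κ 1 :- y := a :- y :+ (s :- (κ 1 :+ a))) (s ∷ y ∷ (fromℕ n) ∷ [])))

  -- Eventual truth and convergence of sequences

  Eventually : (ℕ → Set) → Set
  Eventually P = ∃ λ N → ∀ n → N ℕ.≤ n → P n

  eventually-× : ∀ {P Q : ℕ → Set} → Eventually P → Eventually Q → Eventually (λ n → P n × Q n)
  eventually-× (M , p) (N , r) = M ℕ.⊔ N , λ n h →
    p n (ℕ.≤-trans (ℕ.m≤m⊔n M N) h) , r n (ℕ.≤-trans (ℕ.m≤n⊔m M N) h)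

  eventually-map : ∀ {P Q : ℕ → Set} → (∀ n → P n → Q n) → Eventually P → Eventually Q
  eventually-map f (N , p) = N , λ n h → f n (p n h)

  eventually-∀< : ∀ {P : ℕ → ℕ → Set} m → (∀ i → i ℕ.< m → Eventually (P i)) →
    Eventually (λ n → ∀ i → i ℕ.< m → P i n)
  eventually-∀< zero    p = 0 , λ _ _ _ ()
  eventually-∀< {P} (suc m) p =
    eventually-map extend (eventually-× (eventually-∀< m (λ i i<m → p i (ℕ.m<n⇒m<1+n i<m)))
      (p m (ℕ.n<1+n m)))
    where
    extend : ∀ n → (∀ i → i ℕ.< m → P i n) × P m n → ∀ i → i ℕ.< suc m → P i n
    extend n (below , top) i i<1+m with ℕ.m≤n⇒m<n∨m≡n (ℕ.≤-pred i<1+m)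
    ... | inj₁ i<m    = below i i<m
    ... | inj₂ ≡.refl = top

  eventually-≥ : ∀ m → Eventually (m ℕ.≤_)
  eventually-≥ m = m , λ _ h → h

  large-ℕ : ∀ x → Eventually (λ n → x < fromℕ n)
  large-ℕ x with archimedean x
  ... | N , p = N , λ n h → <-≤-trans p (fromℕ-mono-≤ h)

  ⟶-resp : ∀ {f g L M} → Eventually (λ n → f n ≈ g n) → L ≈ M → f ⟶ L → g ⟶ M
  ⟶-resp {f} {g} {L} {M} e l h ε ε>0 = eventually-map close (eventually-× e (h ε ε>0))
    where
    close : ∀ n → f n ≈ g n × ∣ f n - L ∣ < ε → ∣ g n - M ∣ < ε
    close n (p , r) = ∣x∣<
      (<-respˡ (+-cong p (-‿cong l)) (≤-<-trans (x≤∣x∣ _) r))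
      (<-respˡ (-‿cong (+-cong p (-‿cong l))) (≤-<-trans (-x≤∣x∣ _) r))

  ⟶-≤ : ∀ {f L b} → f ⟶ L → Eventually (λ n → f n ≤ b) → L ≤ b
  ⟶-≤ {f} {L} {b} h e = ≮⇒≥ λ b<L → absurd b<L (eventually-× (h (L - b) (<-diff b<L)) e)
    where
    absurd : b < L → Eventually (λ n → ∣ f n - L ∣ < L - b × f n ≤ b) → ⊥
    absurd b<L (N , p) with p N ℕ.≤-refl
    ... | r , s = <⇒≱ (≤-<-trans (-x≤∣x∣ _) r)
      (≤-by (≤-diff s) (solve 3 (λ a L b → :- (a :- L) :- (L :- b) := b :- a) ((f N) ∷ L ∷ b ∷ [])))

  ⟶-unique : ∀ {f L M} → f ⟶ L → f ⟶ M → L ≈ M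
  ⟶-unique {f} {L} {M} h g = ≤-antisym (below h g) (below g h)
    where
    below : ∀ {L M} → f ⟶ L → f ⟶ M → L ≤ M
    below {L} {M} h g = ≮⇒≥ λ M<L → <⇒≱ (half M<L)
      (⟶-≤ h (eventually-map (λ n r → (≤-by (≤-diff (≤-trans (x≤∣x∣ _) (<⇒≤ r)))
        (solve 4 (λ M L a b → M :+ (L :- M) :* a :- b := (L :- M) :* a :- (b :- M))
        (M ∷ L ∷ (2# ⁻¹) ∷ (f n) ∷ []))))
        (g ((L - M) / 2#) (/-pos (<-diff M<L) 0<2))))
      where
      half : M < L → M + (L - M) / 2# < L
      half M<L = *-cancelʳ-< (<⇒≤ 0<2)
        (<-by (+-pos-nonneg (<-diff M<L) (eq-nonneg (M - L) (pos-⁻¹ 0<2)))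
          (solve 3 (λ L M a → L :* κ 2 :- (M :+ (L :- M) :* a) :* κ 2 := L :- M :+ (M :- L) :*
          (κ 2 :* a :- κ 1)) (L ∷ M ∷ (2# ⁻¹) ∷ [])))

  lim-≈ : ∀ {f L} → f ⟶ L → lim f ≈ L
  lim-≈ {f} {L} h = ⟶-unique (choose-correct (f ⟶_) (L , h)) h

  -- From fg - LM = (f - L)(g - M) + (f - L)M + (g - M)L. With both deviations below e ≤ 1 the first
  -- term is below e, and the total is below e (∣L∣ + ∣M∣ + 1).
  ⟶-* : ∀ {f g L M} → f ⟶ L → g ⟶ M → (λ n → f n * g n) ⟶ (L * M)
  ⟶-* {f} {g} {L} {M} hf hg ε ε>0 = eventually-map close (eventually-× (hf e e>0) (hg e e>0))
    where
    K = ∣ L ∣ + ∣ M ∣ + 1#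
    K>0 : 0# < K
    K>0 = (<-by (+-pos-nonneg (+-pos-nonneg 0<1 (∣∣-nonneg L)) (∣∣-nonneg M))
      (solve 2 (λ a b → a :+ b :+ κ 1 :- κ 0 := κ 1 :+ a :+ b) ((∣ L ∣) ∷ (∣ M ∣) ∷ [])))
    e = 1# ⊓ (ε / K)
    e>0 : 0# < e
    e>0 = pos-⊓ 0<1 (/-pos ε>0 K>0)
    eK≤ε : e * (∣ L ∣ + ∣ M ∣ + 1#) ≤ ε
    eK≤ε = (≤-by (+-nonneg (*-nonneg (≤-diff (x⊓y≤y 1# (ε / K))) (<⇒≤ K>0))
      (eq-nonneg (- ε) (pos-⁻¹ K>0))) (solve 4
      (λ ε e K a → ε :- e :* K := (ε :* a :- e) :* K :+ :- ε :* (K :* a :- κ 1))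
      (ε ∷ e ∷ K ∷ (K ⁻¹) ∷ [])))
    bound : ∀ {a b c} → ∣ a ∣ ≤ b → a * c ≤ b * ∣ c ∣
    bound {a} {b} {c} h with ≤-total 0# c
    ... | inj₁ p = ≤-trans (≤-by (*-nonneg p (≤-diff (≤-trans (x≤∣x∣ a) h)))
      (solve 3 (λ b c a → b :* c :- a :* c := c :* (b :- a)) (b ∷ c ∷ a ∷ [])))
      (≤-by (*-nonneg (≤-trans (∣∣-nonneg a) h) (≤-diff (x≤∣x∣ c)))
        (solve 3 (λ b a c → b :* a :- b :* c := b :* (a :- c)) (b ∷ (∣ c ∣) ∷ c ∷ [])))
    ... | inj₂ p = ≤-trans (≤-by (*-nonneg (≤-diff p) (≤-diff (≤-trans (-x≤∣x∣ a) h)))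
      (solve 3 (λ b c a → b :* (:- c) :- a :* c := (κ 0 :- c) :* (b :- :- a)) (b ∷ c ∷ a ∷ [])))
      (≤-by (*-nonneg (≤-trans (∣∣-nonneg a) h) (≤-diff (-x≤∣x∣ c)))
        (solve 3 (λ b a c → b :* a :- b :* (:- c) := b :* (a :- :- c)) (b ∷ (∣ c ∣) ∷ c ∷ [])))
    ∣-x∣≤ : ∀ {x b} → ∣ x ∣ ≤ b → ∣ - x ∣ ≤ b
    ∣-x∣≤ {x} h = ∣x∣≤ (≤-trans (-x≤∣x∣ x) h)
      (≤-trans (≤-trans (≤-by (eq-nonneg 0# refl)
      (solve 1 (λ x → x :- :- (:- x) := κ 0 :* (x :- x)) (x ∷ []))) (x≤∣x∣ x)) h)
    small : ∀ {a b} → ∣ a ∣ ≤ e → ∣ b ∣ < e → a * b < e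
    small {a} {b} p r = ≤-<-trans (bound p)
      (<-by (+-pos-nonneg (*-pos e>0 (<-diff r)) (*-nonneg (<⇒≤ e>0) (≤-diff (x⊓y≤x 1# (ε / K)))))
        (solve 2 (λ e a → e :- e :* a := e :* (e :- a) :+ e :* (κ 1 :- e)) (e ∷ (∣ b ∣) ∷ [])))
    close : ∀ n → ∣ f n - L ∣ < e × ∣ g n - M ∣ < e → ∣ f n * g n - L * M ∣ < ε
    close n (p , r) = ∣x∣<
      (<-by (+-pos-nonneg (+-pos-nonneg (+-pos-nonneg (<-diff (small (<⇒≤ p) r))
        (≤-diff (bound (<⇒≤ p)))) (≤-diff (bound (<⇒≤ r)))) (≤-diff eK≤ε))
        (solve 8 (λ ε a b L M e c d → ε :- (a :* b :- L :* M) := e :- (a :- L) :* (b :- M) :+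
        (e :* c :- (a :- L) :* M) :+ (e :* d :- (b :- M) :* L) :+ (ε :- e :* (d :+ c :+ κ 1)))
        (ε ∷ (f n) ∷ (g n) ∷ L ∷ M ∷ e ∷ (∣ M ∣) ∷ (∣ L ∣) ∷ [])))
      (<-by (+-pos-nonneg (+-pos-nonneg (+-pos-nonneg (<-diff (small (∣-x∣≤ (<⇒≤ p)) r))
        (≤-diff (bound (∣-x∣≤ (<⇒≤ p))))) (≤-diff (bound (∣-x∣≤ (<⇒≤ r))))) (≤-diff eK≤ε))
        (solve 8 (λ ε a b L M e c d → ε :- :- (a :* b :- L :* M) := e :- :- (a :- L) :* (b :- M) :+
        (e :* c :- :- (a :- L) :* M) :+ (e :* d :- :- (b :- M) :* L) :+ (ε :- e :* (d :+ c :+ κ 1)))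
        (ε ∷ (f n) ∷ (g n) ∷ L ∷ M ∷ e ∷ (∣ M ∣) ∷ (∣ L ∣) ∷ [])))

  monotone-steps : ∀ {f : ℕ → ℝ} {N} → (∀ n → N ℕ.≤ n → f n ≤ f (suc n)) → ∀ {m n} → N ℕ.≤ m →
    m ℕ.≤ n → f m ≤ f n
  monotone-steps {f} {N} step {m} {n} N≤m m≤n = ≡.subst (λ t → f m ≤ f t) (ℕ.m+[n∸m]≡n m≤n)
    (go (n ∸ m))
    where
    go : ∀ d → f m ≤ f (m ℕ.+ d)
    go zero    = ≤-reflexive (reflexive (≡.cong f (≡.sym (ℕ.+-identityʳ m))))
    go (suc d) = ≤-trans (go d) (≡.subst (λ t → f (m ℕ.+ d) ≤ f t) (≡.sym (ℕ.+-suc m d))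
      (step (m ℕ.+ d) (ℕ.≤-trans N≤m (ℕ.m≤m+n m d))))

  monotone-converges : ∀ {f : ℕ → ℝ} {N b} → (∀ n → N ℕ.≤ n → f n ≤ f (suc n)) →
    (∀ n → N ℕ.≤ n → f n ≤ b) →
    ∃ λ s → f ⟶ s × (∀ n → N ℕ.≤ n → f n ≤ s)
  monotone-converges {f} {N} {b} step bounded = s , converges , upper
    where
    P : ℝ → Set
    P y = ∃ λ n → N ℕ.≤ n × y ≤ f n
    S = complete P (f N , N , ℕ.≤-refl , ≤-refl) (b , λ y (n , h , p) → ≤-trans p (bounded n h))
    s = proj₁ S
    upper : ∀ n → N ℕ.≤ n → f n ≤ s
    upper n h = proj₁ (proj₂ S) (f n) (n , h , ≤-refl)
    converges : f ⟶ s
    converges ε ε>0 with em {∃ λ n → N ℕ.≤ n × s - ε < f n}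
    ... | yes (M , N≤M , p) = M , λ n M≤n → ∣x∣<
            (<-by (+-pos-nonneg ε>0 (≤-diff (upper n (ℕ.≤-trans N≤M M≤n))))
              (solve 3 (λ ε a s → ε :- (a :- s) := ε :+ (s :- a)) (ε ∷ (f n) ∷ s ∷ [])))
            (<-by (+-pos-nonneg (<-diff p) (≤-diff (monotone-steps step N≤M M≤n)))
              (solve 4 (λ ε a s b → ε :- :- (a :- s) := b :- (s :- ε) :+ (a :- b))
              (ε ∷ (f n) ∷ s ∷ (f M) ∷ [])))
    ... | no none = ⊥-elim (<⇒≱ (<-by ε>0 (solve 2 (λ s ε → s :- (s :- ε) := ε) (s ∷ ε ∷ [])))
            (proj₂ (proj₂ S) (s - ε) (λ y (n , h , p) → ≤-trans p (≮⇒≥ λ r → none (n , h , r)))))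

  -- Exponential and logarithm

  ^-nonneg : ∀ {x} n → 0# ≤ x → 0# ≤ x ^ n
  ^-nonneg zero    h = 0≤1
  ^-nonneg (suc n) h = *-nonneg h (^-nonneg n h)

  ^-pos : ∀ {x} n → 0# < x → 0# < x ^ n
  ^-pos zero    h = 0<1
  ^-pos (suc n) h = *-pos h (^-pos n h)

  ^-≤1 : ∀ {x} n → 0# ≤ x → x ≤ 1# → x ^ n ≤ 1#
  ^-≤1     zero    _ _ = ≤-refl
  ^-≤1 {x} (suc n) h p = (≤-by (+-nonneg (*-nonneg h (≤-diff (^-≤1 n h p))) (≤-diff p))
    (solve 2 (λ x a → κ 1 :- x :* a := x :* (κ 1 :- a) :+ (κ 1 :- x)) (x ∷ (x ^ n) ∷ [])))

  bernoulli : ∀ {h} n → 0# ≤ 1# + h → 1# + fromℕ n * h ≤ (1# + h) ^ n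
  bernoulli {h} zero    p = (≤-by (eq-nonneg 0# refl)
    (solve 1 (λ h → κ 1 :- (κ 1 :+ κ 0 :* h) := κ 0 :* (h :- h)) (h ∷ [])))
  bernoulli {h} (suc n) p = (≤-by (+-nonneg (*-nonneg p (≤-diff (bernoulli n p)))
    (*-nonneg (fromℕ-nonneg n) (0≤x*x h))) (solve 3
    (λ h a b → (κ 1 :+ h) :* a :- (κ 1 :+ (κ 1 :+ b) :* h) := (κ 1 :+ h) :* (a :- (κ 1 :+ b :* h))
    :+ b :* (h :* h)) (h ∷ ((1# + h) ^ n) ∷ (fromℕ n) ∷ [])))

  expSeq : ℝ → ℕ → ℝ
  expSeq x n = (1# + x / fromℕ n) ^ n

  -- The range in which the bases 1 + x / n and 1 - x / n are positive, as Bernoulli's inequality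
  -- needs; n ≥ 1 keeps the unspecified inverse of 0 away.
  Beyond : ℝ → ℕ → Set
  Beyond x n = 1 ℕ.≤ n × ∣ x ∣ < fromℕ n

  eventually-beyond : ∀ x → Eventually (Beyond x)
  eventually-beyond x = eventually-× (eventually-≥ 1) (large-ℕ ∣ x ∣)

  beyond-neg : ∀ {x n} → Beyond x n → Beyond (- x) n
  beyond-neg {x} {n} (h , p) = h , ∣x∣< (≤-<-trans (-x≤∣x∣ x) p)
    (≤-<-trans (≤-trans (≤-by (eq-nonneg 0# refl)
      (solve 1 (λ x → x :- :- (:- x) := κ 0 :* (x :- x)) (x ∷ []))) (x≤∣x∣ x)) p)

  module _ {x : ℝ} {n : ℕ} (b : Beyond x n) where
    private
      N = fromℕ n
      N>0 : 0# < N
      N>0 = fromℕ-pos (proj₁ b)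

    base-* : N * (1# + x / N) ≈ N + x
    base-* = (≈-by (≈-diff x (pos-⁻¹ N>0)) (solve 3
      (λ N x a → N :* (κ 1 :+ x :* a) :- (N :+ x) := x :* (N :* a :- κ 1)) (N ∷ x ∷ (N ⁻¹) ∷ [])))

    base-pos : 0# < 1# + x / N
    base-pos = *-cancelʳ-< (<⇒≤ N>0) (<-by (+-pos-nonneg (<-diff (≤-<-trans (-x≤∣x∣ x) (proj₂ b)))
      (eq-nonneg 1# base-*)) (solve 3 (λ x a N →
      (κ 1 :+ x :* a) :* N :- κ 0 :* N := N :- :- x :+ κ 1 :* (N :* (κ 1 :+ x :* a) :- (N :+ x)))
      (x ∷ (N ⁻¹) ∷ N ∷ [])))

    expSeq-pos : 0# < expSeq x n
    expSeq-pos = ^-pos n base-pos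

    1+x≤expSeq : 1# + x ≤ expSeq x n
    1+x≤expSeq = ≤-respˡ (≈-by (≈-diff x (pos-⁻¹ N>0))
      (solve 3 (λ N x a → κ 1 :+ N :* (x :* a) :- (κ 1 :+ x) := x :* (N :* a :- κ 1))
      (N ∷ x ∷ (N ⁻¹) ∷ []))) (bernoulli n (<⇒≤ base-pos))

  beyond-suc : ∀ {x n} → Beyond x n → Beyond x (suc n)
  beyond-suc {n = n} (h , p) = ℕ.m≤n⇒m≤1+n h , <-≤-trans p (fromℕ-mono-≤ (ℕ.n≤1+n n))

  -- With consecutive bases u and w, division by u^(n+1) turns the claim into 1 / u ≤ (w / u)^(n+1),
  -- an instance of Bernoulli's inequality.
  expSeq-step : ∀ {x n} → Beyond x n → expSeq x n ≤ expSeq x (suc n)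
  expSeq-step {x} {n} b = ≤-respʳ power grow
    where
    N = fromℕ n
    u w h : ℝ
    u = 1# + x / N
    w = 1# + x / (1# + N)
    h = w / u - 1#
    u>0 : 0# < u
    u>0 = base-pos b
    w>0 : 0# < w
    w>0 = base-pos (beyond-suc b)
    1+h≥0 : 0# ≤ 1# + h
    1+h≥0 = ≤-respʳ (solve 2 (λ w a → w :* a := κ 1 :+ (w :* a :- κ 1)) (w ∷ (u ⁻¹) ∷ []))
      (/-nonneg (<⇒≤ w>0) u>0)
    [1+h]u : (1# + h) * u ≈ w
    [1+h]u = (≈-by (≈-diff w (pos-⁻¹ u>0)) (solve 3
      (λ w a u → (κ 1 :+ (w :* a :- κ 1)) :* u :- w := w :* (u :* a :- κ 1)) (w ∷ (u ⁻¹) ∷ u ∷ [])))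
    power : (1# + h) ^ suc n * u ^ suc n ≈ w ^ suc n
    power = trans (sym (^-distrib-* (1# + h) u (suc n))) (^-congˡ (suc n) [1+h]u)
    -- Bernoulli's bound for the quotient of the bases is exactly 1 / u.
    unit : (1# + (1# + N) * h) * u ≈ 1#
    unit = (≈-by (≈0-+ (≈0-+ (≈-diff (1# + N) [1+h]u) (≈-diff 1# (base-* (beyond-suc b))))
      (≈-diff (- 1#) (base-* b))) (solve 5 (λ N h u w x →
      (κ 1 :+ (κ 1 :+ N) :* h) :* u :- κ 1 := (κ 1 :+ N) :* ((κ 1 :+ h) :* u :- w) :+ κ 1 :*
      ((κ 1 :+ N) :* w :- (κ 1 :+ N :+ x)) :+ :- (κ 1) :* (N :* u :- (N :+ x)))
      (N ∷ h ∷ u ∷ w ∷ x ∷ [])))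
    grow : u ^ n ≤ (1# + h) ^ suc n * u ^ suc n
    grow = (≤-by (+-nonneg (*-nonneg (≤-diff (bernoulli (suc n) 1+h≥0))
      (<⇒≤ (*-pos u>0 (^-pos n u>0)))) (eq-nonneg (u ^ n) unit))
      (solve 5 (λ a u b N h → a :* (u :* b) :- b := (a :- (κ 1 :+ (κ 1 :+ N) :* h)) :* (u :* b) :+ b
      :* ((κ 1 :+ (κ 1 :+ N) :* h) :* u :- κ 1)) (((1# + h) ^ suc n) ∷ u ∷ (u ^ n) ∷ N ∷ h ∷ [])))

  -- Because (1 + x/n)(1 - x/n) = 1 - (x/n)². As `expSeq (- x)` increases too, this bounds
  -- `expSeq x` by a reciprocal and so makes it converge.
  expSeq-neg : ∀ {x n} → Beyond x n → expSeq x n * expSeq (- x) n ≤ 1#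
  expSeq-neg {x} {n} b = ≤-respˡ (^-distrib-* _ _ n)
    (^-≤1 n (<⇒≤ (*-pos (base-pos b) (base-pos (beyond-neg b))))
      (≤-by (0≤x*x (x / N)) (solve 2 (λ x a →
        κ 1 :- (κ 1 :+ x :* a) :* (κ 1 :+ :- x :* a) := x :* a :* (x :* a)) (x ∷ (N ⁻¹) ∷ []))))
    where N = fromℕ n

  module _ {x : ℝ} {N : ℕ} (beyond : ∀ n → N ℕ.≤ n → Beyond x n) where
    private
      e>0 : 0# < expSeq (- x) N
      e>0 = expSeq-pos (beyond-neg (beyond N ℕ.≤-refl))

      above-N : ∀ n → N ℕ.≤ n → expSeq (- x) N ≤ expSeq (- x) n
      above-N n h = monotone-steps {expSeq (- x)} {N}
        (λ m p → expSeq-step (beyond-neg (beyond m p))) ℕ.≤-refl h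

    expSeq-bounded : ∀ n → N ℕ.≤ n → expSeq x n ≤ expSeq (- x) N ⁻¹
    expSeq-bounded n h = *-cancelʳ-≤ e>0
        (≤-by (+-nonneg (+-nonneg (≤-diff (expSeq-neg (beyond n h)))
          (*-nonneg (<⇒≤ (expSeq-pos (beyond n h))) (≤-diff (above-N n h))))
          (eq-nonneg 1# (pos-⁻¹ e>0))) (solve 4
          (λ a b c d → a :* b :- c :* b := κ 1 :- c :* d :+ c :* (d :- b) :+ κ 1 :* (b :* a :- κ 1))
          ((expSeq (- x) N ⁻¹) ∷ (expSeq (- x) N) ∷ (expSeq x n) ∷ (expSeq (- x) n) ∷ [])))

    expSeq-converges : ∃ λ s → expSeq x ⟶ s × (∀ n → N ℕ.≤ n → expSeq x n ≤ s)
    expSeq-converges = monotone-converges (λ n h → expSeq-step (beyond n h)) expSeq-bounded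

  exp-exists : ∀ x → ∃ λ s → expSeq x ⟶ s × Eventually (λ n → expSeq x n ≤ s)
  exp-exists x = let (s , limit , upper) = expSeq-converges (proj₂ (eventually-beyond x)) in
    s , limit , proj₁ (eventually-beyond x) , upper

  exp-limit : ∀ x → expSeq x ⟶ exp x
  exp-limit x = choose-correct (expSeq x ⟶_) (proj₁ (exp-exists x) , proj₁ (proj₂ (exp-exists x)))

  expSeq≤exp : ∀ x → Eventually (λ n → expSeq x n ≤ exp x)
  expSeq≤exp x = let (s , limit , upper) = exp-exists x in
    eventually-map (λ n → ≤-respʳ (sym (lim-≈ limit))) upper

  exp-cong : ∀ {x y} → x ≈ y → exp x ≈ exp y
  exp-cong {x} {y} e = ⟶-unique
    (⟶-resp (0 , λ n _ → ^-congˡ n (+-congˡ (*-congʳ e))) refl (exp-limit x)) (exp-limit y)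

  exp-pos : ∀ x → 0# < exp x
  exp-pos x = let (N , p) = eventually-× (eventually-beyond x) (expSeq≤exp x)
                  (b , r) = p N ℕ.≤-refl
              in <-≤-trans (expSeq-pos b) r

  1+x≤exp : ∀ x → 1# + x ≤ exp x
  1+x≤exp x = let (N , p) = eventually-× (eventually-beyond x) (expSeq≤exp x)
                  (b , r) = p N ℕ.≤-refl
              in ≤-trans (1+x≤expSeq b) r

  -- As (1 + h)(1 - h) ≤ 1, Bernoulli for both factors pins (1 + h) ^ n near 1 when n h is small.
  power-near-1 : ∀ {h e ε} n → 1 ℕ.≤ n → 0# < e → e ≤ 1# → e ≤ ε → 0# < 1# + h →
    2# * (fromℕ n * h) < e → - (2# * (fromℕ n * h)) < e → ∣ (1# + h) ^ n - 1# ∣ < ε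
  power-near-1 {h} {e} {ε} n n≥1 e>0 e≤1 e≤ε 1+h>0 2t<e -2t<e = ∣x∣< above below
    where
    N = fromℕ n
    d = (1# + h) ^ n
    t = N * h
    N≥1 : 1# ≤ N
    N≥1 = 1≤fromℕ n≥1
    1+t≤d : 1# + t ≤ d
    1+t≤d = bernoulli n (<⇒≤ 1+h>0)
    t≤1 : t ≤ 1#
    t≤1 = *-cancelʳ-≤ 0<2 (≤-by (+-nonneg (+-nonneg (≤-diff (<⇒≤ 2t<e)) (≤-diff e≤1)) 0≤1)
      (solve 2 (λ t e → κ 1 :* κ 2 :- t :* κ 2 := e :- κ 2 :* t :+ (κ 1 :- e) :+ κ 1) (t ∷ e ∷ [])))
    1-h≥0 : 0# ≤ 1# + - h
    1-h≥0 = *-cancelʳ-≤ (fromℕ-pos n≥1) (≤-by (+-nonneg (≤-diff N≥1) (≤-diff t≤1))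
      (solve 2 (λ h N → (κ 1 :+ :- h) :* N :- κ 0 :* N := N :- κ 1 :+ (κ 1 :- N :* h))
      (h ∷ N ∷ [])))
    1-t≤ : 1# - t ≤ (1# + - h) ^ n
    1-t≤ = ≤-respˡ (solve 2 (λ N h → κ 1 :+ N :* (:- h) := κ 1 :- N :* h) (N ∷ h ∷ []))
      (bernoulli n 1-h≥0)
    prod≤1 : d * (1# + - h) ^ n ≤ 1#
    prod≤1 = ≤-respˡ (^-distrib-* _ _ n) (^-≤1 n (*-nonneg (<⇒≤ 1+h>0) 1-h≥0)
      (≤-by (0≤x*x h) (solve 1 (λ h → κ 1 :- (κ 1 :+ h) :* (κ 1 :+ :- h) := h :* h) (h ∷ []))))
    d>0 : 0# < d
    d>0 = ^-pos n 1+h>0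
    d[1-t]≤1 : d * (1# - t) ≤ 1#
    d[1-t]≤1 = (≤-by (+-nonneg (*-nonneg (<⇒≤ d>0) (≤-diff 1-t≤)) (≤-diff prod≤1))
      (solve 3 (λ d t a → κ 1 :- d :* (κ 1 :- t) := d :* (a :- (κ 1 :- t)) :+ (κ 1 :- d :* a))
      (d ∷ t ∷ ((1# + - h) ^ n) ∷ [])))
    d≤2 : d ≤ 2#
    d≤2 = (≤-by (+-nonneg (+-nonneg (+-nonneg (≤-diff d[1-t]≤1) (≤-diff d[1-t]≤1))
      (*-nonneg (<⇒≤ d>0) (≤-diff (<⇒≤ 2t<e)))) (*-nonneg (<⇒≤ d>0) (≤-diff e≤1)))
      (solve 3 (λ d t e → κ 2 :- d := κ 1 :- d :* (κ 1 :- t) :+ (κ 1 :- d :* (κ 1 :- t)) :+ d :*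
      (e :- κ 2 :* t) :+ d :* (κ 1 :- e)) (d ∷ t ∷ e ∷ [])))
    above : d - 1# < ε
    above = *-cancelʳ-< (<⇒≤ 0<2) (<-by (+-pos-nonneg
      (+-pos-nonneg (+-pos-nonneg (+-pos-nonneg
      (+-pos-nonneg (*-pos d>0 (<-diff 2t<e)) (≤-diff d[1-t]≤1)) (≤-diff d[1-t]≤1))
      (*-nonneg (<⇒≤ e>0) (≤-diff d≤2))) (≤-diff e≤ε)) (≤-diff e≤ε))
      (solve 4 (λ ε d e t → ε :* κ 2 :- (d :- κ 1) :* κ 2 := d :* (e :- κ 2 :* t) :+
      (κ 1 :- d :* (κ 1 :- t)) :+ (κ 1 :- d :* (κ 1 :- t)) :+ e :* (κ 2 :- d) :+ (ε :- e) :+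
      (ε :- e)) (ε ∷ d ∷ e ∷ t ∷ [])))
    below : - (d - 1#) < ε
    below = *-cancelʳ-< (<⇒≤ 0<2) (<-by (+-pos-nonneg
      (+-pos-nonneg (+-pos-nonneg (+-pos-nonneg (+-pos-nonneg (<-diff -2t<e) (≤-diff 1+t≤d))
      (≤-diff 1+t≤d)) (<⇒≤ e>0)) (≤-diff e≤ε)) (≤-diff e≤ε))
      (solve 4 (λ ε d e t → ε :* κ 2 :- :- (d :- κ 1) :* κ 2 := e :- :- (κ 2 :* t) :+
      (d :- (κ 1 :+ t)) :+ (d :- (κ 1 :+ t)) :+ e :+ (ε :- e) :+ (ε :- e)) (ε ∷ d ∷ e ∷ t ∷ [])))

  -- The product (1 + x/n)(1 + y/n) equals (1 + (x+y)/n)(1 + h n) with n h n = xy / (n + x + y).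
  -- This tends to 0, so `power-near-1` lets the correction factor `d n` tend to 1.
  exp-+ : ∀ x y → exp (x + y) ≈ exp x * exp y
  exp-+ x y = ⟶-unique
    (⟶-resp {f = λ n → expSeq (x + y) n * d n} (eventually-map factor beyonds) (*-identityʳ _)
      (⟶-* (exp-limit (x + y)) d⟶1))
    (⟶-* (exp-limit x) (exp-limit y))
    where
    h d : ℕ → ℝ
    h n = (1# + x / fromℕ n) * (1# + y / fromℕ n) / (1# + (x + y) / fromℕ n) - 1#
    d n = (1# + h n) ^ n
    Beyonds : ℕ → Set
    Beyonds n = Beyond x n × Beyond y n × Beyond (x + y) n
    beyonds : Eventually Beyonds
    beyonds = eventually-× (eventually-beyond x)
      (eventually-× (eventually-beyond y) (eventually-beyond (x + y)))
    factor-base : ∀ {n} → Beyonds n → (1# + (x + y) / fromℕ n) * (1# + h n) ≈ (1# + x / fromℕ n) *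
      (1# + y / fromℕ n)
    factor-base {n} (_ , _ , b) = (≈-by (≈-diff u (pos-⁻¹ (base-pos b)))
      (solve 3 (λ v u a → v :* (κ 1 :+ (u :* a :- κ 1)) :- u := u :* (v :* a :- κ 1))
      (v ∷ u ∷ (v ⁻¹) ∷ [])))
      where
      u = (1# + x / fromℕ n) * (1# + y / fromℕ n)
      v = 1# + (x + y) / fromℕ n
    factor : ∀ n → Beyonds n → expSeq (x + y) n * d n ≈ expSeq x n * expSeq y n
    factor n bs = trans (sym (^-distrib-* _ _ n))
      (trans (^-congˡ n (factor-base bs)) (^-distrib-* _ _ n))
    d⟶1 : d ⟶ 1#
    d⟶1 ε ε>0 = eventually-map close (eventually-× beyonds (large-ℕ (2# * ∣ x * y ∣ / e - (x + y))))
      where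
      e = 1# ⊓ ε
      e>0 : 0# < e
      e>0 = pos-⊓ 0<1 ε>0
      close : ∀ n → Beyonds n × 2# * ∣ x * y ∣ / e - (x + y) < fromℕ n → ∣ d n - 1# ∣ < ε
      close n (bs@(bx , by , bxy) , large) = power-near-1 n (proj₁ bx) e>0 (x⊓y≤x 1# ε) (x⊓y≤y 1# ε)
        1+h>0
        (*-cancelʳ-< (<⇒≤ M>0) (<-by (+-pos-nonneg
          (+-pos-nonneg (+-pos-nonneg (<-diff large′) (≤-diff (x≤∣x∣ (x * y))))
          (≤-diff (x≤∣x∣ (x * y)))) (eq-nonneg (- 2#) Mt))
          (solve 6 (λ e M t a x y → e :* M :- κ 2 :* t :* M := e :* M :- κ 2 :* a :+ (a :- x :* y)
          :+ (a :- x :* y) :+ :- (κ 2) :* (M :* t :- x :* y))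
          (e ∷ M ∷ t ∷ (∣ x * y ∣) ∷ x ∷ y ∷ []))))
        (*-cancelʳ-< (<⇒≤ M>0) (<-by (+-pos-nonneg
          (+-pos-nonneg (+-pos-nonneg (<-diff large′) (≤-diff (-x≤∣x∣ (x * y))))
          (≤-diff (-x≤∣x∣ (x * y)))) (eq-nonneg 2# Mt))
          (solve 6 (λ e M t a x y → e :* M :- :- (κ 2 :* t) :* M := e :* M :- κ 2 :* a :+
          (a :- :- (x :* y)) :+ (a :- :- (x :* y)) :+ κ 2 :* (M :* t :- x :* y))
          (e ∷ M ∷ t ∷ (∣ x * y ∣) ∷ x ∷ y ∷ []))))
        where
        N i v t M : ℝ
        N = fromℕ n
        i = N ⁻¹
        v = 1# + (x + y) / N
        t = N * h n
        M = N + (x + y)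
        v>0 : 0# < v
        v>0 = base-pos bxy
        1+h>0 : 0# < 1# + h n
        1+h>0 = *-cancelʳ-< (<⇒≤ v>0) (<-respˡ (sym (zeroˡ v))
          (<-respʳ (trans (sym (factor-base bs)) (*-comm _ _)) (*-pos (base-pos bx) (base-pos by))))
        Ni : N * i ≈ 1#
        Ni = pos-⁻¹ (fromℕ-pos (proj₁ bx))
        Mt : M * t ≈ x * y
        Mt = (≈-by (≈0-+ (≈-diff (N * N) (factor-base bs))
          (≈-diff (((((N * i) + 1#) * x) * y) - ((N * (h n)) * (x + y))) Ni))
          (solve 5 (λ N x y a i → (N :+ (x :+ y)) :* (N :* a) :- x :* y := N :* N :*
          ((κ 1 :+ (x :+ y) :* i) :* (κ 1 :+ a) :- (κ 1 :+ x :* i) :* (κ 1 :+ y :* i)) :+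
          ((N :* i :+ κ 1) :* x :* y :- N :* a :* (x :+ y)) :* (N :* i :- κ 1))
          (N ∷ x ∷ y ∷ (h n) ∷ i ∷ [])))
        M>0 : 0# < M
        M>0 = <-respʳ (base-* bxy) (*-pos (fromℕ-pos (proj₁ bx)) v>0)
        large′ : 2# * ∣ x * y ∣ < e * M
        large′ = (<-by (+-pos-nonneg (*-pos e>0 (<-diff large))
          (eq-nonneg (2# * (∣ x * y ∣)) (pos-⁻¹ e>0)))
          (solve 6 (λ e N x y a b → e :* (N :+ (x :+ y)) :- κ 2 :* a := e :*
          (N :- (κ 2 :* a :* b :- (x :+ y))) :+ κ 2 :* a :* (e :* b :- κ 1))
          (e ∷ N ∷ x ∷ y ∷ (∣ x * y ∣) ∷ (e ⁻¹) ∷ [])))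

  exp-0 : exp 0# ≈ 1#
  exp-0 = *-cancelʳ-≈ (exp-pos 0#) (trans (sym (exp-+ 0# 0#))
    (trans (exp-cong (+-identityˡ 0#)) (sym (*-identityˡ _))))

  exp-neg : ∀ x → exp x * exp (- x) ≈ 1#
  exp-neg x = trans (sym (exp-+ x (- x))) (trans (exp-cong (-‿inverseʳ x)) exp-0)

  exp-mono-< : ∀ {x y} → x < y → exp x < exp y
  exp-mono-< {x} {y} h = <-respʳ (trans (sym (exp-+ x (y - x)))
    (exp-cong (solve 2 (λ x y → x :+ (y :- x) := y) (x ∷ y ∷ []))))
    (<-by (+-pos-nonneg (*-pos (exp-pos x) (<-diff h))
      (*-nonneg (<⇒≤ (exp-pos x)) (≤-diff (1+x≤exp (y - x)))))
      (solve 4 (λ a b y x → a :* b :- a := a :* (y :- x) :+ a :* (b :- (κ 1 :+ (y :- x))))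
      ((exp x) ∷ (exp (y - x)) ∷ y ∷ x ∷ [])))

  exp-cancel-≤ : ∀ {x y} → exp x ≤ exp y → x ≤ y
  exp-cancel-≤ h = ≮⇒≥ λ p → <⇒≱ (exp-mono-< p) h

  exp-mono-≤ : ∀ {x y} → x ≤ y → exp x ≤ exp y
  exp-mono-≤ {x} {y} h with em {x ≈ y}
  ... | yes e = ≤-reflexive (exp-cong e)
  ... | no ne = <⇒≤ (exp-mono-< (h , ne))

  exp-injective : ∀ {x y} → exp x ≈ exp y → x ≈ y
  exp-injective e = ≤-antisym (exp-cancel-≤ (≤-reflexive e)) (exp-cancel-≤ (≤-reflexive (sym e)))

  exp-surjective : ∀ {y} → 0# < y → ∃ λ t → exp t ≈ y
  exp-surjective {y} y>0 = s , ≤-antisym (≮⇒≥ not-above) (≮⇒≥ not-below)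
    where
    P : ℝ → Set
    P t = exp t ≤ y
    i = y ⁻¹
    -- By exp (1/y) ≥ 1 + 1/y > 1/y. The set is bounded by y since t ≤ exp t ≤ y on it.
    inhabited : exp (- i) ≤ y
    inhabited = (≤-by (+-nonneg (+-nonneg (+-nonneg
      (*-nonneg (*-nonneg (<⇒≤ y>0) (<⇒≤ (exp-pos (- i)))) (≤-diff (1+x≤exp i)))
      (*-nonneg (<⇒≤ (exp-pos (- i))) (<⇒≤ y>0))) (eq-nonneg (exp (- i)) (pos-⁻¹ y>0)))
      (eq-nonneg (- y) (exp-neg i))) (solve 4
      (λ y a b i → y :- a := y :* a :* (b :- (κ 1 :+ i)) :+ a :* y :+ a :* (y :* i :- κ 1) :+ :- y
      :* (b :* a :- κ 1)) (y ∷ (exp (- i)) ∷ (exp i) ∷ i ∷ [])))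
    S = complete P (- i , inhabited) (y , λ t h →
      (≤-by (+-nonneg (+-nonneg (≤-diff h) (≤-diff (1+x≤exp t))) 0≤1)
      (solve 3 (λ y t a → y :- t := y :- a :+ (a :- (κ 1 :+ t)) :+ κ 1) (y ∷ t ∷ (exp t) ∷ []))))
    s E : ℝ
    s = proj₁ S
    E = exp s
    E>0 : 0# < E
    E>0 = exp-pos s
    -- exp (s + δ) ≤ E / (1 - δ) = y for δ = (y - E) / y.
    not-below : ¬ (E < y)
    not-below h = <⇒≱ (<-by δ>0 (solve 2 (λ s δ → s :+ δ :- s := δ) (s ∷ δ ∷ [])))
      (proj₁ (proj₂ S) (s + δ) (≤-respˡ (sym (exp-+ s δ)) small))
      where
      δ = (y - E) / y
      δ>0 : 0# < δ
      δ>0 = /-pos (<-diff h) y>0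
      small : E * exp δ ≤ y
      small = (≤-by (+-nonneg (+-nonneg (*-nonneg (*-nonneg (<⇒≤ y>0) (<⇒≤ (exp-pos δ)))
        (≤-diff (1+x≤exp (- δ)))) (eq-nonneg (- y) (exp-neg δ)))
        (eq-nonneg (- ((exp δ) * (y - E))) (pos-⁻¹ y>0)))
        (solve 5 (λ y E a b c → y :- E :* a := y :* a :* (b :- (κ 1 :+ :- ((y :- E) :* c))) :+ :- y
        :* (a :* b :- κ 1) :+ :- (a :* (y :- E)) :* (y :* c :- κ 1))
        (y ∷ E ∷ (exp δ) ∷ (exp (- δ)) ∷ (y ⁻¹) ∷ [])))
    -- exp (s - δ) ≥ E (1 - δ) = y for δ = (E - y) / E.
    not-above : ¬ (y < E)
    not-above h = <⇒≱ (<-by δ>0 (solve 2 (λ s δ → s :- (s :- δ) := δ) (s ∷ δ ∷ [])))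
      (proj₂ (proj₂ S) (s - δ) λ t p → exp-cancel-≤
      (≤-trans p (≤-respʳ (sym (exp-+ s (- δ))) large)))
      where
      δ = (E - y) / E
      δ>0 : 0# < δ
      δ>0 = /-pos (<-diff h) E>0
      large : y ≤ E * exp (- δ)
      large = (≤-by (+-nonneg (*-nonneg (<⇒≤ E>0) (≤-diff (1+x≤exp (- δ))))
        (eq-nonneg (- (E - y)) (pos-⁻¹ E>0)))
        (solve 4 (λ E a y b → E :* a :- y := E :* (a :- (κ 1 :+ :- ((E :- y) :* b))) :+ :- (E :- y)
        :* (E :* b :- κ 1)) (E ∷ (exp (- δ)) ∷ y ∷ (E ⁻¹) ∷ [])))

  exp-log : ∀ {x} → 0# < x → exp (log x) ≈ x
  exp-log {x} h = choose-correct (λ t → exp t ≈ x) (exp-surjective h)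

  log-exp : ∀ t → log (exp t) ≈ t
  log-exp t = exp-injective (exp-log (exp-pos t))

  log-mono-≤ : ∀ {x y} → 0# < x → x ≤ y → log x ≤ log y
  log-mono-≤ h p = exp-cancel-≤ (≤-respˡ (sym (exp-log h))
    (≤-respʳ (sym (exp-log (<-≤-trans h p))) p))

  log-cancel-≤ : ∀ {x y} → 0# < x → 0# < y → log x ≤ log y → x ≤ y
  log-cancel-≤ p r h = ≤-respˡ (exp-log p) (≤-respʳ (exp-log r) (exp-mono-≤ h))

  log-1 : log 1# ≈ 0#
  log-1 = exp-injective (trans (exp-log 0<1) (sym exp-0))

  log-nonneg : ∀ {x} → 1# ≤ x → 0# ≤ log x
  log-nonneg h = ≤-respˡ log-1 (log-mono-≤ 0<1 h)

  -- Upper and lower limits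

  module ± = Ext _≤_

  between : ∀ {x y} → x < y → ∃ λ z → x < z × z < y
  between {x} {y} h = (x + y) / 2# ,
    *-cancelʳ-< (<⇒≤ 0<2) (<-by (+-pos-nonneg (<-diff h) (eq-nonneg (x + y) (pos-⁻¹ 0<2)))
      (solve 3 (λ x y a → (x :+ y) :* a :* κ 2 :- x :* κ 2 := y :- x :+ (x :+ y) :*
      (κ 2 :* a :- κ 1)) (x ∷ y ∷ (2# ⁻¹) ∷ []))) ,
    *-cancelʳ-< (<⇒≤ 0<2) (<-by (+-pos-nonneg (<-diff h) (eq-nonneg (- (x + y)) (pos-⁻¹ 0<2)))
      (solve 3 (λ y x a → y :* κ 2 :- (x :+ y) :* a :* κ 2 := y :- x :+ :- (x :+ y) :*
      (κ 2 :* a :- κ 1)) (y ∷ x ∷ (2# ⁻¹) ∷ [])))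

  ≤±-trans : ∀ {x y z} → x ≤± y → y ≤± z → x ≤± z
  ≤±-trans = ±.≤±-trans ≤-trans

  ≤±-antisym : ∀ {x y} → x ≤± y → y ≤± x → x ≈± y
  ≤±-antisym = ±.≤±-antisym ≤-antisym

  [_]≤ : ∀ {x y} → x ≤ y → [ x ] ≤± [ y ]
  [ p ]≤ = ±.[ p ]

  ≤±-from-above : ∀ {s t} → (∀ ν → t < ν → s ≤± [ ν ]) → s ≤± [ t ]
  ≤±-from-above {⊥±} _ = ±.⊥±≤ _
  ≤±-from-above {⊤±} {t} h with h (t + 1#) (<-by 0<1
    (solve 1 (λ t → t :+ κ 1 :- t := κ 1) (t ∷ [])))
  ... | ()
  ≤±-from-above {[ r ]} {t} h = [ ≮⇒≥ (λ t<r → let (ν , t<ν , ν<r) = between t<r in <⇒≱ ν<r (±.[≤]-injective (h ν t<ν))) ]≤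

  ≤±-from-below : ∀ {s t} → (∀ ν → ν < t → [ ν ] ≤± s) → [ t ] ≤± s
  ≤±-from-below {⊤±} _ = (_ ±.≤⊤±)
  ≤±-from-below {⊥±} {t} h with h (t - 1#) (<-by 0<1
    (solve 1 (λ t → t :- (t :- κ 1) := κ 1) (t ∷ [])))
  ... | SupremumOrder.[ () ]
  ≤±-from-below {[ r ]} {t} h = [ ≮⇒≥ (λ r<t → let (ν , r<ν , ν<t) = between r<t in <⇒≱ r<ν (±.[≤]-injective (h ν ν<t))) ]≤

  ⊤±-from-below : ∀ {s} → (∀ ν → [ ν ] ≤± s) → ⊤± ≤± s
  ⊤±-from-below {⊤±} _ = (_ ±.≤⊤±)
  ⊤±-from-below {⊥±} h with h 0#
  ... | SupremumOrder.[ () ]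
  ⊤±-from-below {[ r ]} h = ⊥-elim (<⇒≱ (<-by 0<1 (solve 1 (λ r → r :+ κ 1 :- r := κ 1) (r ∷ [])))
    (±.[≤]-injective (h (r + 1#))))

  module _ {I : Set} (f : I → ℝ ±) where

    ≤-sup : ∀ i → f i ≤± sup f
    ≤-sup = proj₁ (proj₂ (sup-exists f))

    sup-≤ : ∀ {b} → (∀ i → f i ≤± b) → sup f ≤± b
    sup-≤ {b} = proj₂ (proj₂ (sup-exists f)) b

    inf-≤ : ∀ i → inf f ≤± f i
    inf-≤ = proj₁ (proj₂ (inf-exists f))

    ≤-inf : ∀ {b} → (∀ i → b ≤± f i) → b ≤± inf f
    ≤-inf {b} = proj₂ (proj₂ (inf-exists f)) b

  module _ {k : ℕ} (ζ : Fin k → ℝ) (j : ℕ) where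

    private
      H : ℝ → ℝ → Set
      H = HasIndependentSolutions ζ j

    solutions-antitone : ∀ {X ν ν′} → 1# ≤ X → ν ≤ ν′ → H X ν′ → H X ν
    solutions-antitone {X} {ν} {ν′} X≥1 ν≤ν′ (v , independent , solution) =
      v , independent , λ i → proj₁ (solution i) , λ l → ≤-trans (proj₂ (solution i) l) smaller
      where
      smaller : X ^ʳ (- ν′) ≤ X ^ʳ (- ν)
      smaller = exp-mono-≤ (≤-by (*-nonneg (log-nonneg X≥1) (≤-diff ν≤ν′))
        (solve 3 (λ ν a ν′ → :- ν :* a :- :- ν′ :* a := a :* (ν′ :- ν)) (ν ∷ (log X) ∷ ν′ ∷ [])))

    private
      at-≥ : ∀ {X ν} → H X ν → [ ν ] ≤± ω-at ζ j X
      at-≥ {X} {ν} h = ≤-sup _ (ν , h)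

      -- For X ≥ 1 the admissible exponents are closed downwards, so one missing exponent bounds
      -- their supremum; this includes the case of no admissible exponent, where the supremum is
      -- `⊥±`.
      at-≤ : ∀ {X ν} → 1# ≤ X → ¬ H X ν → ω-at ζ j X ≤± [ ν ]
      at-≤ {X} {ν} X≥1 ¬h = sup-≤ _ λ (ν′ , h) →
        [ ≮⇒≥ (λ ν<ν′ → ¬h (solutions-antitone X≥1 (<⇒≤ ν<ν′) h)) ]≤

      above-1 : ∀ X₀ → ∃ λ X₁ → 0# < X₁ × 1# ≤ X₁ × X₀ ≤ X₁
      above-1 X₀ = X₀ ⊔ 1# , <-≤-trans 0<1 (x≤y⊔x X₀ 1#) , x≤y⊔x X₀ 1# , x≤x⊔y X₀ 1#

    ω-≤ : ∀ {t} → (∀ ν → t < ν → ∃ λ X₀ → ∀ X → X₀ ≤ X → ¬ H X ν) → ω ζ j ≤± [ t ]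
    ω-≤ h = ≤±-from-above λ ν t<ν →
      let (X₀ , none)            = h ν t<ν
          (X₁ , pos , ≥1 , ≥X₀) = above-1 X₀
      in ≤±-trans (inf-≤ _ (X₁ , pos))
           (sup-≤ _ λ (X , p) → at-≤ (≤-trans ≥1 p) (none X (≤-trans ≥X₀ p)))

    ≤-ω : ∀ {t} → (∀ ν → ν < t → ∀ X₀ → ∃ λ X → X₀ ≤ X × H X ν) → [ t ] ≤± ω ζ j
    ≤-ω h = ≤-inf _ λ (X₀ , _) → ≤±-from-below λ ν ν<t →
      let (X , p , s) = h ν ν<t X₀ in ≤±-trans (at-≥ s) (≤-sup _ (X , p))

    ω-infinite : (∀ ν X₀ → ∃ λ X → X₀ ≤ X × H X ν) → ω ζ j ≈± ⊤±
    ω-infinite h = ≤±-antisym ((_ ±.≤⊤±)) (≤-inf _ λ (X₀ , _) → ⊤±-from-below λ ν →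
      let (X , p , s) = h ν X₀ in ≤±-trans (at-≥ s) (≤-sup _ (X , p)))

    ≤-ω̂ : ∀ {t} → (∀ ν → ν < t → ∃ λ X₀ → ∀ X → X₀ ≤ X → H X ν) → [ t ] ≤± ω̂ ζ j
    ≤-ω̂ h = ≤±-from-below λ ν ν<t →
      let (X₀ , all)             = h ν ν<t
          (X₁ , pos , _ , ≥X₀) = above-1 X₀
      in ≤±-trans (≤-inf _ λ (X , p) → at-≥ (all X (≤-trans ≥X₀ p))) (≤-sup _ (X₁ , pos))

    ω̂-≤ : ∀ {t} → (∀ ν → t < ν → ∀ X₀ → ∃ λ X → X₀ ≤ X × 1# ≤ X × ¬ H X ν) → ω̂ ζ j ≤± [ t ]
    ω̂-≤ h = sup-≤ _ λ (X₀ , _) → ≤±-from-above λ ν t<ν →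
      let (X , p , ≥1 , none) = h ν t<ν X₀ in ≤±-trans (inf-≤ _ (X , p)) (at-≤ ≥1 none)

  -- Linear dependence over the integers

  open RawSemiringOps ℤ.+-*-rawSemiring using () renaming (sum to sumℤ)
  open CommutativeMonoidSum ℤ.+-0-commutativeMonoid using (sum-remove; ∑-distrib-+; sum-cong-≗)
  open SemiringSum ℤ.+-*-semiring using (*-distribʳ-sum)

  sumℤ-0 : ∀ {n} (f : Fin n → ℤ) → (∀ i → f i ≡ ℤ.0ℤ) → sumℤ f ≡ ℤ.0ℤ
  sumℤ-0 {zero}  f h = ≡.refl
  sumℤ-0 {suc n} f h = ≡.cong₂ ℤ._+_ (h Fin.zero)
    (sumℤ-0 (λ i → f (Fin.suc i)) (λ i → h (Fin.suc i)))

  sumℤ-linear : ∀ {n} (f g : Fin n → ℤ) x y →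
    sumℤ (λ i → f i ℤ.* x ℤ.+ g i ℤ.* y) ≡ sumℤ f ℤ.* x ℤ.+ sumℤ g ℤ.* y
  sumℤ-linear f g x y = ≡.trans (∑-distrib-+ (λ i → f i ℤ.* x) (λ i → g i ℤ.* y))
    (≡.sym (≡.cong₂ ℤ._+_ (*-distribʳ-sum x f) (*-distribʳ-sum y g)))

  -- Gaussian elimination without fractions. A column of zeros is dropped; otherwise a pivot a in
  -- row p clears the column when row i is replaced by a times row i minus its leading entry times
  -- row p.
  too-many-dependent : ∀ d {j} → d ℕ.< j → (v : Fin j → Fin d → ℤ) → ¬ LinearlyIndependent v
  too-many-dependent zero {suc j} _ v independent with independent (λ _ → ℤ.1ℤ) (λ ()) Fin.zero
  ... | ()
  too-many-dependent (suc d) {suc j} (ℕ.s≤s d<j) v independent with Fin.any?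
    (λ i → ¬? (v i Fin.zero ℤ.≟ ℤ.0ℤ))
  ... | no none = too-many-dependent d (ℕ.m<n⇒m<1+n d<j) (λ i l → v i (Fin.suc l)) λ c h → independent c λ where
          Fin.zero    → sumℤ-0 _ λ i → ≡.trans (≡.cong (c i ℤ.*_) (vanish i)) (ℤ.*-zeroʳ (c i))
          (Fin.suc l) → h l
    where
    vanish : ∀ i → v i Fin.zero ≡ ℤ.0ℤ
    vanish i = decidable-stable (v i Fin.zero ℤ.≟ ℤ.0ℤ) λ n → none (i , n)
  ... | yes (p , a≢0) = too-many-dependent d d<j w w-independent
    where
    a = v p Fin.zero
    others : Fin j → Fin (suc d) → ℤ
    others i = v (Fin.punchIn p i)
    w : Fin j → Fin d → ℤ
    w i l = a ℤ.* others i (Fin.suc l) ℤ.+ (ℤ.- others i Fin.zero) ℤ.* v p (Fin.suc l)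
    module _ (c : Fin j → ℤ) (h : ∀ l → sumℤ (λ i → c i ℤ.* w i l) ≡ ℤ.0ℤ) where
      s = sumℤ (λ i → c i ℤ.* others i Fin.zero)
      -- A relation c among the reduced rows lifts to the original rows: each other row gets c i a,
      -- and the pivot row gets the coefficient that collects all subtracted multiples.
      C : Fin (suc j) → ℤ
      C = Functional.insertAt (λ i → c i ℤ.* a) p (ℤ.- s)
      C-sum : ∀ l → sumℤ (λ i → C i ℤ.* v i l) ≡ ℤ.- s ℤ.* v p l ℤ.+ sumℤ
        (λ i → (c i ℤ.* a) ℤ.* others i l)
      C-sum l = ≡.trans (sum-remove {i = p} (λ i → C i ℤ.* v i l))
        (≡.cong₂ ℤ._+_ (≡.cong (ℤ._* v p l) (Functional.insertAt-lookup (λ i → c i ℤ.* a) p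
          (ℤ.- s)))
          (sum-cong-≗ λ i → ≡.cong (ℤ._* others i l)
            (Functional.insertAt-punchIn (λ i → c i ℤ.* a) p (ℤ.- s) i)))
      rearrange : ∀ x y z a → (x ℤ.* a) ℤ.* y ≡ (x ℤ.* y) ℤ.* a ℤ.+ ℤ.0ℤ ℤ.* z
      rearrange = solve-∀
      cancel : ∀ s a t z → ℤ.- s ℤ.* a ℤ.+ (s ℤ.* a ℤ.+ t ℤ.* z) ≡ t ℤ.* z
      cancel = solve-∀
      expand : ∀ c a y x z → (c ℤ.* a) ℤ.* y ≡ (c ℤ.* (a ℤ.* y ℤ.+ (ℤ.- x) ℤ.* z)) ℤ.* ℤ.1ℤ ℤ.+
        (c ℤ.* x) ℤ.* z
      expand = solve-∀
      collect : ∀ s z t → ℤ.- s ℤ.* z ℤ.+ (t ℤ.* ℤ.1ℤ ℤ.+ s ℤ.* z) ≡ t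
      collect = solve-∀
      combination : ∀ l → sumℤ (λ i → C i ℤ.* v i l) ≡ ℤ.0ℤ
      combination Fin.zero = ≡.trans (C-sum Fin.zero) (≡.trans (≡.cong (λ t → ℤ.- s ℤ.* a ℤ.+ t)
        (≡.trans (sum-cong-≗ λ i → rearrange (c i) (others i Fin.zero) ℤ.0ℤ a)
          (sumℤ-linear (λ i → c i ℤ.* others i Fin.zero) (λ _ → ℤ.0ℤ) a ℤ.0ℤ)))
        (≡.trans (cancel s a (sumℤ {j} (λ _ → ℤ.0ℤ)) ℤ.0ℤ) (ℤ.*-zeroʳ (sumℤ {j} (λ _ → ℤ.0ℤ)))))
      combination (Fin.suc l) = ≡.trans (C-sum (Fin.suc l))
        (≡.trans (≡.cong (λ t → ℤ.- s ℤ.* z ℤ.+ t)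
        (≡.trans (sum-cong-≗ λ i → expand (c i) a (others i (Fin.suc l)) (others i Fin.zero) z)
          (sumℤ-linear (λ i → c i ℤ.* w i l) (λ i → c i ℤ.* others i Fin.zero) ℤ.1ℤ z)))
        (≡.trans (collect s z _) (h l)))
        where z = v p (Fin.suc l)
      w-zero : ∀ i → c i ≡ ℤ.0ℤ
      w-zero i with ℤ.i*j≡0⇒i≡0∨j≡0 (c i) (≡.trans
        (≡.sym (Functional.insertAt-punchIn (λ i → c i ℤ.* a) p (ℤ.- s) i))
        (independent C combination (Fin.punchIn p i)))
      ... | inj₁ e = e
      ... | inj₂ e = ⊥-elim (a≢0 e)
    w-independent : LinearlyIndependent w
    w-independent = w-zero

  interval-induction : ∀ {lo hi} (P : ℕ → Set) → P lo →
    (∀ m → lo ℕ.≤ m → m ℕ.< hi → P m → P (suc m)) →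
    ∀ m → lo ℕ.≤ m → m ℕ.≤ hi → P m
  interval-induction P base step m lo≤m m≤hi with ℕ.m≤n⇒m<n∨m≡n lo≤m
  ... | inj₂ ≡.refl = base
  interval-induction P base step (suc m) _ m<hi | inj₁ (ℕ.s≤s lo≤m) =
    step m lo≤m m<hi (interval-induction P base step m lo≤m (ℕ.<⇒≤ m<hi))

  -- This factor 2 is what makes the series for ζᵢ decay geometrically.
  proper-multiple : ∀ {m n} → m ∣ n → m ℕ.< n → 2 ℕ.* m ℕ.≤ n
  proper-multiple (divides zero ≡.refl)          ()
  proper-multiple (divides (suc zero) ≡.refl)    m<n = ⊥-elim
    (ℕ.<-irrefl (≡.sym (ℕ.+-identityʳ _)) m<n)
  proper-multiple {m} (divides (suc (suc e)) ≡.refl) _ = ℕ.*-monoˡ-≤ m (ℕ.s≤s (ℕ.s≤s (ℕ.z≤n {e})))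

  -- Zero divides only zero. Positivity of the denominators thus follows from their strictly
  -- increasing chain of divisibility.
  divisor-of-larger-pos : ∀ {m n} → m ∣ n → m ℕ.< n → 1 ℕ.≤ m
  divisor-of-larger-pos {zero}  (divides e ≡.refl) 0<n = ⊥-elim
    (ℕ.<-irrefl (≡.sym (ℕ.*-zeroʳ e)) 0<n)
  divisor-of-larger-pos {suc _} _                  _   = ℕ.s≤s ℕ.z≤n

  -- Integral field elements and dependence forced by linear equations

  IsInt : ℝ → Set
  IsInt r = ∃ λ z → fromℤ z ≈ r

  isInt-fromℤ : ∀ z → IsInt (fromℤ z)
  isInt-fromℤ z = z , refl

  isInt-fromℕ : ∀ n → IsInt (fromℕ n)
  isInt-fromℕ n = + n , refl

  isInt-+ : ∀ {x y} → IsInt x → IsInt y → IsInt (x + y)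
  isInt-+ (a , p) (b , r) = a ℤ.+ b , trans (fromℤ-+ a b) (+-cong p r)

  isInt-* : ∀ {x y} → IsInt x → IsInt y → IsInt (x * y)
  isInt-* (a , p) (b , r) = a ℤ.* b , trans (fromℤ-* a b) (*-cong p r)

  isInt-neg : ∀ {x} → IsInt x → IsInt (- x)
  isInt-neg (a , p) = ℤ.- a , trans (fromℤ-neg a) (-‿cong p)

  isInt-resp : ∀ {x y} → x ≈ y → IsInt x → IsInt y
  isInt-resp e (a , p) = a , trans p e

  isInt-small : ∀ {x} → IsInt x → x < 1# → - x < 1# → x ≈ 0#
  isInt-small (a , p) h g = trans (sym p) (reflexive (≡.cong fromℤ
    (fromℤ-small a (<-respˡ (sym p) h) (<-respˡ (-‿cong (sym p)) g))))

  -- The sums are over integers but the coefficients s and t are partial sums and unit fractions, so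
  -- the relation has to be carried through in the field.
  sumℤ-linear-relation : ∀ {n} (h f g : Fin n → ℤ) s t →
    (∀ p → fromℤ (h p) ≈ s * fromℤ (f p) + t * fromℤ (g p)) →
    fromℤ (sumℤ h) ≈ s * fromℤ (sumℤ f) + t * fromℤ (sumℤ g)
  sumℤ-linear-relation {zero}  h f g s t e = (solve 2 (λ s t → κ 0 := s :* κ 0 :+ t :* κ 0)
    (s ∷ t ∷ []))
  sumℤ-linear-relation {suc n} h f g s t e = trans (fromℤ-+ h₀ h₊)
    (trans (+-cong (e Fin.zero) (sumℤ-linear-relation _ _ _ s t (λ p → e (Fin.suc p))))
    (trans (solve 6 (λ s a t b c d → s :* a :+ t :* b :+ (s :* c :+ t :* d) := s :* (a :+ c) :+ t :*
      (b :+ d)) (s ∷ (fromℤ f₀) ∷ t ∷ (fromℤ g₀) ∷ (fromℤ f₊) ∷ (fromℤ g₊) ∷ []))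
      (sym (+-cong (*-congˡ (fromℤ-+ f₀ f₊)) (*-congˡ (fromℤ-+ g₀ g₊))))))
    where
    h₀ = h Fin.zero
    f₀ = f Fin.zero
    g₀ = g Fin.zero
    h₊ = sumℤ (λ p → h (Fin.suc p))
    f₊ = sumℤ (λ p → f (Fin.suc p))
    g₊ = sumℤ (λ p → g (Fin.suc p))

  scaled-relation : ∀ {x y w} c s t → fromℤ y ≈ s * fromℤ x + t * fromℤ w →
    fromℤ (c ℤ.* y) ≈ s * fromℤ (c ℤ.* x) + t * fromℤ (c ℤ.* w)
  scaled-relation {x} {y} {w} c s t e = trans (fromℤ-* c y) (trans (*-congˡ e)
    (trans (solve 5 (λ a s b t c → a :* (s :* b :+ t :* c) := s :* (a :* b) :+ t :* (a :* c))
      ((fromℤ c) ∷ s ∷ (fromℤ x) ∷ t ∷ (fromℤ w) ∷ []))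
      (sym (+-cong (*-congˡ (fromℤ-* c x)) (*-congˡ (fromℤ-* c w))))))

  -- Vectors (x , y₁ , … , y_k) in which every yᵢ outside the range I < i ≤ M is a fixed multiple of x
  -- are determined by the remaining 1 + (M - I) coordinates.
  constrained-dependent : ∀ {k j} (v : Fin j → Fin (suc k) → ℤ) I M → I ℕ.≤ M → M ℕ.≤ k →
    (∀ i → toℕ i ℕ.< I ⊎ M ℕ.≤ toℕ i → ∃ λ s → ∀ p →
      fromℤ (v p (Fin.suc i)) ≈ s * fromℤ (v p Fin.zero)) →
    suc (M ∸ I) ℕ.< j → ¬ LinearlyIndependent v
  constrained-dependent {k} {j} v I M I≤M M≤k constrained d<j independent =
    too-many-dependent (suc (M ∸ I)) d<j (λ p l → v p (free l)) λ c h →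
      independent c (combination c h)
    where
    I+t<k : ∀ (t : Fin (M ∸ I)) → I ℕ.+ toℕ t ℕ.< k
    I+t<k t = ℕ.<-≤-trans (ℕ.+-monoʳ-< I (Fin.toℕ<n t))
      (ℕ.≤-trans (ℕ.≤-reflexive (ℕ.m+[n∸m]≡n I≤M)) M≤k)
    free : Fin (suc (M ∸ I)) → Fin (suc k)
    free Fin.zero    = Fin.zero
    free (Fin.suc t) = Fin.suc (Fin.fromℕ< (I+t<k t))
    module _ (c : Fin j → ℤ) (h : ∀ l → sumℤ (λ p → c p ℤ.* v p (free l)) ≡ ℤ.0ℤ) where
      determined : ∀ i → toℕ i ℕ.< I ⊎ M ℕ.≤ toℕ i → sumℤ (λ p → c p ℤ.* v p (Fin.suc i)) ≡ ℤ.0ℤ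
      determined i out = let (s , e) = constrained i out in fromℤ-injective _ ℤ.0ℤ (trans
        (sumℤ-linear-relation _ (λ p → c p ℤ.* v p Fin.zero) (λ p → c p ℤ.* v p Fin.zero) s 0#
          λ p → scaled-relation {v p Fin.zero} {v p (Fin.suc i)} {v p Fin.zero} (c p) s 0#
            (trans (e p)
            (solve 2 (λ s x → s :* x := s :* x :+ κ 0 :* x) (s ∷ fromℤ (v p Fin.zero) ∷ []))))
        (trans (+-cong (*-congˡ (reflexive (≡.cong fromℤ (h Fin.zero)))) (zeroˡ _))
          (solve 1 (λ s → s :* κ 0 :+ κ 0 := κ 0) (s ∷ []))))
      combination : ∀ l → sumℤ (λ p → c p ℤ.* v p l) ≡ ℤ.0ℤ
      combination Fin.zero    = h Fin.zero
      combination (Fin.suc i) with toℕ i ℕ.<? I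
      ... | yes i<I = determined i (inj₁ i<I)
      ... | no i≮I with M ℕ.≤? toℕ i
      ...   | yes M≤i = determined i (inj₂ M≤i)
      ...   | no M≰i  = ≡.subst (λ l → sumℤ (λ p → c p ℤ.* v p (Fin.suc l)) ≡ ℤ.0ℤ) same
        (h (Fin.suc t))
        where
        I≤i = ℕ.≮⇒≥ i≮I
        i<M = ℕ.≰⇒> M≰i
        t = Fin.fromℕ< (ℕ.∸-monoˡ-< i<M I≤i)
        same : Fin.fromℕ< (I+t<k t) ≡ i
        same = Fin.toℕ-injective (≡.trans (Fin.toℕ-fromℕ< (I+t<k t))
          (≡.trans (≡.cong (I ℕ.+_) (Fin.toℕ-fromℕ< (ℕ.∸-monoˡ-< i<M I≤i))) (ℕ.m+[n∸m]≡n I≤i)))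

  -- Tails of series, exponential comparison, maxima and minima

  -- The partial sums s n increase, while s n + 2 u (n+1) decreases by the halving condition; the
  -- limit lies between the two.
  series-bounds : ∀ {u : ℕ → ℝ} → (∀ n → 0# ≤ u (suc n)) →
    (∀ n → 2# * u (suc (suc n)) ≤ u (suc n)) →
    ∀ N → Σ₁ N u ≤ series₁ u × series₁ u ≤ Σ₁ N u + 2# * u (suc N)
  series-bounds {u} u≥0 halving N = ≤-respʳ (sym value) (proj₂ (proj₂ limit) N ℕ.z≤n) ,
    ≤-respˡ (sym value) (⟶-≤ (proj₁ (proj₂ limit)) (N , λ n N≤n → upper N n N≤n))
    where
    s : ℕ → ℝ
    s n = Σ₁ n u
    upper : ∀ m n → m ℕ.≤ n → s n ≤ s m + 2# * u (suc m)
    upper m n m≤n = ≤-trans (≤-by (+-nonneg (u≥0 n) (u≥0 n))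
      (solve 2 (λ a b → a :+ κ 2 :* b :- a := b :+ b) ((s n) ∷ (u (suc n)) ∷ [])))
      (≤-by (≤-diff (monotone-steps {λ n → - (s n + 2# * u (suc n))} {0}        
        (λ n _ → (≤-by (≤-diff (halving n)) (solve 3
        (λ a b c → :- (a :+ b :+ κ 2 :* c) :- :- (a :+ κ 2 :* b) := b :- κ 2 :* c)
        ((s n) ∷ (u (suc n)) ∷ (u (suc (suc n))) ∷ []))))         ℕ.z≤n m≤n))
        (solve 4 (λ a b c d → a :+ κ 2 :* b :- (c :+ κ 2 :* d) := :- (c :+ κ 2 :* d) :- :-
        (a :+ κ 2 :* b)) ((s m) ∷ (u (suc m)) ∷ (s n) ∷ (u (suc n)) ∷ [])))
    limit = monotone-converges {s} {0} {s 0 + 2# * u 1}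
      (λ n _ → (≤-by (u≥0 n) (solve 2 (λ a b → a :+ b :- a := b) ((s n) ∷ (u (suc n)) ∷ []))))
        (λ n _ → upper 0 n ℕ.z≤n)
    value : series₁ u ≈ proj₁ limit
    value = lim-≈ (proj₁ (proj₂ limit))

  -- Triangle inequality for y - σ x = (y - ζ x) + (ζ - σ) x with 0 ≤ ζ - σ ≤ τ.
  approximation : ∀ {ζ σ τ x y X δ} → σ ≤ ζ → ζ ≤ σ + τ → ∣ x ∣ ≤ X → ∣ ζ * x - y ∣ ≤ δ →
    ∣ y - σ * x ∣ ≤ δ + τ * X
  approximation {ζ} {σ} {τ} {x} {y} {X} {δ} σ≤ζ ζ≤σ+τ x≤X close = ∣x∣≤
    (≤-by (+-nonneg (+-nonneg (≤-diff (≤-trans (-x≤∣x∣ _) close))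
      (*-nonneg (≤-diff σ≤ζ) (≤-diff (≤-trans (x≤∣x∣ x) x≤X))))
      (*-nonneg (≤-diff ζ≤σ+τ) (≤-trans (∣∣-nonneg x) x≤X)))
      (solve 7 (λ δ τ X y σ x ζ → δ :+ τ :* X :- (y :- σ :* x) := δ :- :- (ζ :* x :- y) :+ (ζ :- σ)
      :* (X :- x) :+ (σ :+ τ :- ζ) :* X) (δ ∷ τ ∷ X ∷ y ∷ σ ∷ x ∷ ζ ∷ [])))
    (≤-by (+-nonneg (+-nonneg (≤-diff (≤-trans (x≤∣x∣ _) close))
      (*-nonneg (≤-diff σ≤ζ) (≤-diff (≤-trans (-x≤∣x∣ x) x≤X))))
      (*-nonneg (≤-diff ζ≤σ+τ) (≤-trans (∣∣-nonneg x) x≤X)))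
      (solve 7 (λ δ τ X y σ x ζ → δ :+ τ :* X :- :- (y :- σ :* x) := δ :- (ζ :* x :- y) :+ (ζ :- σ)
      :* (X :- :- x) :+ (σ :+ τ :- ζ) :* X) (δ ∷ τ ∷ X ∷ y ∷ σ ∷ x ∷ ζ ∷ [])))

  exp-≤ : ∀ {x y a b} → x ≈ exp a → y ≈ exp b → a ≤ b → x ≤ y
  exp-≤ p r h = ≤-respˡ (sym p) (≤-respʳ (sym r) (exp-mono-≤ h))

  exp-< : ∀ {x y a b} → x ≈ exp a → y ≈ exp b → a < b → x < y
  exp-< p r h = <-respˡ (sym p) (<-respʳ (sym r) (exp-mono-< h))

  exp-⊗ : ∀ {x y a b} → x ≈ exp a → y ≈ exp b → x * y ≈ exp (a + b)
  exp-⊗ p r = trans (*-cong p r) (sym (exp-+ _ _))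

  x≤exp : ∀ x → x ≤ exp x
  x≤exp x = (≤-by (+-nonneg (≤-diff (1+x≤exp x)) 0≤1)
    (solve 2 (λ a x → a :- x := a :- (κ 1 :+ x) :+ κ 1) ((exp x) ∷ x ∷ [])))

  -- A discrete intermediate value principle, valid for any f. It places log X among the blocks, and
  -- inside a block among the thresholds belonging to the a n m.
  crossing : ∀ (f : ℕ → ℝ) {x} lo d → f lo ≤ x → x < f (lo ℕ.+ d) →
    ∃ λ m → lo ℕ.≤ m × m ℕ.< lo ℕ.+ d × f m ≤ x × x < f (suc m)
  crossing f lo zero    p r = ⊥-elim (<⇒≱ (<-respʳ (reflexive (≡.cong f (ℕ.+-identityʳ lo))) r) p)
  crossing f {x} lo (suc d) p r with ≤⊎> (f (lo ℕ.+ d)) x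
  ... | inj₁ h = lo ℕ.+ d , ℕ.m≤m+n lo d , ℕ.+-monoʳ-< lo (ℕ.n<1+n d) , h , <-respʳ
    (reflexive (≡.cong f (ℕ.+-suc lo d))) r
  ... | inj₂ h = let (m , lo≤m , m< , s) = crossing f lo d p h in m , lo≤m , ℕ.<-trans m< (ℕ.+-monoʳ-< lo (ℕ.n<1+n d)) , s

  log4 : ℝ
  log4 = log 4#

  4≈exp : 4# ≈ exp log4
  4≈exp = sym (exp-log 0<4)

  private
    maxFrom-≥ : ∀ (f : ℕ → ℝ) lo d e → e ℕ.≤ d → f (lo ℕ.+ e) ≤ maxFrom lo d f
    maxFrom-≥ f lo zero    zero    _   = ≤-reflexive (reflexive (≡.cong f (ℕ.+-identityʳ lo)))
    maxFrom-≥ f lo (suc d) e       e≤d with ℕ.m≤n⇒m<n∨m≡n e≤d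
    ... | inj₁ (ℕ.s≤s e≤d′) = ≤-trans (maxFrom-≥ f lo d e e≤d′) (x≤x⊔y _ _)
    ... | inj₂ ≡.refl        = x≤y⊔x _ _

    minFrom-≤ : ∀ (f : ℕ → ℝ) lo d e → e ℕ.≤ d → minFrom lo d f ≤ f (lo ℕ.+ e)
    minFrom-≤ f lo zero    zero    _   = ≤-reflexive
      (reflexive (≡.cong f (≡.sym (ℕ.+-identityʳ lo))))
    minFrom-≤ f lo (suc d) e       e≤d with ℕ.m≤n⇒m<n∨m≡n e≤d
    ... | inj₁ (ℕ.s≤s e≤d′) = ≤-trans (x⊓y≤x _ _) (minFrom-≤ f lo d e e≤d′)
    ... | inj₂ ≡.refl        = x⊓y≤y _ _

    maxFrom-attained : ∀ (f : ℕ → ℝ) lo d → ∃ λ e → e ℕ.≤ d × maxFrom lo d f ≈ f (lo ℕ.+ e)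
    maxFrom-attained f lo zero    = 0 , ℕ.z≤n , reflexive (≡.cong f (≡.sym (ℕ.+-identityʳ lo)))
    maxFrom-attained f lo (suc d) with ⊔-sel (maxFrom lo d f) (f (lo ℕ.+ suc d))
    ... | inj₁ h = let (e , e≤d , p) = maxFrom-attained f lo d in e , ℕ.m≤n⇒m≤1+n e≤d , trans h p
    ... | inj₂ h = suc d , ℕ.≤-refl , h

    minFrom-attained : ∀ (f : ℕ → ℝ) lo d → ∃ λ e → e ℕ.≤ d × minFrom lo d f ≈ f (lo ℕ.+ e)
    minFrom-attained f lo zero    = 0 , ℕ.z≤n , reflexive (≡.cong f (≡.sym (ℕ.+-identityʳ lo)))
    minFrom-attained f lo (suc d) with ⊓-sel (minFrom lo d f) (f (lo ℕ.+ suc d))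
    ... | inj₁ h = let (e , e≤d , p) = minFrom-attained f lo d in e , ℕ.m≤n⇒m≤1+n e≤d , trans h p
    ... | inj₂ h = suc d , ℕ.≤-refl , h

  module _ (f : ℕ → ℝ) {lo hi : ℕ} where

    ≤-max : ∀ {m} → lo ℕ.≤ m → m ℕ.≤ hi → f m ≤ max[ lo , hi ] f
    ≤-max {m} lo≤m m≤hi = ≤-respˡ (reflexive (≡.cong f (ℕ.m+[n∸m]≡n lo≤m)))
      (maxFrom-≥ f lo (hi ∸ lo) (m ∸ lo) (ℕ.∸-monoˡ-≤ lo m≤hi))

    min-≤ : ∀ {m} → lo ℕ.≤ m → m ℕ.≤ hi → min[ lo , hi ] f ≤ f m
    min-≤ {m} lo≤m m≤hi = ≤-respʳ (reflexive (≡.cong f (ℕ.m+[n∸m]≡n lo≤m)))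
      (minFrom-≤ f lo (hi ∸ lo) (m ∸ lo) (ℕ.∸-monoˡ-≤ lo m≤hi))

    private
      in-range : lo ℕ.≤ hi → ∀ {e} → e ℕ.≤ hi ∸ lo → lo ℕ.+ e ℕ.≤ hi
      in-range lo≤hi e≤ = ℕ.≤-trans (ℕ.+-monoʳ-≤ lo e≤) (ℕ.≤-reflexive (ℕ.m+[n∸m]≡n lo≤hi))

    max-attained : lo ℕ.≤ hi → ∃ λ m → lo ℕ.≤ m × m ℕ.≤ hi × max[ lo , hi ] f ≈ f m
    max-attained lo≤hi = let (e , e≤ , p) = maxFrom-attained f lo (hi ∸ lo) in lo ℕ.+ e , ℕ.m≤m+n lo e , in-range lo≤hi e≤ , p

    min-attained : lo ℕ.≤ hi → ∃ λ m → lo ℕ.≤ m × m ℕ.≤ hi × min[ lo , hi ] f ≈ f m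
    min-attained lo≤hi = let (e , e≤ , p) = minFrom-attained f lo (hi ∸ lo) in lo ℕ.+ e , ℕ.m≤m+n lo e , in-range lo≤hi e≤ , p

  -- The denominators and their partial sums

  module Denominators
    (k′ : ℕ) (q : ℕ → ℕ → ℕ)
    (row-<  : ∀ n j → 1 ℕ.≤ n → 1 ℕ.≤ j → j ℕ.< suc k′ → q n j ℕ.< q n (suc j))
    (next-< : ∀ n → 1 ℕ.≤ n → q n (suc k′) ℕ.< q (suc n) 1)
    (row-∣  : ∀ n j → 1 ℕ.≤ n → 1 ℕ.≤ j → j ℕ.< suc k′ → q n j ∣ q n (suc j))
    (next-∣ : ∀ n → 1 ℕ.≤ n → q n (suc k′) ∣ q (suc n) 1)
    where

    k : ℕ
    k = suc k′

    -- Block n: the denominators q (n+1) m for 1 ≤ m ≤ k, preceded by q n k at m = 0.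
    a : ℕ → ℕ → ℕ
    a n zero    = q n k
    a n (suc i) = q (suc n) (suc i)

    module _ {n : ℕ} (n≥1 : 1 ℕ.≤ n) where

      a-<-step : ∀ m → m ℕ.< k → a n m ℕ.< a n (suc m)
      a-<-step zero    _   = next-< n n≥1
      a-<-step (suc i) i<k = row-< (suc n) (suc i) (ℕ.s≤s ℕ.z≤n) (ℕ.s≤s ℕ.z≤n) i<k

      a-∣-step : ∀ m → m ℕ.< k → a n m ∣ a n (suc m)
      a-∣-step zero    _   = next-∣ n n≥1
      a-∣-step (suc i) i<k = row-∣ (suc n) (suc i) (ℕ.s≤s ℕ.z≤n) (ℕ.s≤s ℕ.z≤n) i<k

      a-∣ : ∀ {l m} → l ℕ.≤ m → m ℕ.≤ k → a n l ∣ a n m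
      a-∣ {l} {m} l≤m m≤k = interval-induction (λ m → a n l ∣ a n m) ∣-refl
        (λ m _ m<k p → ∣-trans p (a-∣-step m m<k)) m l≤m m≤k

      a-mono : ∀ {l m} → l ℕ.≤ m → m ℕ.≤ k → a n l ℕ.≤ a n m
      a-mono {l} {m} l≤m m≤k = interval-induction (λ m → a n l ℕ.≤ a n m) ℕ.≤-refl
        (λ m _ m<k p → ℕ.≤-trans p (ℕ.<⇒≤ (a-<-step m m<k))) m l≤m m≤k

      q-∣-row : ∀ {l m} → 1 ℕ.≤ l → l ℕ.≤ m → m ℕ.≤ k → q n l ∣ q n m
      q-∣-row {l} {m} l≥1 l≤m m≤k = interval-induction (λ m → q n l ∣ q n m) ∣-refl
        (λ m l≤m m<k p → ∣-trans p (row-∣ n m n≥1 (ℕ.≤-trans l≥1 l≤m) m<k)) m l≤m m≤k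

      q-mono-row : ∀ {l m} → 1 ℕ.≤ l → l ℕ.≤ m → m ℕ.≤ k → q n l ℕ.≤ q n m
      q-mono-row {l} {m} l≥1 l≤m m≤k = interval-induction (λ m → q n l ℕ.≤ q n m) ℕ.≤-refl
        (λ m l≤m m<k p → ℕ.≤-trans p (ℕ.<⇒≤ (row-< n m n≥1 (ℕ.≤-trans l≥1 l≤m) m<k))) m l≤m m≤k

      q-pos : ∀ {l} → 1 ℕ.≤ l → l ℕ.≤ k → 1 ℕ.≤ q n l
      q-pos {l} l≥1 l≤k with ℕ.m≤n⇒m<n∨m≡n l≤k
      ... | inj₁ l<k    = divisor-of-larger-pos (row-∣ n l n≥1 l≥1 l<k) (row-< n l n≥1 l≥1 l<k)
      ... | inj₂ ≡.refl = divisor-of-larger-pos (next-∣ n n≥1) (next-< n n≥1)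

      a-pos : ∀ {m} → m ℕ.≤ k → 1 ℕ.≤ a n m
      a-pos m≤k = ℕ.≤-trans (q-pos (ℕ.s≤s ℕ.z≤n) ℕ.≤-refl) (a-mono ℕ.z≤n m≤k)

      column-∣ : ∀ {l} → 1 ℕ.≤ l → l ℕ.≤ k → q n l ∣ q (suc n) l
      column-∣ {suc l} l≥1 l≤k = ∣-trans (q-∣-row l≥1 l≤k ℕ.≤-refl) (a-∣ {0} {suc l} ℕ.z≤n l≤k)

      column-< : ∀ {l} → 1 ℕ.≤ l → l ℕ.≤ k → q n l ℕ.< q (suc n) l
      column-< {suc l} l≥1 l≤k = ℕ.≤-<-trans (q-mono-row l≥1 l≤k ℕ.≤-refl)
        (ℕ.<-≤-trans (next-< n n≥1) (a-mono {1} {suc l} (ℕ.s≤s ℕ.z≤n) l≤k))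

    k≤k : k ℕ.≤ k
    k≤k = ℕ.≤-refl

    aʳ : ℕ → ℕ → ℝ
    aʳ n m = fromℕ (a n m)

    aʳ-pos : ∀ {n m} → 1 ℕ.≤ n → m ℕ.≤ k → 0# < aʳ n m
    aʳ-pos n≥1 m≤k = fromℕ-pos (a-pos n≥1 m≤k)

    aʳ-mono : ∀ {n l m} → 1 ℕ.≤ n → l ℕ.≤ m → m ℕ.≤ k → aʳ n l ≤ aʳ n m
    aʳ-mono n≥1 l≤m m≤k = fromℕ-mono-≤ (a-mono n≥1 l≤m m≤k)

    -- The column of the coordinate i : Fin k is suc (toℕ i).
    u : Fin k → ℕ → ℝ
    u i n = 1# / fromℕ (q n (suc (toℕ i)))

    ζ : Fin k → ℝ
    ζ i = series₁ (u i)

    Σu : Fin k → ℕ → ℝ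
    Σu i N = Σ₁ N (u i)

    private
      col≤k : ∀ (i : Fin k) → suc (toℕ i) ℕ.≤ k
      col≤k = Fin.toℕ<n

    q-pos-col : ∀ i n → 1 ℕ.≤ n → 0# < fromℕ (q n (suc (toℕ i)))
    q-pos-col i n n≥1 = fromℕ-pos (q-pos n≥1 (ℕ.s≤s ℕ.z≤n) (col≤k i))

    u-* : ∀ i n → 1 ℕ.≤ n → fromℕ (q n (suc (toℕ i))) * u i n ≈ 1#
    u-* i n n≥1 = trans (*-congˡ (*-identityˡ _)) (pos-⁻¹ (q-pos-col i n n≥1))

    u-pos : ∀ i n → 1 ℕ.≤ n → 0# < u i n
    u-pos i n n≥1 = /-pos 0<1 (q-pos-col i n n≥1)

    u-≤ : ∀ i n {B} → 1 ℕ.≤ n → 0# < B → B ≤ fromℕ (q n (suc (toℕ i))) → B * u i n ≤ 1#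
    u-≤ i n {B} n≥1 B>0 B≤q = (≤-by (+-nonneg (*-nonneg (≤-diff B≤q) (<⇒≤ (u-pos i n n≥1)))
      (eq-nonneg (- 1#) (u-* i n n≥1))) (solve 3
      (λ B a b → κ 1 :- B :* a := (b :- B) :* a :+ :- (κ 1) :* (b :* a :- κ 1))
      (B ∷ (u i n) ∷ (fromℕ (q n (suc (toℕ i)))) ∷ [])))

    ζ-bounds : ∀ i N → Σu i N ≤ ζ i × ζ i ≤ Σu i N + 2# * u i (suc N)
    ζ-bounds i = series-bounds (λ n → <⇒≤ (u-pos i (suc n) (ℕ.s≤s ℕ.z≤n))) halving
      where
      c = suc (toℕ i)
      halving : ∀ n → 2# * u i (suc (suc n)) ≤ u i (suc n)
      halving n = *-cancelʳ-≤ (*-pos (q-pos-col i (suc n) n≥1) (q-pos-col i (suc (suc n)) n+1≥1))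
        (≤-by (+-nonneg (+-nonneg (≤-diff double)
          (eq-nonneg (- (2# * q₁)) (u-* i (suc (suc n)) n+1≥1))) (eq-nonneg q₂ (u-* i (suc n) n≥1)))
          (solve 4 (λ a q₁ q₂ b → a :* (q₁ :* q₂) :- κ 2 :* b :* (q₁ :* q₂) := q₂ :- κ 2 :* q₁ :+ :-
          (κ 2 :* q₁) :* (q₂ :* b :- κ 1) :+ q₂ :* (q₁ :* a :- κ 1))
          ((u i (suc n)) ∷ q₁ ∷ q₂ ∷ (u i (suc (suc n))) ∷ [])))
        where
        n≥1 : 1 ℕ.≤ suc n
        n≥1 = ℕ.s≤s ℕ.z≤n
        n+1≥1 : 1 ℕ.≤ suc (suc n)
        n+1≥1 = ℕ.s≤s ℕ.z≤n
        q₁ = fromℕ (q (suc n) c)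
        q₂ = fromℕ (q (suc (suc n)) c)
        double : 2# * q₁ ≤ q₂
        double = ≤-respˡ (trans (fromℕ-* 2 (q (suc n) c))
          (*-congʳ (solve 0 (κ 1 :+ (κ 1 :+ κ 0) := κ 2) [])))
          (fromℕ-mono-≤ (proper-multiple (column-∣ n≥1 (ℕ.s≤s ℕ.z≤n) (col≤k i))
            (column-< n≥1 (ℕ.s≤s ℕ.z≤n) (col≤k i))))

    -- Each earlier denominator of the column divides the last one. The divisibility is asked for N
    -- ≥ 1 only: the sum is empty for N = 0, and nothing is known about row 0 of q.
    partial-integral : ∀ i N D → (1 ℕ.≤ N → q N (suc (toℕ i)) ∣ D) → IsInt (fromℕ D * Σu i N)
    partial-integral i zero    D _   = isInt-resp (sym (zeroʳ _)) (isInt-fromℕ 0)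
    partial-integral i (suc N) D q∣D = isInt-resp (sym (distribˡ _ _ _))
      (isInt-+ (partial-integral i N D earlier)
        (isInt-resp (sym (quotient (q∣D (ℕ.s≤s ℕ.z≤n))))
        (isInt-fromℕ (_∣_.quotient (q∣D (ℕ.s≤s ℕ.z≤n))))))
      where
      earlier : 1 ℕ.≤ N → q N (suc (toℕ i)) ∣ D
      earlier N≥1 = ∣-trans (column-∣ N≥1 (ℕ.s≤s ℕ.z≤n) (col≤k i)) (q∣D (ℕ.s≤s ℕ.z≤n))
      quotient : (d : q (suc N) (suc (toℕ i)) ∣ D) → fromℕ D * u i (suc N) ≈ fromℕ (_∣_.quotient d)
      quotient (divides e eq) = begin
        fromℕ D * u i (suc N)                                  ≡⟨ ≡.cong
          (λ t → fromℕ t * u i (suc N)) eq ⟩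
        fromℕ (e ℕ.* q (suc N) (suc (toℕ i))) * u i (suc N)    ≈⟨ *-congʳ (fromℕ-* e _) ⟩
        fromℕ e * fromℕ (q (suc N) (suc (toℕ i))) * u i (suc N) ≈⟨ *-assoc _ _ _ ⟩
        fromℕ e * (fromℕ (q (suc N) (suc (toℕ i))) * u i (suc N)) ≈⟨ *-congˡ
          (u-* i (suc N) (ℕ.s≤s ℕ.z≤n)) ⟩
        fromℕ e * 1#                                            ≈⟨ *-identityʳ _ ⟩
        fromℕ e                                                 ∎
        where open import Relation.Binary.Reasoning.Setoid setoid

    -- Linear equations satisfied by every solution

    module Constraints {n : ℕ} (n≥1 : 1 ℕ.≤ n) {X δ x : ℝ} {y : Fin k → ℝ}
      (x-int : IsInt x) (y-int : ∀ i → IsInt (y i))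
      (x≤X : ∣ x ∣ ≤ X) (close : ∀ i → ∣ ζ i * x - y i ∣ ≤ δ) where

      private
        R = aʳ n 0
        R>0 : 0# < R
        R>0 = aʳ-pos n≥1 ℕ.z≤n

        R-integral : ∀ i → IsInt (R * Σu i n)
        R-integral i = partial-integral i n (a n 0) λ _ →
          q-∣-row n≥1 (ℕ.s≤s ℕ.z≤n) (col≤k i) ℕ.≤-refl

        B : Fin k → ℝ
        B i = R * (y i - Σu i n * x)

        B-int : ∀ i → IsInt (B i)
        B-int i = isInt-resp (solve 4 (λ R a b x → R :* a :- R :* b :* x := R :* (a :- b :* x))
          (R ∷ (y i) ∷ (Σu i n) ∷ x ∷ []))
          (isInt-+ (isInt-* (isInt-fromℕ (a n 0)) (y-int i))
            (isInt-neg (isInt-* (R-integral i) x-int)))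

      -- The integer `B i` is at most R δ + 2 R X / a n (i+1) in absolute value, which is below 1/4
      -- + 1/2.
      late-constraint : ∀ i → 4# * R * δ < 1# → 4# * R * X ≤ aʳ n (suc (toℕ i)) → y i ≈ Σu i n * x
      late-constraint i δ-small X-small = *-cancelʳ-≈ R>0
        (≈-by (≈-diff 1# (isInt-small (B-int i) (small (≤-trans (x≤∣x∣ _) bound))
          (<-respˡ (solve 4 (λ R a b x → R :* (:- (a :- b :* x)) := :- (R :* (a :- b :* x)))
          (R ∷ (y i) ∷ (Σu i n) ∷ x ∷ [])) (small (≤-trans (-x≤∣x∣ _) bound)))))
          (solve 4 (λ a R b x → a :* R :- b :* x :* R := κ 1 :* (R :* (a :- b :* x) :- κ 0))
          ((y i) ∷ R ∷ (Σu i n) ∷ x ∷ [])))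
        where
        U = u i (suc n)
        bound : ∣ y i - Σu i n * x ∣ ≤ δ + 2# * U * X
        bound = approximation (proj₁ (ζ-bounds i n)) (proj₂ (ζ-bounds i n)) x≤X (close i)
        RUX : 4# * R * X * U ≤ 1#
        RUX = (≤-by (+-nonneg (*-nonneg (≤-diff X-small) (<⇒≤ (u-pos i (suc n) (ℕ.s≤s ℕ.z≤n))))
          (eq-nonneg (- 1#) (u-* i (suc n) (ℕ.s≤s ℕ.z≤n))))
          (solve 4 (λ R X U a → κ 1 :- κ 4 :* R :* X :* U := (a :- κ 4 :* R :* X) :* U :+ :- (κ 1)
          :* (a :* U :- κ 1)) (R ∷ X ∷ U ∷ (aʳ n (suc (toℕ i))) ∷ [])))
        small : ∀ {z} → z ≤ δ + 2# * U * X → R * z < 1#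
        small {z} h = *-cancelʳ-< (<⇒≤ 0<4) (<-by
          (+-pos-nonneg (+-pos-nonneg (+-pos-nonneg
          (+-pos-nonneg (<-diff δ-small) (*-nonneg (*-nonneg (<⇒≤ 0<4) (<⇒≤ R>0)) (≤-diff h)))
          (≤-diff RUX)) (≤-diff RUX)) 0≤1) (solve 5
          (λ R z δ U X → κ 1 :* κ 4 :- R :* z :* κ 4 := κ 1 :- κ 4 :* R :* δ :+ κ 4 :* R :*
          (δ :+ κ 2 :* U :* X :- z) :+ (κ 1 :- κ 4 :* R :* X :* U) :+ (κ 1 :- κ 4 :* R :* X :* U) :+
          κ 1) (R ∷ z ∷ δ ∷ U ∷ X ∷ [])))

      private
        A : Fin k → ℝ
        A i = aʳ n (suc (toℕ i)) * (y i - Σu i (suc n) * x)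

        quotient-of-∣ : ∀ {l m} → a n l ∣ a n m → ∃ λ g → aʳ n m ≈ fromℕ g * aʳ n l
        quotient-of-∣ {l} (divides g eq) = g , trans (reflexive (≡.cong fromℕ eq))
          (fromℕ-* g (a n l))

        -- The two truncations differ by the single term 1 / a n (i+1), which the factor a n (i+1)
        -- turns into x. With g an integer this is the congruence of `A i` and - x modulo g.
        A≈gB-x : ∀ i g → aʳ n (suc (toℕ i)) ≈ g * R → A i ≈ g * B i - x
        A≈gB-x i g e = (≈-by (≈0-+ (≈-diff ((y i) - ((Σu i n) * x)) e)
          (≈-diff (- x) (u-* i (suc n) (ℕ.s≤s ℕ.z≤n))))
          (solve 7 (λ a b c U x g R → a :* (b :- (c :+ U) :* x) :- (g :* (R :* (b :- c :* x)) :- x)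
          := (b :- c :* x) :* (a :- g :* R) :+ :- x :* (a :* U :- κ 1))
          (aᵢ ∷ (y i) ∷ (Σu i n) ∷ U ∷ x ∷ g ∷ R ∷ [])))
          where
          aᵢ = aʳ n (suc (toℕ i))
          U = u i (suc n)

      -- The integers A i are congruent to - x modulo a n (suc (toℕ i)) / R, hence to each other,
      -- and vanish one after the other by size.
      early-constraint : ∀ I → (∀ i → toℕ i ℕ.< I →
        R * aʳ n (suc (toℕ i)) * (δ + 2# * u i (suc (suc n)) * X) < aʳ n (toℕ i)) →
        ∀ i → toℕ i ℕ.< I → y i ≈ Σu i (suc n) * x
      early-constraint I small i i<I = solved i (vanish (toℕ i) i ≡.refl i<I)
        where
        solved : ∀ i → A i ≈ 0# → y i ≈ Σu i (suc n) * x
        solved i e = *-cancelʳ-≈ (aʳ-pos n≥1 (col≤k i))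
          (≈-by (≈-diff 1# e) (solve 4 (λ a b c x →
            a :* b :- c :* x :* b := κ 1 :* (b :* (a :- c :* x) :- κ 0))
            ((y i) ∷ (aʳ n (suc (toℕ i))) ∷ (Σu i (suc n)) ∷ x ∷ [])))
        small-A : ∀ i → toℕ i ℕ.< I → R * A i < aʳ n (toℕ i) × R * - A i < aʳ n (toℕ i)
        small-A i i<I = ≤-<-trans (scale (x≤∣x∣ _)) (small i i<I) ,
          ≤-<-trans (≤-trans (≤-reflexive (solve 3
            (λ R a z → R :* (:- (a :* z)) := R :* (a :* (:- z))) (R ∷ aᵢ ∷ z ∷ [])))
            (scale (-x≤∣x∣ _))) (small i i<I)
          where
          aᵢ = aʳ n (suc (toℕ i))
          z = y i - Σu i (suc n) * x
          b = δ + 2# * u i (suc (suc n)) * X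
          bound : ∣ z ∣ ≤ b
          bound = approximation (proj₁ (ζ-bounds i (suc n))) (proj₂ (ζ-bounds i (suc n))) x≤X
            (close i)
          scale : ∀ {w} → w ≤ ∣ z ∣ → R * (aᵢ * w) ≤ R * aᵢ * b
          scale {w} h = (≤-by (*-nonneg (<⇒≤ (*-pos R>0 (aʳ-pos n≥1 (col≤k i))))
            (≤-diff (≤-trans h bound))) (solve 4
            (λ R a b w → R :* a :* b :- R :* (a :* w) := R :* a :* (b :- w)) (R ∷ aᵢ ∷ b ∷ w ∷ [])))
        vanish : ∀ t i → toℕ i ≡ t → t ℕ.< I → A i ≈ 0#
        -- Here a n (toℕ i) is R itself, so that the size condition says that the integer `A i` is
        -- below 1 in absolute value.
        vanish zero i eq t<I = isInt-small A-int (first (proj₁ smalls)) (first (proj₂ smalls))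
          where
          gR = quotient-of-∣ {0} {suc (toℕ i)} (a-∣ n≥1 ℕ.z≤n (col≤k i))
          A-int : IsInt (A i)
          A-int = isInt-resp (sym (A≈gB-x i (fromℕ (proj₁ gR)) (proj₂ gR)))
            (isInt-+ (isInt-* (isInt-fromℕ (proj₁ gR)) (B-int i)) (isInt-neg x-int))
          smalls = small-A i (≡.subst (ℕ._< I) (≡.sym eq) t<I)
          first : ∀ {z} → R * z < aʳ n (toℕ i) → z < 1#
          first {z} h = *-cancelʳ-< (<⇒≤ R>0)
            (<-respˡ (*-comm R z) (<-respʳ (trans (reflexive (≡.cong (aʳ n) eq))
            (sym (*-identityˡ R))) h))
        -- The preceding `A i′` is already 0. Hence `A i` = `A i` - `A i′` is a multiple of g′ = a n
        -- (toℕ i) / R, while the size condition makes it smaller than g′.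
        vanish (suc t) i eq t<I = trans A≈g′C
          (trans (*-congˡ (isInt-small C-int (unit (proj₁ smalls))
          (unit (<-respˡ (solve 3 (λ R g′ C → R :* (:- (g′ :* C)) := R :* (g′ :* (:- C)))
          (R ∷ g′ ∷ C ∷ [])) (proj₂ smalls))))) (zeroʳ _))
          where
          t<k : t ℕ.< k
          t<k = ℕ.<-trans (ℕ.≤-reflexive (≡.sym eq)) (Fin.toℕ<n i)
          i′ : Fin k
          i′ = Fin.fromℕ< t<k
          eq′ : toℕ i′ ≡ t
          eq′ = Fin.toℕ-fromℕ< t<k
          g′R = quotient-of-∣ {0} {suc (toℕ i′)} (a-∣ n≥1 ℕ.z≤n (col≤k i′))
          step = quotient-of-∣ {suc (toℕ i′)} {suc (toℕ i)}
            (a-∣ n≥1 (ℕ.≤-trans (ℕ.≤-reflexive (≡.trans (≡.cong suc eq′) (≡.sym eq))) (ℕ.n≤1+n _))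
            (col≤k i))
          g′ e C : ℝ
          g′ = fromℕ (proj₁ g′R)
          e = fromℕ (proj₁ step)
          C = e * B i - B i′
          C-int : IsInt C
          C-int = isInt-+ (isInt-* (isInt-fromℕ (proj₁ step)) (B-int i)) (isInt-neg (B-int i′))
          A≈g′C : A i ≈ g′ * C
          A≈g′C = (≈-by (≈0-+ (≈0-+ (≈-diff 1#
            (A≈gB-x i (e * g′) (trans (proj₂ step)
            (trans (*-congˡ (proj₂ g′R)) (sym (*-assoc _ _ _))))))
            (≈-diff (- 1#) (A≈gB-x i′ g′ (proj₂ g′R))))
            (≈-diff 1# (vanish t i′ eq′ (ℕ.<-trans (ℕ.n<1+n t) t<I))))
            (solve 7 (λ a g′ e b c x d → a :- g′ :* (e :* b :- c) := κ 1 :*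
            (a :- (e :* g′ :* b :- x)) :+ :- (κ 1) :* (d :- (g′ :* c :- x)) :+ κ 1 :* (d :- κ 0))
            ((A i) ∷ g′ ∷ e ∷ (B i) ∷ (B i′) ∷ x ∷ (A i′) ∷ [])))
          smalls-A = small-A i (≡.subst (ℕ._< I) (≡.sym eq) t<I)
          smalls : R * (g′ * C) < aʳ n (toℕ i) × R * - (g′ * C) < aʳ n (toℕ i)
          smalls = <-respˡ (*-congˡ A≈g′C) (proj₁ smalls-A) , <-respˡ (*-congˡ (-‿cong A≈g′C))
            (proj₂ smalls-A)
          Rg′≥0 : 0# ≤ R * g′
          Rg′≥0 = *-nonneg (<⇒≤ R>0) (fromℕ-nonneg (proj₁ g′R))
          aᵢ≈ : aʳ n (toℕ i) ≈ g′ * R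
          aᵢ≈ = trans (reflexive (≡.cong (aʳ n) (≡.trans eq (≡.sym (≡.cong suc eq′))))) (proj₂ g′R)
          unit : ∀ {z} → R * (g′ * z) < aʳ n (toℕ i) → z < 1#
          unit {z} h = *-cancelʳ-< Rg′≥0 (<-by (+-pos-nonneg (<-diff h) (eq-nonneg (- 1#) aᵢ≈))
            (solve 4 (λ R g′ z a → κ 1 :* (R :* g′) :- z :* (R :* g′) := a :- R :* (g′ :* z) :+ :-
            (κ 1) :* (a :- g′ :* R)) (R ∷ g′ ∷ z ∷ (aʳ n (toℕ i)) ∷ [])))

    Solves : ℝ → ℝ → (Fin (suc k) → ℤ) → Set
    Solves X δ v = ∣ fromℤ (v Fin.zero) ∣ ≤ X ×
      (∀ i → ∣ ζ i * fromℤ (v Fin.zero) - fromℤ (v (Fin.suc i)) ∣ ≤ δ)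

    module Obstruction {n : ℕ} (n≥1 : 1 ℕ.≤ n) {I M : ℕ} {X δ : ℝ} (M≤k : M ℕ.≤ k)
      (δ-small : 4# * aʳ n 0 * δ < 1#)
      (late    : ∀ (i : Fin k) → M ℕ.≤ toℕ i → 4# * aʳ n 0 * X ≤ aʳ n (suc (toℕ i)))
      (early   : ∀ (i : Fin k) → toℕ i ℕ.< I →
        aʳ n 0 * aʳ n (suc (toℕ i)) * (δ + 2# * u i (suc (suc n)) * X) < aʳ n (toℕ i))
      {j : ℕ} (v : Fin j → Fin (suc k) → ℤ) (solves : ∀ p → Solves X δ (v p))
      where

      private
        early-eq : ∀ p i → toℕ i ℕ.< I → fromℤ (v p (Fin.suc i)) ≈ Σu i (suc n) * fromℤ
          (v p Fin.zero)
        early-eq p = Constraints.early-constraint n≥1 {x = fromℤ (v p Fin.zero)}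
          {y = λ i → fromℤ (v p (Fin.suc i))} (isInt-fromℤ (v p Fin.zero))
          (λ i → isInt-fromℤ (v p (Fin.suc i))) (proj₁ (solves p)) (proj₂ (solves p)) I early

        late-eq : ∀ p i → M ℕ.≤ toℕ i → fromℤ (v p (Fin.suc i)) ≈ Σu i n * fromℤ (v p Fin.zero)
        late-eq p i M≤i = Constraints.late-constraint n≥1 {x = fromℤ (v p Fin.zero)}
          {y = λ i → fromℤ (v p (Fin.suc i))} (isInt-fromℤ (v p Fin.zero))
          (λ i → isInt-fromℤ (v p (Fin.suc i))) (proj₁ (solves p)) (proj₂ (solves p)) i δ-small
          (late i M≤i)

      few-solutions : I ℕ.≤ M → suc (M ∸ I) ℕ.< j → ¬ LinearlyIndependent v
      few-solutions I≤M = constrained-dependent v I M I≤M M≤k λ where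
        i (inj₁ i<I) → Σu i (suc n) , λ p → early-eq p i i<I
        i (inj₂ M≤i) → Σu i n , λ p → late-eq p i M≤i

      -- Column M is early and late at once. Its two equations differ by the nonzero multiple u M
      -- (n+1) of x, so x = 0, and then all y vanish. The index `p` only ensures that the family is
      -- nonempty.
      no-solutions : M ℕ.< k → I ≡ suc M → (p : Fin j) → ¬ LinearlyIndependent v
      no-solutions M<k I≡1+M p independent with independent (λ _ → ℤ.1ℤ)
        (λ l → sumℤ-0 _ λ p → ≡.trans (ℤ.*-identityˡ _) (all-zero p l)) p
        where
        m : Fin k
        m = Fin.fromℕ< M<k
        m≡M : toℕ m ≡ M
        m≡M = Fin.toℕ-fromℕ< M<k
        x≈0 : ∀ p → fromℤ (v p Fin.zero) ≈ 0#
        x≈0 p = *-cancelʳ-≈ (u-pos m (suc n) (ℕ.s≤s ℕ.z≤n))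
          (≈-by (≈0-+ (≈-diff 1# (late-eq p m (ℕ.≤-reflexive (≡.sym m≡M))))
            (≈-diff (- 1#) (early-eq p m (≡.subst₂ ℕ._<_ (≡.sym m≡M) (≡.sym I≡1+M) (ℕ.n<1+n M)))))
            (solve 4 (λ x U y a → x :* U :- κ 0 :* U := κ 1 :* (y :- a :* x) :+ :- (κ 1) :*
            (y :- (a :+ U) :* x)) (x ∷ U ∷ y ∷ (Σu m n) ∷ [])))
          where
          x = fromℤ (v p Fin.zero)
          y = fromℤ (v p (Fin.suc m))
          U = u m (suc n)
        y≈0 : ∀ p i → fromℤ (v p (Fin.suc i)) ≈ 0#
        y≈0 p i with M ℕ.≤? toℕ i
        ... | yes M≤i = trans (late-eq p i M≤i) (trans (*-congˡ (x≈0 p)) (zeroʳ _))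
        ... | no M≰i  = trans (early-eq p i (ℕ.<-trans (ℕ.≰⇒> M≰i) (ℕ.≤-reflexive (≡.sym I≡1+M))))
          (trans (*-congˡ (x≈0 p)) (zeroʳ _))
        all-zero : ∀ p l → v p l ≡ ℤ.0ℤ
        all-zero p Fin.zero    = fromℤ-injective _ ℤ.0ℤ (x≈0 p)
        all-zero p (Fin.suc i) = fromℤ-injective _ ℤ.0ℤ (y≈0 p i)
      ... | ()

    -- The approximants of block n and their independence

    module _ {n : ℕ} (n≥1 : 1 ℕ.≤ n) where

      private
        -- Triangular table of k + 1 linear forms on the approximants: row t < k is the form yᵢ - Σu
        -- i (n+1) x of the column with `toℕ i` = t, rescaled to be integral, and row k is the
        -- coordinate x.
        weight : ℕ → ℕ → ℕ
        weight t m with m ℕ.≤? t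
        ... | yes _ = a n m
        ... | no _  = 0

        weight-≤ : ∀ {t m} → m ℕ.≤ t → weight t m ≡ a n m
        weight-≤ {t} {m} h with m ℕ.≤? t
        ... | yes _ = ≡.refl
        ... | no g  = ⊥-elim (g h)

        weight-> : ∀ {t m} → t ℕ.< m → weight t m ≡ 0
        weight-> {t} {m} h with m ℕ.≤? t
        ... | yes g = ⊥-elim (ℕ.<⇒≱ h g)
        ... | no _  = ≡.refl

        -- In row t = m 0 all weights except the first vanish, which gives c 0 = 0 as a n (m 0) is
        -- positive; the others follow by recursion on the remaining indices.
        triangular : ∀ {j} (m : Fin j → ℕ) → (∀ {p r} → toℕ p ℕ.< toℕ r → m p ℕ.< m r) →
          (∀ p → m p ℕ.≤ k) →
          (c : Fin j → ℤ) → (∀ t → t ℕ.≤ k → sumℤ (λ p → c p ℤ.* + weight t (m p)) ≡ ℤ.0ℤ) → ∀ p →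
            c p ≡ ℤ.0ℤ
        triangular {suc j} m increasing m≤k c h = λ where
            Fin.zero    → c₀≡0
            (Fin.suc p) → triangular (λ p → m (Fin.suc p)) (λ p<r → increasing (ℕ.s≤s p<r))
              (λ p → m≤k (Fin.suc p)) (λ p → c (Fin.suc p)) rest p
          where
          m₀ = m Fin.zero
          tail₀ : sumℤ (λ p → c (Fin.suc p) ℤ.* + weight m₀ (m (Fin.suc p))) ≡ ℤ.0ℤ
          tail₀ = sumℤ-0 _ λ p → ≡.trans (≡.cong (λ w → c (Fin.suc p) ℤ.* + w)
            (weight-> (increasing (ℕ.s≤s ℕ.z≤n)))) (ℤ.*-zeroʳ (c (Fin.suc p)))
          head₀ : c Fin.zero ℤ.* + a n m₀ ≡ ℤ.0ℤ
          head₀ = ≡.trans (≡.sym (ℤ.+-identityʳ _)) (≡.trans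
            (≡.cong₂ ℤ._+_ (≡.cong (λ w → c Fin.zero ℤ.* + w) (≡.sym (weight-≤ {m₀} ℕ.≤-refl)))
              (≡.sym tail₀)) (h m₀ (m≤k Fin.zero)))
          c₀≡0 : c Fin.zero ≡ ℤ.0ℤ
          c₀≡0 with ℤ.i*j≡0⇒i≡0∨j≡0 (c Fin.zero) head₀
          ... | inj₁ e = e
          ... | inj₂ e = ⊥-elim (ℕ.<⇒≢ (a-pos n≥1 (m≤k Fin.zero)) (≡.sym (ℤ.+-injective e)))
          rest : ∀ t → t ℕ.≤ k → sumℤ (λ p → c (Fin.suc p) ℤ.* + weight t (m (Fin.suc p))) ≡ ℤ.0ℤ
          rest t t≤k = ≡.trans (≡.sym (ℤ.+-identityˡ _)) (≡.trans
            (≡.cong (ℤ._+ sumℤ (λ p → c (Fin.suc p) ℤ.* + weight t (m (Fin.suc p))))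
              (≡.sym (≡.trans (≡.cong (ℤ._* + weight t m₀) c₀≡0) (ℤ.*-zeroˡ (+ weight t m₀)))))
              (h t t≤k))

        level : ℕ → Fin k → ℕ
        level m i with toℕ i ℕ.<? m
        ... | yes _ = suc n
        ... | no _  = n

        integral : ∀ {m} → m ℕ.≤ k → ∀ i → IsInt (aʳ n m * Σu i (level m i))
        integral {m} m≤k i with toℕ i ℕ.<? m
        ... | yes i<m = partial-integral i (suc n) (a n m) λ _ → a-∣ n≥1 i<m m≤k
        ... | no _    = partial-integral i n (a n m) λ _ →
          ∣-trans (q-∣-row n≥1 (ℕ.s≤s ℕ.z≤n) (Fin.toℕ<n i) ℕ.≤-refl) (a-∣ n≥1 ℕ.z≤n m≤k)

      approximant : ∀ {m} → m ℕ.≤ k → Fin (suc k) → ℤ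
      approximant {m} m≤k Fin.zero    = + a n m
      approximant {m} m≤k (Fin.suc i) = proj₁ (integral m≤k i)

      -- B is a common lower bound for the first omitted denominators: q (n+2) (i+1) in the columns
      -- i < m and q (n+1) (i+1) in the columns i ≥ m. The factor 2 is that of `ζ-bounds`.
      approximant-close : ∀ {m B} (m≤k : m ℕ.≤ k) → 0# < B → (m ℕ.< k → B ≤ aʳ n (suc m)) →
        B ≤ aʳ (suc n) 1 →
        ∀ i → ∣ ζ i * aʳ n m - fromℤ (approximant m≤k (Fin.suc i)) ∣ * B ≤ 2# * aʳ n m
      approximant-close {m} {B} m≤k B>0 B≤₁ B≤₂ i = ≤-trans
        (≤-by (*-nonneg (≤-diff error) (<⇒≤ B>0))
          (solve 4 (λ a B U b → κ 2 :* a :* (B :* U) :- b :* B := (κ 2 :* U :* a :- b) :* B)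
          ((aʳ n m) ∷ B ∷ U ∷ (∣ e ∣) ∷ [])))
        (≤-by (*-nonneg (*-nonneg (<⇒≤ 0<2) (fromℕ-nonneg (a n m))) (≤-diff BU≤1))
          (solve 3 (λ a B U → κ 2 :* a :- κ 2 :* a :* (B :* U) := κ 2 :* a :* (κ 1 :- B :* U))
          ((aʳ n m) ∷ B ∷ U ∷ [])))
        where
        e U σ : ℝ
        e = ζ i * aʳ n m - fromℤ (approximant m≤k (Fin.suc i))
        U = u i (suc (level m i))
        σ = Σu i (level m i)
        value : fromℤ (approximant m≤k (Fin.suc i)) ≈ aʳ n m * σ
        value = proj₂ (integral m≤k i)
        A≥0 : 0# ≤ aʳ n m
        A≥0 = fromℕ-nonneg (a n m)
        error : ∣ e ∣ ≤ 2# * U * aʳ n m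
        error = ∣x∣≤
          (≤-by (+-nonneg (*-nonneg (≤-diff (proj₂ (ζ-bounds i (level m i)))) A≥0)
            (eq-nonneg 1# value)) (solve 5 (λ U a b c σ →
            κ 2 :* U :* a :- (b :* a :- c) := (σ :+ κ 2 :* U :- b) :* a :+ κ 1 :* (c :- a :* σ))
            (U ∷ (aʳ n m) ∷ (ζ i) ∷ (fromℤ (approximant m≤k (Fin.suc i))) ∷ σ ∷ [])))
          (≤-by (+-nonneg (+-nonneg (*-nonneg (≤-diff (proj₁ (ζ-bounds i (level m i)))) A≥0)
            (eq-nonneg (- 1#) value)) (*-nonneg
            (*-nonneg (<⇒≤ 0<2) (<⇒≤ (u-pos i (suc (level m i)) (ℕ.s≤s ℕ.z≤n)))) A≥0))
            (solve 5 (λ U a b c σ → κ 2 :* U :* a :- :- (b :* a :- c) := (b :- σ) :* a :+ :- (κ 1)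
            :* (c :- a :* σ) :+ κ 2 :* U :* a)
            (U ∷ (aʳ n m) ∷ (ζ i) ∷ (fromℤ (approximant m≤k (Fin.suc i))) ∷ σ ∷ [])))
        BU≤1 : B * U ≤ 1#
        BU≤1 with toℕ i ℕ.<? m
        ... | yes i<m = u-≤ i (suc (suc n)) (ℕ.s≤s ℕ.z≤n) B>0
          (≤-trans B≤₂ (aʳ-mono (ℕ.s≤s ℕ.z≤n) (ℕ.s≤s ℕ.z≤n) (Fin.toℕ<n i)))
        ... | no i≮m  = u-≤ i (suc n) (ℕ.s≤s ℕ.z≤n) B>0
          (≤-trans (B≤₁ (ℕ.≤-<-trans (ℕ.≮⇒≥ i≮m) (Fin.toℕ<n i)))
          (aʳ-mono n≥1 (ℕ.s≤s (ℕ.≮⇒≥ i≮m)) (Fin.toℕ<n i)))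

      approximants-independent : ∀ {j} (m : Fin j → ℕ) → (∀ {p r} → toℕ p ℕ.< toℕ r → m p ℕ.< m r) →
        (m≤k : ∀ p → m p ℕ.≤ k) →
        LinearlyIndependent (λ p → approximant (m≤k p))
      approximants-independent {j} m increasing m≤k c h = triangular m increasing m≤k c sums
        where
        -- On the approximant of index m, the form yᵢ - Σu i (suc n) x takes the value 0 if i ≤ m
        -- and - a n m / a n i otherwise.
        relation : ∀ i p → fromℤ (approximant (m≤k p) (Fin.suc i)) ≈ Σu i (suc n) * fromℤ
          (+ a n (m p)) + - u i (suc n) * fromℤ (+ weight (toℕ i) (m p))
        relation i p = trans (proj₂ (integral (m≤k p) i)) shifted
          where
          A = aʳ n (m p)
          U = u i (suc n)
          shifted : A * Σu i (level (m p) i) ≈ (Σu i n + U) * A + - U * fromℕ (weight (toℕ i) (m p))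
          shifted with toℕ i ℕ.<? m p
          ... | yes i<m = trans (solve 3 (λ A a U → A :* (a :+ U) := (a :+ U) :* A :+ :- U :* κ 0)
            (A ∷ (Σu i n) ∷ U ∷ [])) (+-congˡ
            (*-congˡ (reflexive (≡.cong fromℕ (≡.sym (weight-> i<m))))))
          ... | no i≮m  = trans (solve 3 (λ A a U → A :* a := (a :+ U) :* A :+ :- U :* A)
            (A ∷ (Σu i n) ∷ U ∷ [])) (+-congˡ
            (*-congˡ (reflexive (≡.cong fromℕ (≡.sym (weight-≤ (ℕ.≮⇒≥ i≮m)))))))
        sums : ∀ t → t ℕ.≤ k → sumℤ (λ p → c p ℤ.* + weight t (m p)) ≡ ℤ.0ℤ
        sums t t≤k with ℕ.m≤n⇒m<n∨m≡n t≤k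
        ... | inj₂ ≡.refl = ≡.trans (sum-cong-≗ λ p → ≡.cong (λ w → c p ℤ.* + w) (weight-≤ (m≤k p)))
          (h Fin.zero)
        ... | inj₁ t<k    = ≡.subst (λ t → sumℤ (λ p → c p ℤ.* + weight t (m p)) ≡ ℤ.0ℤ)
          (Fin.toℕ-fromℕ< t<k) (fromℤ-injective _ ℤ.0ℤ
            (*-cancelʳ-≈ (u-pos i (suc n) (ℕ.s≤s ℕ.z≤n))
              (≈-by (≈-diff 1# combined) (solve 3
              (λ w U a → w :* U :- κ 0 :* U := κ 1 :* (κ 0 :- (a :* κ 0 :+ :- U :* w)))
              (w ∷ U ∷ (Σu i (suc n)) ∷ [])))))
          where
          i : Fin k
          i = Fin.fromℕ< t<k
          U w : ℝ
          U = u i (suc n)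
          w = fromℤ (sumℤ (λ p → c p ℤ.* + weight (toℕ i) (m p)))
          combined : 0# ≈ Σu i (suc n) * 0# + - U * w
          combined = trans (reflexive (≡.cong fromℤ (≡.sym (h (Fin.suc i))))) (trans
            (sumℤ-linear-relation _ (λ p → c p ℤ.* + a n (m p))
              (λ p → c p ℤ.* + weight (toℕ i) (m p)) (Σu i (suc n)) (- U)
              (λ p → scaled-relation {+ a n (m p)} {approximant (m≤k p) (Fin.suc i)}
                {+ weight (toℕ i) (m p)} (c p) _ _ (relation i p)))
            (+-congʳ (*-congˡ (reflexive (≡.cong fromℤ (h Fin.zero))))))

      -- Uses the j consecutive indices from `lo` on. The index k has a condition of its own because
      -- all the denominators it omits lie in the next block.
      approximants-solve : ∀ {X δ} lo {j} → (∀ (p : Fin j) → lo ℕ.+ toℕ p ℕ.≤ k) →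
        (∀ (p : Fin j) → aʳ n (lo ℕ.+ toℕ p) ≤ X) →
        (∀ (p : Fin j) → lo ℕ.+ toℕ p ℕ.< k →
          2# * aʳ n (lo ℕ.+ toℕ p) ≤ δ * aʳ n (suc (lo ℕ.+ toℕ p))) →
        (∀ (p : Fin j) → lo ℕ.+ toℕ p ≡ k → 2# * aʳ n k ≤ δ * aʳ (suc n) 1) →
        Σ (Fin j → Fin (suc k) → ℤ) λ v → LinearlyIndependent v × (∀ p → Solves X δ (v p))
      approximants-solve {X} {δ} lo {j} m≤k x≤X inner outer =
        (λ p → approximant (m≤k p)) , approximants-independent (λ p → lo ℕ.+ toℕ p) (ℕ.+-monoʳ-< lo)
          m≤k ,
        λ p → ∣x∣≤ (x≤X p) (≤-trans (≤-by (+-nonneg (fromℕ-nonneg (a n (lo ℕ.+ toℕ p)))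
          (fromℕ-nonneg (a n (lo ℕ.+ toℕ p)))) (solve 1 (λ a → a :- :- a := a :+ a) ((x p) ∷ [])))
          (x≤X p)) , small p
        where
        x : Fin j → ℝ
        x p = aʳ n (lo ℕ.+ toℕ p)
        small : ∀ p i → ∣ ζ i * x p - fromℤ (approximant (m≤k p) (Fin.suc i)) ∣ ≤ δ
        small p i with ℕ.m≤n⇒m<n∨m≡n (m≤k p)
        ... | inj₁ m<k = *-cancelʳ-≤ (aʳ-pos n≥1 m<k) (≤-trans
                (approximant-close (m≤k p) (aʳ-pos n≥1 m<k) (λ _ → ≤-refl)
                  (≤-trans (aʳ-mono n≥1 m<k ℕ.≤-refl) (aʳ-mono (ℕ.s≤s ℕ.z≤n) ℕ.z≤n (ℕ.s≤s ℕ.z≤n)))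
                    i)
                (inner p m<k))
        ... | inj₂ m≡k = *-cancelʳ-≤ B>0 (≤-trans
                (approximant-close (m≤k p) B>0 (λ m<k → ⊥-elim (ℕ.<⇒≢ m<k m≡k)) ≤-refl i)
                (≤-trans (≤-reflexive (*-congˡ (reflexive (≡.cong (aʳ n) m≡k)))) (outer p m≡k)))
          where
          B>0 : 0# < aʳ (suc n) 1
          B>0 = aʳ-pos (ℕ.s≤s ℕ.z≤n) (ℕ.s≤s ℕ.z≤n)

    -- Asymptotics of the logarithms

    ℓ : ℕ → ℕ → ℝ
    ℓ n m = log (aʳ n m)

    a≈exp : ∀ {n m} → 1 ℕ.≤ n → m ℕ.≤ k → aʳ n m ≈ exp (ℓ n m)
    a≈exp n≥1 m≤k = sym (exp-log (aʳ-pos n≥1 m≤k))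

    n≤a₀ : ∀ n → 1 ℕ.≤ n → n ℕ.≤ a n 0
    n≤a₀ (suc zero)    n≥1 = a-pos n≥1 ℕ.z≤n
    n≤a₀ (suc (suc n)) _   = ℕ.≤-<-trans (n≤a₀ (suc n) (ℕ.s≤s ℕ.z≤n))
      (column-< (ℕ.s≤s ℕ.z≤n) (ℕ.s≤s ℕ.z≤n) ℕ.≤-refl)

    ℓ₀-large : ∀ K → Eventually (λ n → K < ℓ n 0)
    ℓ₀-large K = eventually-map bound (eventually-× (eventually-≥ 1) (large-ℕ (exp K)))
      where
      bound : ∀ n → 1 ℕ.≤ n × exp K < fromℕ n → K < ℓ n 0
      bound n (n≥1 , h) = ≰⇒> λ p → <⇒≱ (<-≤-trans h (fromℕ-mono-≤ (n≤a₀ n n≥1)))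
        (≤-respˡ (exp-log (aʳ-pos n≥1 ℕ.z≤n)) (exp-mono-≤ p))

    module Asymptotics (η : ℕ → ℝ)
      (increments : ∀ m → m ℕ.< k → (λ n → (ℓ n (suc m) - ℓ n m) / ℓ n k) ⟶ η (suc m))
      (gaps       : (λ n → ℓ n 1 / ℓ n 0) ⟶∞)
      (η-step     : ∀ i → 1 ℕ.≤ i → i ℕ.< k → η i ≤ η (suc i))
      (η₁>0       : 0# < η 1)
      where

      S : ℕ → ℝ
      S m = Σ₁ m η

      σ : ℝ
      σ = η 1

      η-mono : ∀ {l m} → 1 ℕ.≤ l → l ℕ.≤ m → m ℕ.≤ k → η l ≤ η m
      η-mono {l} {m} l≥1 l≤m m≤k = interval-induction (λ m → η l ≤ η m) ≤-refl
        (λ m l≤m m<k p → ≤-trans p (η-step m (ℕ.≤-trans l≥1 l≤m) m<k)) m l≤m m≤k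

      η-nonneg : ∀ {m} → 1 ℕ.≤ m → m ℕ.≤ k → 0# ≤ η m
      η-nonneg m≥1 m≤k = ≤-trans (<⇒≤ η₁>0) (η-mono ℕ.≤-refl m≥1 m≤k)

      σ≤S : ∀ {m} → 1 ℕ.≤ m → m ℕ.≤ k → σ ≤ S m
      σ≤S {m} m≥1 m≤k = interval-induction (λ m → σ ≤ S m) (≤-reflexive (sym (+-identityˡ _)))
        (λ m _ m<k p → (≤-by (+-nonneg (≤-diff p) (η-nonneg (ℕ.s≤s ℕ.z≤n) m<k))
          (solve 3 (λ a b σ → a :+ b :- σ := a :- σ :+ b) ((S m) ∷ (η (suc m)) ∷ σ ∷ [])))) m m≥1
          m≤k

      S-pos : ∀ {m} → 1 ℕ.≤ m → m ℕ.≤ k → 0# < S m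
      S-pos m≥1 m≤k = <-≤-trans η₁>0 (σ≤S m≥1 m≤k)

      -- All asymptotic input about block n, with errors measured by ε log Q. M expresses the
      -- superlinear gaps, K makes the chosen X exceed a prescribed bound, and log 4 < log R lets
      -- the constants 4 be absorbed like R.
      record Good (ε M K : ℝ) (n : ℕ) : Set where
        field
          n≥1      : 1 ℕ.≤ n
          r-large  : K < ℓ n 0
          log4<r   : log4 < ℓ n 0
          r≤εL     : ℓ n 0 ≤ ε * ℓ n k
          inc-≤    : ∀ m → m ℕ.< k → ℓ n (suc m) - ℓ n m ≤ (η (suc m) + ε) * ℓ n k
          inc-≥    : ∀ m → m ℕ.< k → (η (suc m) - ε) * ℓ n k ≤ ℓ n (suc m) - ℓ n m
          ℓ-≤      : ∀ m → m ℕ.≤ k → ℓ n m ≤ (S m + ε) * ℓ n k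
          ℓ-≥      : ∀ m → m ℕ.≤ k → (S m - ε) * ℓ n k ≤ ℓ n m
          gap      : M * ℓ n 0 ≤ ℓ n 1
          next-gap : M * ℓ n k ≤ ℓ (suc n) 1

        log4≥0 : 0# ≤ log4
        log4≥0 = log-nonneg (≤-by (+-nonneg (+-nonneg 0≤1 0≤1) 0≤1)
          (solve 0 (κ 4 :- κ 1 := κ 1 :+ κ 1 :+ κ 1) []))

        r>0 : 0# < ℓ n 0
        r>0 = ≤-<-trans log4≥0 log4<r

        ℓ-mono : ∀ {l m} → l ℕ.≤ m → m ℕ.≤ k → ℓ n l ≤ ℓ n m
        ℓ-mono l≤m m≤k = log-mono-≤ (aʳ-pos n≥1 (ℕ.≤-trans l≤m m≤k)) (aʳ-mono n≥1 l≤m m≤k)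

        r≤L : ℓ n 0 ≤ ℓ n k
        r≤L = ℓ-mono ℕ.z≤n k≤k

        L>0 : 0# < ℓ n k
        L>0 = <-≤-trans r>0 r≤L

        log4≤εL : log4 ≤ ε * ℓ n k
        log4≤εL = ≤-trans (<⇒≤ log4<r) r≤εL

      good : ∀ ε M K → 0# < ε → Eventually (Good ε M K)
      good ε M K ε>0 = eventually-map assemble
        (eventually-× (eventually-≥ 1) (eventually-× (ℓ₀-large (K ⊔ (log4 ⊔ 0#)))
          (eventually-× (gaps (M ⊔ ε′ ⁻¹)) (eventually-× shifted
            (eventually-∀< k λ m m<k → increments m m<k ε′ ε′>0)))))
        where
        ε′ κ′ : ℝ
        κ′ = fromℕ (suc k)
        -- `ℓ n m` is `ℓ n 0` plus m increments, so that at most k + 1 errors of size ε′ L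
        -- accumulate.
        ε′ = ε / κ′
        κ′>0 : 0# < κ′
        κ′>0 = fromℕ-pos {suc k} (ℕ.s≤s ℕ.z≤n)
        ε′>0 : 0# < ε′
        ε′>0 = /-pos ε>0 κ′>0
        ε′κ′ : ε′ * κ′ ≈ ε
        ε′κ′ = x/z*z κ′>0
        -- a (n+1) 0 is a n k by definition, so this is the gap hypothesis at n + 1.
        shifted : Eventually (λ n → M < ℓ (suc n) 1 / ℓ n k)
        shifted = let (N , h) = gaps M in N , λ n N≤n → h (suc n) (ℕ.m≤n⇒m≤1+n N≤n)
        assemble : ∀ n → 1 ℕ.≤ n × K ⊔ (log4 ⊔ 0#) < ℓ n 0 × M ⊔ ε′ ⁻¹ < ℓ n 1 / ℓ n 0 × M < ℓ
          (suc n) 1 / ℓ n k ×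
          (∀ m → m ℕ.< k → ∣ (ℓ n (suc m) - ℓ n m) / ℓ n k - η (suc m) ∣ < ε′) → Good ε M K n
        assemble n (n≥1 , large , gap₁ , gap₂ , inc) = record
          { n≥1 = n≥1
          ; r-large = ≤-<-trans (x≤x⊔y K _) large
          ; log4<r = ≤-<-trans (≤-trans (x≤x⊔y log4 0#) (x≤y⊔x K _)) large
          ; r≤εL = ≤-trans r≤ε′L (scale ε′≤ε)
          ; inc-≤ = λ m m<k → ≤-trans (inc-≤′ m m<k)
            (scale ((≤-by (≤-diff ε′≤ε) (solve 3 (λ a ε ε′ → a :+ ε :- (a :+ ε′) := ε :- ε′)
            ((η (suc m)) ∷ ε ∷ ε′ ∷ [])))))
          ; inc-≥ = λ m m<k → ≤-trans (scale ((≤-by (≤-diff ε′≤ε)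
            (solve 3 (λ a ε′ ε → a :- ε′ :- (a :- ε) := ε :- ε′) ((η (suc m)) ∷ ε′ ∷ ε ∷ [])))))
            (inc-≥′ m m<k)
          ; ℓ-≤ = λ m m≤k → ≤-trans (ℓ-≤′ m m≤k)
            (scale ((≤-by (≤-diff (mε′≤ε m≤k))
            (solve 4 (λ a ε b ε′ → a :+ ε :- (a :+ b :* ε′) := ε :- b :* ε′)
            ((S m) ∷ ε ∷ (fromℕ (suc m)) ∷ ε′ ∷ [])))))
          ; ℓ-≥ = λ m m≤k → ≤-trans (scale ((≤-by (≤-diff (mε′≤ε m≤k))
            (solve 4 (λ a b ε′ ε → a :- b :* ε′ :- (a :- ε) := ε :- b :* ε′)
            ((S m) ∷ (fromℕ (suc m)) ∷ ε′ ∷ ε ∷ []))))) (ℓ-≥′ m m≤k)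
          ; gap = ≤-trans (≤-by (*-nonneg (≤-diff (x≤x⊔y M (ε′ ⁻¹))) (<⇒≤ r>0))
            (solve 3 (λ a r M → a :* r :- M :* r := (a :- M) :* r) ((M ⊔ ε′ ⁻¹) ∷ r ∷ M ∷ [])))
            gap-r
          ; next-gap = (≤-by (+-nonneg (*-nonneg (≤-diff (<⇒≤ gap₂)) (<⇒≤ L>0))
            (eq-nonneg (- (ℓ (suc n) 1)) (pos-⁻¹ L>0)))
            (solve 4 (λ a M L b → a :- M :* L := (a :* b :- M) :* L :+ :- a :* (L :* b :- κ 1))
            ((ℓ (suc n) 1) ∷ M ∷ L ∷ (L ⁻¹) ∷ [])))
          }
          where
          r L : ℝ
          r = ℓ n 0
          L = ℓ n k
          r>0 : 0# < r
          r>0 = ≤-<-trans (≤-trans (x≤y⊔x log4 0#) (x≤y⊔x K _)) large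
          L>0 : 0# < L
          L>0 = <-≤-trans r>0 (log-mono-≤ (aʳ-pos n≥1 ℕ.z≤n) (aʳ-mono n≥1 ℕ.z≤n k≤k))
          scale : ∀ {x y} → x ≤ y → x * L ≤ y * L
          scale {x} {y} h = (≤-by (*-nonneg (≤-diff h) (<⇒≤ L>0))
            (solve 3 (λ y L x → y :* L :- x :* L := (y :- x) :* L) (y ∷ L ∷ x ∷ [])))
          mε′≤ε : ∀ {m} → m ℕ.≤ k → fromℕ (suc m) * ε′ ≤ ε
          mε′≤ε {m} m≤k = (≤-by (+-nonneg (*-nonneg (≤-diff (fromℕ-mono-≤ (ℕ.s≤s m≤k))) (<⇒≤ ε′>0))
            (eq-nonneg (- 1#) ε′κ′)) (solve 4
            (λ ε w ε′ κ′ → ε :- w :* ε′ := (κ′ :- w) :* ε′ :+ :- (κ 1) :* (ε′ :* κ′ :- ε))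
            (ε ∷ w ∷ ε′ ∷ κ′ ∷ [])))
            where w = fromℕ (suc m)
          ε′≤ε : ε′ ≤ ε
          ε′≤ε = ≤-respˡ (solve 1 (λ ε′ → (κ 1 :+ κ 0) :* ε′ := ε′) (ε′ ∷ [])) (mε′≤ε {0} ℕ.z≤n)
          gap-r : (M ⊔ ε′ ⁻¹) * r ≤ ℓ n 1
          gap-r = (≤-by (+-nonneg (*-nonneg (≤-diff (<⇒≤ gap₁)) (<⇒≤ r>0))
            (eq-nonneg (- (ℓ n 1)) (pos-⁻¹ r>0)))
            (solve 4 (λ a b r c → a :- b :* r := (a :* c :- b) :* r :+ :- a :* (r :* c :- κ 1))
            ((ℓ n 1) ∷ (M ⊔ ε′ ⁻¹) ∷ r ∷ (r ⁻¹) ∷ [])))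
          -- This is why ε′ ⁻¹ was put into the gap condition: r ≤ ε′ ℓ n 1 ≤ ε′ L.
          r≤ε′L : r ≤ ε′ * L
          r≤ε′L = (≤-by (+-nonneg (+-nonneg (*-nonneg (<⇒≤ ε′>0)
            (≤-diff (≤-trans gap-r (log-mono-≤ (aʳ-pos n≥1 (ℕ.s≤s ℕ.z≤n))
            (aʳ-mono n≥1 (ℕ.s≤s ℕ.z≤n) k≤k)))))
            (*-nonneg (*-nonneg (<⇒≤ ε′>0) (<⇒≤ r>0)) (≤-diff (x≤y⊔x M (ε′ ⁻¹)))))
            (eq-nonneg r (pos-⁻¹ ε′>0))) (solve 5
            (λ ε′ L r a b → ε′ :* L :- r := ε′ :* (L :- a :* r) :+ ε′ :* r :* (a :- b) :+ r :*
            (ε′ :* b :- κ 1)) (ε′ ∷ L ∷ r ∷ (M ⊔ ε′ ⁻¹) ∷ (ε′ ⁻¹) ∷ [])))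
          inc-≤′ : ∀ m → m ℕ.< k → ℓ n (suc m) - ℓ n m ≤ (η (suc m) + ε′) * L
          inc-≤′ m m<k = (≤-by (+-nonneg (*-nonneg (≤-diff (<⇒≤ (≤-<-trans (x≤∣x∣ _) (inc m m<k))))
            (<⇒≤ L>0)) (eq-nonneg d (pos-⁻¹ L>0)))
            (solve 5 (λ a ε′ L d b → (a :+ ε′) :* L :- d := (ε′ :- (d :* b :- a)) :* L :+ d :*
            (L :* b :- κ 1)) ((η (suc m)) ∷ ε′ ∷ L ∷ d ∷ (L ⁻¹) ∷ [])))
            where d = ℓ n (suc m) - ℓ n m
          inc-≥′ : ∀ m → m ℕ.< k → (η (suc m) - ε′) * L ≤ ℓ n (suc m) - ℓ n m
          inc-≥′ m m<k = (≤-by (+-nonneg (*-nonneg (≤-diff (<⇒≤ (≤-<-trans (-x≤∣x∣ _) (inc m m<k))))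
            (<⇒≤ L>0)) (eq-nonneg (- d) (pos-⁻¹ L>0)))
            (solve 5 (λ d a ε′ L b → d :- (a :- ε′) :* L := (ε′ :- :- (d :* b :- a)) :* L :+ :- d :*
            (L :* b :- κ 1)) (d ∷ (η (suc m)) ∷ ε′ ∷ L ∷ (L ⁻¹) ∷ [])))
            where d = ℓ n (suc m) - ℓ n m
          ℓ-≤′ : ∀ m → m ℕ.≤ k → ℓ n m ≤ (S m + fromℕ (suc m) * ε′) * L
          ℓ-≤′ zero    _   = ≤-respʳ (solve 2 (λ ε′ L → ε′ :* L := (κ 0 :+ (κ 1 :+ κ 0) :* ε′) :* L)
            (ε′ ∷ L ∷ [])) r≤ε′L
          ℓ-≤′ (suc m) m<k = (≤-by (+-nonneg (≤-diff (ℓ-≤′ m (ℕ.<⇒≤ m<k))) (≤-diff (inc-≤′ m m<k)))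
            (solve 7 (λ a b c ε′ L d e → (a :+ b :+ (κ 1 :+ c) :* ε′) :* L :- d := (a :+ c :* ε′) :*
            L :- e :+ ((b :+ ε′) :* L :- (d :- e)))
            ((S m) ∷ (η (suc m)) ∷ (fromℕ (suc m)) ∷ ε′ ∷ L ∷ (ℓ n (suc m)) ∷ (ℓ n m) ∷ [])))
          ℓ-≥′ : ∀ m → m ℕ.≤ k → (S m - fromℕ (suc m) * ε′) * L ≤ ℓ n m
          ℓ-≥′ zero    _   = (≤-by (+-nonneg (<⇒≤ r>0) (*-nonneg (<⇒≤ ε′>0) (<⇒≤ L>0)))
            (solve 3 (λ r ε′ L → r :- (κ 0 :- (κ 1 :+ κ 0) :* ε′) :* L := r :+ ε′ :* L)
            (r ∷ ε′ ∷ L ∷ [])))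
          ℓ-≥′ (suc m) m<k = (≤-by (+-nonneg (≤-diff (ℓ-≥′ m (ℕ.<⇒≤ m<k))) (≤-diff (inc-≥′ m m<k)))
            (solve 7 (λ a b c d ε′ L e → a :- (b :+ c :- (κ 1 :+ d) :* ε′) :* L := e :-
            (b :- d :* ε′) :* L :+ (a :- e :- (c :- ε′) :* L))
            ((ℓ n (suc m)) ∷ (S m) ∷ (η (suc m)) ∷ (fromℕ (suc m)) ∷ ε′ ∷ L ∷ (ℓ n m) ∷ [])))

      tolerance : ∀ {γ c} → 0# < γ → 0# < c → ∃ λ ε → 0# < ε × ε ≤ 1# × ε * c ≤ γ
      tolerance {γ} {c} γ>0 c>0 = 1# ⊓ (γ / c) , pos-⊓ 0<1 (/-pos γ>0 c>0) , x⊓y≤x 1# (γ / c) ,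
        (≤-by (+-nonneg (*-nonneg (≤-diff (x⊓y≤y 1# (γ / c))) (<⇒≤ c>0))
          (eq-nonneg (- γ) (pos-⁻¹ c>0))) (solve 4
          (λ γ e c a → γ :- e :* c := (γ :* a :- e) :* c :+ :- γ :* (c :* a :- κ 1))
          (γ ∷ e ∷ c ∷ (c ⁻¹) ∷ [])))
        where e = 1# ⊓ (γ / c)

      -- Existence and obstruction criteria in logarithmic form

      module Block {ε M K : ℝ} {n : ℕ} (g : Good ε M K n) where
        open Good g public

        r L : ℝ
        r = ℓ n 0
        L = ℓ n k

        δ-bound : ∀ {ν t} → log4 + r < ν * t → 4# * aʳ n 0 * exp (- ν * t) < 1#
        δ-bound {ν} {t} h = exp-< (exp-⊗ (exp-⊗ 4≈exp (a≈exp n≥1 ℕ.z≤n)) refl) (sym exp-0)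
          (<-by (<-diff h) (solve 4 (λ log4 r ν t →
            κ 0 :- (log4 :+ r :+ :- ν :* t) := ν :* t :- (log4 :+ r)) (log4 ∷ r ∷ ν ∷ t ∷ [])))

        late-bound : ∀ {X m} → 0# < X → (m ℕ.< k → log X ≤ ℓ n (suc m) - (log4 + r)) →
          ∀ i → m ℕ.≤ toℕ i → 4# * aʳ n 0 * X ≤ aʳ n (suc (toℕ i))
        late-bound {X} {m} X>0 h i m≤i = exp-≤
          (exp-⊗ (exp-⊗ 4≈exp (a≈exp n≥1 ℕ.z≤n)) (sym (exp-log X>0))) (a≈exp n≥1 (Fin.toℕ<n i))
          (≤-by (+-nonneg (≤-diff (h (ℕ.≤-<-trans m≤i (Fin.toℕ<n i))))
            (≤-diff (ℓ-mono (ℕ.s≤s m≤i) (Fin.toℕ<n i))))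
            (solve 5 (λ a log4 r b c → a :- (log4 :+ r :+ b) := c :- (log4 :+ r) :- b :+ (a :- c))
            ((ℓ n (suc (toℕ i))) ∷ log4 ∷ r ∷ (log X) ∷ (ℓ n (suc m)) ∷ [])))

        -- The 3 ε pay for log 4, for r and for the error of one increment. The 3 in C + 3 bounds
        -- log 4, r and ℓ n (i+1) by L each, so that 4 R a′ X ≤ q (n+2) 1. Then four times the left
        -- side is below aᵢ + 2 ≤ 4 aᵢ.
        early-bound : ∀ {X ν C} I → 0# < X → ε ≤ 1# → C + 3# ≤ M → log X ≤ C * L →
          (∀ i → i ℕ.< I → i ℕ.< k → (η (suc i) + 3# * ε) * L < ν * log X) →
          ∀ i → toℕ i ℕ.< I → aʳ n 0 * aʳ n (suc (toℕ i)) *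
            (exp (- ν * log X) + 2# * u i (suc (suc n)) * X) < aʳ n (toℕ i)
        early-bound {X} {ν} {C} I X>0 ε≤1 C≤M t≤CL h i i<I = *-cancelʳ-< (<⇒≤ 0<4)
          (<-by (+-pos-nonneg (+-pos-nonneg (+-pos-nonneg
            (+-pos-nonneg (+-pos-nonneg (+-pos-nonneg
            (+-pos-nonneg (<-diff e₁) (*-nonneg (≤-diff e₂)
            (<⇒≤ (u-pos i (suc (suc n)) (ℕ.s≤s ℕ.z≤n)))))
            (*-nonneg (≤-diff e₂) (<⇒≤ (u-pos i (suc (suc n)) (ℕ.s≤s ℕ.z≤n))))) (≤-diff BU))
            (≤-diff BU)) (≤-diff aᵢ≥1)) (≤-diff aᵢ≥1)) (fromℕ-nonneg (a n (toℕ i))))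
            (solve 7 (λ a R a′ δ U X B → a :* κ 4 :- R :* a′ :* (δ :+ κ 2 :* U :* X) :* κ 4 := a :-
            κ 4 :* R :* a′ :* δ :+ (B :- κ 4 :* R :* a′ :* X) :* U :+ (B :- κ 4 :* R :* a′ :* X) :*
            U :+ (κ 1 :- B :* U) :+ (κ 1 :- B :* U) :+ (a :- κ 1) :+ (a :- κ 1) :+ a)
            (aᵢ ∷ R ∷ a′ ∷ δ ∷ U ∷ X ∷ B ∷ [])))
          where
          i<k = Fin.toℕ<n i
          R a′ aᵢ B U δ t : ℝ
          R = aʳ n 0
          a′ = aʳ n (suc (toℕ i))
          aᵢ = aʳ n (toℕ i)
          B = aʳ (suc n) 1
          U = u i (suc (suc n))
          t = log X
          δ = exp (- ν * t)
          B>0 : 0# < B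
          B>0 = aʳ-pos {suc n} {1} (ℕ.s≤s ℕ.z≤n) (ℕ.s≤s ℕ.z≤n)
          aᵢ≥1 : 1# ≤ aᵢ
          aᵢ≥1 = 1≤fromℕ (a-pos n≥1 (ℕ.<⇒≤ i<k))
          BU : B * U ≤ 1#
          BU = u-≤ i (suc (suc n)) (ℕ.s≤s ℕ.z≤n) B>0
            (aʳ-mono {suc n} {1} {suc (toℕ i)} (ℕ.s≤s ℕ.z≤n) (ℕ.s≤s ℕ.z≤n) i<k)
          e₁ : 4# * R * a′ * δ < aᵢ
          e₁ = exp-< (exp-⊗ (exp-⊗ (exp-⊗ 4≈exp (a≈exp n≥1 ℕ.z≤n)) (a≈exp n≥1 i<k)) refl)
            (a≈exp n≥1 (ℕ.<⇒≤ i<k))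
            (<-by (+-pos-nonneg (+-pos-nonneg
              (+-pos-nonneg (<-diff (h (toℕ i) i<I i<k)) (≤-diff (inc-≤ (toℕ i) i<k)))
              (≤-diff log4≤εL)) (≤-diff r≤εL))
              (solve 9 (λ a log4 r b ν t c ε L →
              a :- (log4 :+ r :+ b :+ :- ν :* t) := ν :* t :- (c :+ κ 3 :* ε) :* L :+
              ((c :+ ε) :* L :- (b :- a)) :+ (ε :* L :- log4) :+ (ε :* L :- r))
              ((ℓ n (toℕ i)) ∷ log4 ∷ r ∷ (ℓ n (suc (toℕ i))) ∷ ν ∷ t ∷ (η (suc (toℕ i))) ∷ ε ∷ L ∷
              [])))
          e₂ : 4# * R * a′ * X ≤ B
          e₂ = exp-≤ (exp-⊗ (exp-⊗ (exp-⊗ 4≈exp (a≈exp n≥1 ℕ.z≤n)) (a≈exp n≥1 i<k))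
            (sym (exp-log X>0))) (sym (exp-log B>0))
            (≤-by (+-nonneg (+-nonneg (+-nonneg
              (+-nonneg (+-nonneg (+-nonneg (≤-diff log4≤εL) (*-nonneg (≤-diff ε≤1) (<⇒≤ L>0)))
              (≤-diff r≤L)) (≤-diff (ℓ-mono i<k k≤k))) (≤-diff t≤CL))
              (*-nonneg (≤-diff C≤M) (<⇒≤ L>0))) (≤-diff next-gap))
              (solve 9 (λ a log4 r b t ε L C M →
              a :- (log4 :+ r :+ b :+ t) := ε :* L :- log4 :+ (κ 1 :- ε) :* L :+ (L :- r) :+
              (L :- b) :+ (C :* L :- t) :+ (M :- (C :+ κ 3)) :* L :+ (a :- M :* L))
              ((ℓ (suc n) 1) ∷ log4 ∷ r ∷ (ℓ n (suc (toℕ i))) ∷ t ∷ ε ∷ L ∷ C ∷ M ∷ [])))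

        -- E ≤ T S m leaves the room (ν - T) S m ≥ 4 ε (ν + 1) for the error terms.
        exponent-exceeds : ∀ {ν t T E m} → 0# < ε → 0# < ν → T < ν → 1 ℕ.≤ m → m ℕ.≤ k →
          E ≤ T * S m →
          ε * (4# * (ν + 1#)) ≤ (ν - T) * σ → ℓ n m - (log4 + r) ≤ t → (E + 3# * ε) * L < ν * t
        exponent-exceeds {ν} {t} {T} {E} {m} ε>0 ν>0 T<ν m≥1 m≤k E≤TS room t≥ =
          (<-by (+-pos-nonneg (+-pos-nonneg (+-pos-nonneg
            (+-pos-nonneg (*-pos (*-pos ε>0 L>0) ν+1>0) (*-nonneg (<⇒≤ ν>0) (≤-diff t-lower)))
            (*-nonneg (≤-diff E≤TS) (<⇒≤ L>0)))
            (*-nonneg (*-nonneg (≤-diff (<⇒≤ T<ν)) (≤-diff (σ≤S m≥1 m≤k))) (<⇒≤ L>0)))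
            (*-nonneg (≤-diff room) (<⇒≤ L>0)))
            (solve 8 (λ ν t E ε L a T σ → ν :* t :- (E :+ κ 3 :* ε) :* L := ε :* L :* (ν :+ κ 1) :+
            ν :* (t :- (a :- κ 3 :* ε) :* L) :+ (T :* a :- E) :* L :+ (ν :- T) :* (a :- σ) :* L :+
            ((ν :- T) :* σ :- ε :* (κ 4 :* (ν :+ κ 1))) :* L)
            (ν ∷ t ∷ E ∷ ε ∷ L ∷ (S m) ∷ T ∷ σ ∷ [])))
          where
          ν+1>0 : 0# < ν + 1#
          ν+1>0 = +-pos-nonneg ν>0 0≤1
          t-lower : (S m - 3# * ε) * L ≤ t
          t-lower = (≤-by (+-nonneg (+-nonneg (+-nonneg (≤-diff t≥) (≤-diff (ℓ-≥ m m≤k)))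
            (≤-diff log4≤εL)) (≤-diff r≤εL)) (solve 7
            (λ t a ε L b log4 r → t :- (a :- κ 3 :* ε) :* L := t :- (b :- (log4 :+ r)) :+
            (b :- (a :- ε) :* L) :+ (ε :* L :- log4) :+ (ε :* L :- r))
            (t ∷ (S m) ∷ ε ∷ L ∷ (ℓ n m) ∷ log4 ∷ r ∷ [])))

        δ-from-exponent : ∀ {ν t E} → 0# < ε → 0# ≤ E → (E + 3# * ε) * L < ν * t → log4 + r < ν * t
        δ-from-exponent {ν} {t} {E} ε>0 E≥0 h = ≤-<-trans
          (≤-by (+-nonneg (+-nonneg (+-nonneg (≤-diff log4≤εL) (≤-diff r≤εL))
            (*-nonneg E≥0 (<⇒≤ L>0))) (*-nonneg (<⇒≤ ε>0) (<⇒≤ L>0)))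
            (solve 5 (λ E ε L log4 r → (E :+ κ 3 :* ε) :* L :- (log4 :+ r) := ε :* L :- log4 :+
            (ε :* L :- r) :+ E :* L :+ ε :* L) (E ∷ ε ∷ L ∷ log4 ∷ r ∷ []))) h

        few : ∀ {X ν C j m} I → 0# < X → ε ≤ 1# → C + 3# ≤ M → log X ≤ C * L → m ℕ.≤ k →
          log4 + r < ν * log X → (m ℕ.< k → log X ≤ ℓ n (suc m) - (log4 + r)) →
          (∀ i → i ℕ.< I → i ℕ.< k → (η (suc i) + 3# * ε) * L < ν * log X) →
          I ℕ.≤ m → suc (m ∸ I) ℕ.< j → ¬ HasIndependentSolutions ζ j X ν
        few I X>0 ε≤1 C≤M t≤CL m≤k δ late early I≤m d<j (v , independent , solves) =
          Obstruction.few-solutions n≥1 m≤k (δ-bound δ) (late-bound X>0 late)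
            (early-bound I X>0 ε≤1 C≤M t≤CL early) v solves I≤m d<j independent

        none : ∀ {X ν C m} → 0# < X → ε ≤ 1# → C + 3# ≤ M → log X ≤ C * L → m ℕ.< k →
          log4 + r < ν * log X → (m ℕ.< k → log X ≤ ℓ n (suc m) - (log4 + r)) →
          (∀ i → i ℕ.< suc m → i ℕ.< k → (η (suc i) + 3# * ε) * L < ν * log X) →
          ¬ HasIndependentSolutions ζ 1 X ν
        none {m = m} X>0 ε≤1 C≤M t≤CL m<k δ late early (v , independent , solves) =
          Obstruction.no-solutions n≥1 (ℕ.<⇒≤ m<k) (δ-bound δ) (late-bound X>0 late)
            (early-bound (suc m) X>0 ε≤1 C≤M t≤CL early) v solves m<k ≡.refl Fin.zero independent

        many : ∀ {X ν} lo {j} → 0# < X → (∀ (p : Fin j) → lo ℕ.+ toℕ p ℕ.≤ k) →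
          (∀ (p : Fin j) → ℓ n (lo ℕ.+ toℕ p) ≤ log X) →
          (∀ (p : Fin j) → lo ℕ.+ toℕ p ℕ.< k →
            ν * log X + log4 ≤ ℓ n (suc (lo ℕ.+ toℕ p)) - ℓ n (lo ℕ.+ toℕ p)) →
          (∀ (p : Fin j) → lo ℕ.+ toℕ p ≡ k → ν * log X + log4 + L ≤ ℓ (suc n) 1) →
          HasIndependentSolutions ζ j X ν
        many {X} {ν} lo {j} X>0 m≤k x≤X inner outer = approximants-solve n≥1 lo m≤k
          (λ p → log-cancel-≤ (aʳ-pos n≥1 (m≤k p)) X>0 (x≤X p))
          (λ p m<k → double (a n (m p)) (exp-≤ (exp-⊗ 4≈exp (a≈exp n≥1 (m≤k p)))
            (exp-⊗ refl (a≈exp n≥1 m<k))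
            (≤-by (≤-diff (inner p m<k)) (solve 5
              (λ ν a b log4 c → :- ν :* a :+ b :- (log4 :+ c) := b :- c :- (ν :* a :+ log4))
              (ν ∷ (log X) ∷ (ℓ n (suc (m p))) ∷ log4 ∷ (ℓ n (m p)) ∷ [])))))
          (λ p m≡k → double (a n k) (exp-≤ (exp-⊗ 4≈exp (a≈exp n≥1 k≤k))
            (exp-⊗ refl (a≈exp {suc n} {1} (ℕ.s≤s ℕ.z≤n) (ℕ.s≤s ℕ.z≤n)))
            (≤-by (≤-diff (outer p m≡k)) (solve 5
              (λ ν a b log4 L → :- ν :* a :+ b :- (log4 :+ L) := b :- (ν :* a :+ log4 :+ L))
              (ν ∷ (log X) ∷ (ℓ (suc n) 1) ∷ log4 ∷ L ∷ [])))))
          where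
          m : Fin j → ℕ
          m p = lo ℕ.+ toℕ p
          double : ∀ c {y} → 4# * fromℕ c ≤ y → 2# * fromℕ c ≤ y
          double c {y} h = (≤-by (+-nonneg (+-nonneg (≤-diff h) (fromℕ-nonneg c)) (fromℕ-nonneg c))
            (solve 2 (λ y a → y :- κ 2 :* a := y :- κ 4 :* a :+ a :+ a) (y ∷ (fromℕ c) ∷ [])))

      -- Upper bounds for the approximation constants

      X₀≤exp : ∀ {X₀ t} → ∣ X₀ ∣ ≤ t → X₀ ≤ exp t × 1# ≤ exp t
      X₀≤exp {X₀} {t} h = ≤-trans (≤-trans (x≤∣x∣ X₀) h) (x≤exp t) ,
        ≤-trans (≤-by (+-nonneg (≤-diff h) (∣∣-nonneg X₀))
          (solve 2 (λ t a → κ 1 :+ t :- κ 1 := t :- a :+ a) (t ∷ (∣ X₀ ∣) ∷ []))) (1+x≤exp t)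

      -- Let m be the place of 4 R X among the a n i. The columns beyond m are late, and log X is
      -- about S m L or larger. So ν > T makes the error smaller than Q^(- η (m - j′)) and the first
      -- m - j′ columns early. Only 1 + j′ free coordinates remain for j′ + 2 vectors.
      ω-upper : ∀ j′ {T} → 0# ≤ T → (∀ m → j′ ℕ.< m → m ℕ.≤ k → η (m ∸ j′) ≤ T * S m) →
        ω ζ (suc (suc j′)) ≤± [ T ]
      ω-upper j′ {T} T≥0 T-bound = ω-≤ ζ (suc (suc j′)) λ ν T<ν → bound ν T<ν
        where
        module _ (ν : ℝ) (T<ν : T < ν) where
          ν>0 : 0# < ν
          ν>0 = ≤-<-trans T≥0 T<ν
          choice = tolerance (*-pos (<-diff T<ν) η₁>0) (*-pos 0<4 (+-pos-nonneg ν>0 0≤1))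
          ε C : ℝ
          ε = proj₁ choice
          -- Then log X ≥ C r gives ν log X ≥ 2 r > log 4 + r, which is the condition 4 R δ < 1.
          C = 2# / ν
          ε>0 : 0# < ε
          ε>0 = proj₁ (proj₂ choice)
          ε≤1 : ε ≤ 1#
          ε≤1 = proj₁ (proj₂ (proj₂ choice))
          room : ε * (4# * (ν + 1#)) ≤ (ν - T) * σ
          room = proj₂ (proj₂ (proj₂ choice))
          C>0 : 0# < C
          C>0 = /-pos 0<2 ν>0
          νC : ν * C ≈ 2#
          νC = trans (*-comm ν C) (x/z*z ν>0)
          eventually = good ε (C + 3#) 0# ε>0
          N = proj₁ eventually

          module _ {n : ℕ} (g : Good ε (C + 3#) 0# n) {X : ℝ} (X>0 : 0# < X)
            (lower : C * ℓ n 0 ≤ log X) (upper : log X ≤ C * ℓ n k) where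
            open Block g
            t f₀ : ℝ
            t = log X
            f₀ = log4 + r

            none-at : ∀ m → m ℕ.≤ k → ℓ n m - f₀ ≤ t → (m ℕ.< k → t ≤ ℓ n (suc m) - f₀) →
              ¬ HasIndependentSolutions ζ (suc (suc j′)) X ν
            -- All columns are late, so the solutions lie on one line, whereas at least two
            -- independent ones are asked for.
            none-at zero m≤k _ late = few 0 X>0 ε≤1 ≤-refl upper m≤k
              (<-by (+-pos-nonneg (+-pos-nonneg (<-diff log4<r) (*-nonneg (<⇒≤ ν>0) (≤-diff lower)))
                (eq-nonneg r νC)) (solve 5 (λ ν t log4 r C →
                ν :* t :- (log4 :+ r) := r :- log4 :+ ν :* (t :- C :* r) :+ r :* (ν :* C :- κ 2))
                (ν ∷ t ∷ log4 ∷ r ∷ C ∷ [])))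
              late (λ _ ()) ℕ.≤-refl (ℕ.s≤s (ℕ.s≤s ℕ.z≤n))
            none-at m@(suc _) m≤k t≥ late with j′ ℕ.<? m
            ... | yes j′<m = few (m ∸ j′) X>0 ε≤1 ≤-refl upper m≤k
              (δ-from-exponent ε>0 (η-nonneg I≥1 I≤k) exceeds)
                  late (λ i i<I _ → ≤-<-trans
                    (≤-by (*-nonneg (≤-diff (η-mono (ℕ.s≤s ℕ.z≤n) i<I I≤k)) (<⇒≤ L>0))
                    (solve 4 (λ a ε L b → (a :+ κ 3 :* ε) :* L :- (b :+ κ 3 :* ε) :* L := (a :- b)
                    :* L) ((η (m ∸ j′)) ∷ ε ∷ L ∷ (η (suc i)) ∷ []))) exceeds)
                  (ℕ.m∸n≤m m j′) (ℕ.≤-reflexive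
                    (≡.cong (λ d → suc (suc d)) (ℕ.m∸[m∸n]≡n (ℕ.<⇒≤ j′<m))))
              where
              I≥1 : 1 ℕ.≤ m ∸ j′
              I≥1 = ℕ.m<n⇒0<n∸m j′<m
              I≤k : m ∸ j′ ℕ.≤ k
              I≤k = ℕ.≤-trans (ℕ.m∸n≤m m j′) m≤k
              exceeds : (η (m ∸ j′) + 3# * ε) * L < ν * t
              exceeds = exponent-exceeds ε>0 ν>0 T<ν (ℕ.s≤s ℕ.z≤n) m≤k (T-bound m j′<m m≤k) room t≥
            -- The late columns alone leave 1 + m ≤ 1 + j′ coordinates; the exponent estimate with E
            -- = 0 serves only to make R δ small.
            ... | no j′≮m = few 0 X>0 ε≤1 ≤-refl upper m≤k
                  (δ-from-exponent ε>0 ≤-refl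
                    (exponent-exceeds ε>0 ν>0 T<ν (ℕ.s≤s ℕ.z≤n) m≤k
                    (*-nonneg T≥0 (<⇒≤ (S-pos (ℕ.s≤s ℕ.z≤n) m≤k))) room t≥))
                  late (λ _ ()) ℕ.z≤n (ℕ.s≤s (ℕ.s≤s (ℕ.≮⇒≥ j′≮m)))

            absent : ¬ HasIndependentSolutions ζ (suc (suc j′)) X ν
            absent with ≤⊎> (ℓ n k - f₀) t
            ... | inj₁ h = none-at k ℕ.≤-refl h (λ k<k → ⊥-elim (ℕ.<-irrefl ≡.refl k<k))
            ... | inj₂ h = let (m , _ , m<k , p , s) = crossing (λ m → ℓ n m - f₀) 0 k start h in none-at m (ℕ.<⇒≤ m<k) p (λ _ → <⇒≤ s)
              where
              start : r - f₀ ≤ t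
              start = (≤-by (+-nonneg (+-nonneg log4≥0 (≤-diff lower))
                (*-nonneg (<⇒≤ C>0) (<⇒≤ r>0)))
                (solve 4 (λ t r log4 C → t :- (r :- (log4 :+ r)) := log4 :+ (t :- C :* r) :+ C :* r)
                (t ∷ r ∷ log4 ∷ C ∷ [])))

          -- The windows from C ℓ n 0 to C ℓ (n+1) 0 cover all large log X, and the right end is C ℓ
          -- n k by definition.
          bound : ∃ λ X₀ → ∀ X → X₀ ≤ X → ¬ HasIndependentSolutions ζ (suc (suc j′)) X ν
          bound = exp (C * ℓ N 0) , λ X h →
            let X>0              = <-≤-trans (exp-pos _) h
                (N′ , beyond)    = ℓ₀-large (log X / C)
                start            = ≤-respˡ (log-exp (C * ℓ N 0)) (log-mono-≤ (exp-pos _) h)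
                large            = beyond (N ℕ.+ N′) (ℕ.m≤n+m N′ N)
                (n , N≤n , _ , p , s) = crossing (λ n → C * ℓ n 0) N N′ start
                  ((<-by (+-pos-nonneg (*-pos C>0 (<-diff large)) (eq-nonneg (log X) (pos-⁻¹ C>0)))
                    (solve 4 (λ C a b c → C :* a :- b := C :* (a :- b :* c) :+ b :* (C :* c :- κ 1))
                    (C ∷ (ℓ (N ℕ.+ N′) 0) ∷ (log X) ∷ (C ⁻¹) ∷ []))))
            in absent (proj₂ eventually n N≤n) X>0 p (<⇒≤ s)

      -- X = a n m / (4 R) is the largest X for which column m is still late. There ν > η m / S m
      -- makes the columns 1, ..., m early, and the overlap in column m excludes nonzero solutions.
      ω̂₁-upper : ∀ m → 1 ℕ.≤ m → m ℕ.≤ k → ω̂ ζ 1 ≤± [ η m / S m ]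
      ω̂₁-upper (suc m) m≥1 m≤k = ω̂-≤ ζ 1 bound
        where
        T : ℝ
        T = η (suc m) / S (suc m)
        S>0 : 0# < S (suc m)
        S>0 = S-pos m≥1 m≤k
        T≥0 : 0# ≤ T
        T≥0 = /-nonneg (η-nonneg m≥1 m≤k) S>0
        bound : ∀ ν → T < ν → ∀ X₀ → ∃ λ X → X₀ ≤ X × 1# ≤ X × ¬ HasIndependentSolutions ζ 1 X ν
        bound ν T<ν X₀ = exp t , proj₁ (X₀≤exp X₀≤t) , proj₂ (X₀≤exp X₀≤t) ,
          none {C = 1#} (exp-pos t) ε≤1 ≤-refl t≤L m≤k
            (δ-from-exponent ε>0 (η-nonneg m≥1 m≤k) exceeds) (λ _ → ≤-reflexive (log-exp t))
            (λ i i<1+m _ → ≤-<-trans (≤-by (*-nonneg (≤-diff (η-mono (ℕ.s≤s ℕ.z≤n) i<1+m m≤k))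
              (<⇒≤ L>0)) (solve 4 (λ a ε L b →
              (a :+ κ 3 :* ε) :* L :- (b :+ κ 3 :* ε) :* L := (a :- b) :* L)
              ((η (suc m)) ∷ ε ∷ L ∷ (η (suc i)) ∷ []))) exceeds)
          where
          ν>0 : 0# < ν
          ν>0 = ≤-<-trans T≥0 T<ν
          choice = tolerance (*-pos (<-diff T<ν) η₁>0) (*-pos 0<4 (+-pos-nonneg ν>0 0≤1))
          ε : ℝ
          ε = proj₁ choice
          ε>0 : 0# < ε
          ε>0 = proj₁ (proj₂ choice)
          ε≤1 : ε ≤ 1#
          ε≤1 = proj₁ (proj₂ (proj₂ choice))
          room : ε * (4# * (ν + 1#)) ≤ (ν - T) * σ
          room = proj₂ (proj₂ (proj₂ choice))
          -- C = 1 suffices as log X ≤ L. The bound on r gives ν t > ε L ≥ ε r > ν ∣X₀∣, so that X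
          -- exceeds X₀.
          eventually = good ε (1# + 3#) (ν * ∣ X₀ ∣ / ε) ε>0
          n = proj₁ eventually
          open Block (proj₂ eventually n ℕ.≤-refl)
          t : ℝ
          t = ℓ n (suc m) - (log4 + r)
          exceeds′ : (η (suc m) + 3# * ε) * L < ν * t
          exceeds′ = exponent-exceeds ε>0 ν>0 T<ν m≥1 m≤k (≤-reflexive (sym (x/z*z S>0))) room
            ≤-refl
          exceeds : (η (suc m) + 3# * ε) * L < ν * log (exp t)
          exceeds = <-respʳ (*-congˡ (sym (log-exp t))) exceeds′
          t≤L : log (exp t) ≤ 1# * L
          t≤L = ≤-respˡ (sym (log-exp t)) (≤-by
            (+-nonneg (+-nonneg (≤-diff (ℓ-mono m≤k k≤k)) log4≥0) (<⇒≤ r>0))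
            (solve 4 (λ L a log4 r → κ 1 :* L :- (a :- (log4 :+ r)) := L :- a :+ log4 :+ r)
            (L ∷ (ℓ n (suc m)) ∷ log4 ∷ r ∷ [])))
          X₀≤t : ∣ X₀ ∣ ≤ t
          X₀≤t = *-cancelʳ-≤ ν>0 (≤-by (+-nonneg
            (+-nonneg (+-nonneg (+-nonneg (+-nonneg
            (+-nonneg (≤-diff (<⇒≤ exceeds′)) (*-nonneg (η-nonneg m≥1 m≤k) (<⇒≤ L>0)))
            (*-nonneg (<⇒≤ ε>0) (<⇒≤ L>0))) (*-nonneg (<⇒≤ ε>0) (<⇒≤ L>0)))
            (*-nonneg (<⇒≤ ε>0) (≤-diff r≤L))) (*-nonneg (<⇒≤ ε>0) (≤-diff (<⇒≤ r-large))))
            (eq-nonneg (ν * (∣ X₀ ∣)) (pos-⁻¹ ε>0)))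
            (solve 8 (λ t ν a b ε L r c → t :* ν :- a :* ν := ν :* t :- (b :+ κ 3 :* ε) :* L :+ b :*
            L :+ ε :* L :+ ε :* L :+ ε :* (L :- r) :+ ε :* (r :- ν :* a :* c) :+ ν :* a :*
            (ε :* c :- κ 1)) (t ∷ ν ∷ (∣ X₀ ∣) ∷ (η (suc m)) ∷ ε ∷ L ∷ r ∷ (ε ⁻¹) ∷ [])))

      -- At X = R^(2/ν) the error is R^(-2), small enough for late equations, while the gap between
      -- R and a n 1 keeps X below a n 1 / (4 R). Every column is then late and all solutions are
      -- proportional.
      ω̂-upper-zero : ∀ j′ → ω̂ ζ (suc (suc j′)) ≤± [ 0# ]
      ω̂-upper-zero j′ = ω̂-≤ ζ (suc (suc j′)) bound
        where
        bound : ∀ ν → 0# < ν → ∀ X₀ → ∃ λ X →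
          X₀ ≤ X × 1# ≤ X × ¬ HasIndependentSolutions ζ (suc (suc j′)) X ν
        bound ν ν>0 X₀ = exp t , proj₁ (X₀≤exp X₀≤t) , proj₂ (X₀≤exp X₀≤t) ,
          few {C = C} 0 (exp-pos t) ≤-refl ≤-refl
            (≤-respˡ (sym (log-exp t)) (≤-by (*-nonneg (<⇒≤ C>0) (≤-diff r≤L))
              (solve 3 (λ C L r → C :* L :- C :* r := C :* (L :- r)) (C ∷ L ∷ r ∷ [])))) ℕ.z≤n
            (<-respʳ (*-congˡ (sym (log-exp t)))
              (<-by (+-pos-nonneg (<-diff log4<r) (eq-nonneg r νC))
              (solve 4 (λ ν C r log4 → ν :* (C :* r) :- (log4 :+ r) := r :- log4 :+ r :*
              (ν :* C :- κ 2)) (ν ∷ C ∷ r ∷ log4 ∷ []))))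
            (λ _ → ≤-respˡ (sym (log-exp t)) (≤-by
              (+-nonneg (+-nonneg (≤-diff gap) (≤-diff (<⇒≤ log4<r))) (<⇒≤ r>0))
              (solve 4 (λ a log4 r C → a :- (log4 :+ r) :- C :* r := a :- (C :+ κ 3) :* r :+
              (r :- log4) :+ r) ((ℓ n 1) ∷ log4 ∷ r ∷ C ∷ []))))
            (λ _ ()) ℕ.≤-refl (ℕ.s≤s (ℕ.s≤s ℕ.z≤n))
          where
          C : ℝ
          C = 2# / ν
          C>0 : 0# < C
          C>0 = /-pos 0<2 ν>0
          νC : ν * C ≈ 2#
          νC = trans (*-comm ν C) (x/z*z ν>0)
          eventually = good 1# (C + 3#) (ν * ∣ X₀ ∣) 0<1
          n = proj₁ eventually
          open Block (proj₂ eventually n ℕ.≤-refl)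
          t : ℝ
          t = C * r
          X₀≤t : ∣ X₀ ∣ ≤ t
          X₀≤t = (≤-by (+-nonneg (+-nonneg (*-nonneg (<⇒≤ C>0) (≤-diff (<⇒≤ r-large)))
            (eq-nonneg (∣ X₀ ∣) νC)) (∣∣-nonneg X₀))
            (solve 4 (λ C r a ν → C :* r :- a := C :* (r :- ν :* a) :+ a :* (ν :* C :- κ 2) :+ a)
            (C ∷ r ∷ (∣ X₀ ∣) ∷ ν ∷ [])))

      -- Lower bounds for the approximation constants

      private
        -- Raising ν to 0 makes the claim stronger and stays below a positive target; afterwards
        -- upper bounds for log X may be multiplied by ν.
        nonneg-part : ∀ {ν t} → 0# < t → ν < t → 0# ≤ ν ⊔ 0# × ν ⊔ 0# < t
        nonneg-part {ν} {t} t>0 ν<t with ⊔-sel ν 0#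
        ... | inj₁ e = x≤y⊔x ν 0# , <-respˡ (sym e) ν<t
        ... | inj₂ e = x≤y⊔x ν 0# , <-respˡ (sym e) t>0

      module Room {ε M K : ℝ} {n : ℕ} {ν : ℝ} (g : Good ε M K n) (ν≥0 : 0# ≤ ν) where
        open Block g

        -- The error ε (ν + 2) consists of ν ε from the estimate of ℓ n m and one ε each from log 4
        -- and from the increment; (T - ν) S m ≥ (T - ν) σ pays for it.
        inner-room : ∀ {t T m l} → T * S m ≤ η (suc l) → ν ≤ T → ε * (ν + 2#) ≤ (T - ν) * σ →
          1 ℕ.≤ m → m ℕ.≤ k → l ℕ.< k →
          t ≤ ℓ n m → ν * t + log4 ≤ ℓ n (suc l) - ℓ n l
        inner-room {t} {T} {m} {l} TS≤η ν≤T room m≥1 m≤k l<k t≤ =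
          (≤-by (+-nonneg (+-nonneg (+-nonneg
          (+-nonneg (+-nonneg (+-nonneg (*-nonneg ν≥0 (≤-diff t≤))
          (*-nonneg ν≥0 (≤-diff (ℓ-≤ m m≤k)))) (≤-diff log4≤εL)) (≤-diff (inc-≥ l l<k)))
          (*-nonneg (≤-diff TS≤η) (<⇒≤ L>0)))
          (*-nonneg (*-nonneg (≤-diff ν≤T) (≤-diff (σ≤S m≥1 m≤k))) (<⇒≤ L>0)))
          (*-nonneg (≤-diff room) (<⇒≤ L>0)))
          (solve 12 (λ a b ν t log4 c d ε L e T σ →
          a :- b :- (ν :* t :+ log4) := ν :* (c :- t) :+ ν :* ((d :+ ε) :* L :- c) :+
          (ε :* L :- log4) :+ (a :- b :- (e :- ε) :* L) :+ (e :- T :* d) :* L :+ (T :- ν) :*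
          (d :- σ) :* L :+ ((T :- ν) :* σ :- ε :* (ν :+ κ 2)) :* L)
          ((ℓ n (suc l)) ∷ (ℓ n l) ∷ ν ∷ t ∷ log4 ∷ (ℓ n m) ∷ (S m) ∷ ε ∷ L ∷ (η (suc l)) ∷ T ∷ σ ∷
          [])))

        outer-room : ∀ {t} → ε ≤ 1# → ν + 2# ≤ M → t ≤ L → ν * t + log4 + L ≤ ℓ (suc n) 1
        outer-room {t} ε≤1 ν≤M t≤L = (≤-by (+-nonneg
          (+-nonneg (+-nonneg (+-nonneg (*-nonneg ν≥0 (≤-diff t≤L)) (≤-diff log4≤εL))
          (*-nonneg (≤-diff ε≤1) (<⇒≤ L>0))) (*-nonneg (≤-diff ν≤M) (<⇒≤ L>0))) (≤-diff next-gap))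
          (solve 7 (λ a ν t log4 L ε M → a :- (ν :* t :+ log4 :+ L) := ν :* (L :- t) :+
          (ε :* L :- log4) :+ (κ 1 :- ε) :* L :+ (M :- (ν :+ κ 2)) :* L :+ (a :- M :* L))
          ((ℓ (suc n) 1) ∷ ν ∷ t ∷ log4 ∷ L ∷ ε ∷ M ∷ [])))

      -- At X = a n m the approximants of indices m - j′ - 1, ..., m are available. Index l has
      -- error about Q^(- η (l+1)), so by monotonicity of η the first one is the worst and gives η
      -- (m - j′) / S m. If m = k, the last one profits from the gap before the next block.
      ω-lower : ∀ j′ m → j′ ℕ.< m → m ℕ.≤ k → [ η (m ∸ j′) / S m ] ≤± ω ζ (suc (suc j′))
      ω-lower j′ m j′<m m≤k = ≤-ω ζ (suc (suc j′)) bound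
        where
        m≥1 : 1 ℕ.≤ m
        m≥1 = ℕ.≤-trans (ℕ.s≤s ℕ.z≤n) j′<m
        I≥1 : 1 ℕ.≤ m ∸ j′
        I≥1 = ℕ.m<n⇒0<n∸m j′<m
        I≤k : m ∸ j′ ℕ.≤ k
        I≤k = ℕ.≤-trans (ℕ.m∸n≤m m j′) m≤k
        T : ℝ
        T = η (m ∸ j′) / S m
        T>0 : 0# < T
        T>0 = /-pos (<-≤-trans η₁>0 (η-mono ℕ.≤-refl I≥1 I≤k)) (S-pos m≥1 m≤k)
        lo : ℕ
        lo = m ∸ suc j′
        1+lo : suc lo ≡ m ∸ j′
        1+lo = ≡.sym (ℕ.+-∸-assoc 1 j′<m)
        index≤m : ∀ (p : Fin (suc (suc j′))) → lo ℕ.+ toℕ p ℕ.≤ m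
        index≤m p = ℕ.≤-trans (ℕ.+-monoʳ-≤ lo (ℕ.≤-pred (Fin.toℕ<n p)))
          (ℕ.≤-reflexive (ℕ.m∸n+n≡m j′<m))
        bound : ∀ ν → ν < T → ∀ X₀ → ∃ λ X → X₀ ≤ X × HasIndependentSolutions ζ (suc (suc j′)) X ν
        bound ν ν<T X₀ = aʳ n m , X₀≤X ,
          solutions-antitone ζ (suc (suc j′)) (1≤fromℕ (a-pos n≥1 m≤k)) (x≤x⊔y ν 0#)
            (many lo (aʳ-pos n≥1 m≤k) (λ p → ℕ.≤-trans (index≤m p) m≤k)
              (λ p → ℓ-mono (index≤m p) m≤k)
              (λ p l<k → inner-room {T = T} (TS≤ p l<k) (<⇒≤ ν⁺<T) room m≥1 m≤k l<k ≤-refl)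
              (λ _ _ → outer-room ε≤1 ≤-refl (ℓ-mono m≤k k≤k)))
          where
          ν⁺ : ℝ
          ν⁺ = ν ⊔ 0#
          ν⁺≥0 : 0# ≤ ν⁺
          ν⁺≥0 = proj₁ (nonneg-part T>0 ν<T)
          ν⁺<T : ν⁺ < T
          ν⁺<T = proj₂ (nonneg-part T>0 ν<T)
          choice = tolerance (*-pos (<-diff ν⁺<T) η₁>0)
            (<-respʳ (+-comm 2# ν⁺) (+-pos-nonneg 0<2 ν⁺≥0))
          ε : ℝ
          ε = proj₁ choice
          ε≤1 : ε ≤ 1#
          ε≤1 = proj₁ (proj₂ (proj₂ choice))
          room : ε * (ν⁺ + 2#) ≤ (T - ν⁺) * σ
          room = proj₂ (proj₂ (proj₂ choice))
          eventually = good ε (ν⁺ + 2#) X₀ (proj₁ (proj₂ choice))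
          n = proj₁ eventually
          g = proj₂ eventually n ℕ.≤-refl
          open Block g
          open Room {ν = ν⁺} g ν⁺≥0
          X₀≤X : X₀ ≤ aʳ n m
          X₀≤X = ≤-trans (<⇒≤ r-large) (≤-trans (ℓ-mono ℕ.z≤n m≤k)
            (≤-respʳ (sym (a≈exp n≥1 m≤k)) (x≤exp (ℓ n m))))
          TS≤ : ∀ p → lo ℕ.+ toℕ p ℕ.< k → T * S m ≤ η (suc (lo ℕ.+ toℕ p))
          TS≤ p l<k = ≤-respˡ (sym (x/z*z (S-pos m≥1 m≤k)))
            (η-mono I≥1 (ℕ.≤-trans (ℕ.≤-reflexive (≡.sym 1+lo)) (ℕ.s≤s (ℕ.m≤m+n lo (toℕ p)))) l<k)

      -- The approximant of index k has x = Q and error about Q / q (n+2) 1, which is eventually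
      -- below any fixed power of Q.
      ω₁-infinite : ω ζ 1 ≈± ⊤±
      ω₁-infinite = ω-infinite ζ 1 bound
        where
        bound : ∀ ν X₀ → ∃ λ X → X₀ ≤ X × HasIndependentSolutions ζ 1 X ν
        bound ν X₀ = aʳ n k , X₀≤X , solutions-antitone ζ 1 (1≤fromℕ (a-pos n≥1 k≤k)) (x≤x⊔y ν 0#)
            (many k (aʳ-pos n≥1 k≤k) index≤k (λ p → ℓ-mono (index≤k p) k≤k)
              (λ p l<k → ⊥-elim (ℕ.<⇒≱ l<k (ℕ.m≤m+n k (toℕ p))))
                (λ _ _ → outer-room ≤-refl ≤-refl ≤-refl))
          where
          eventually = good 1# ((ν ⊔ 0#) + 2#) X₀ 0<1
          n = proj₁ eventually
          g = proj₂ eventually n ℕ.≤-refl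
          open Block g
          open Room {ν = ν ⊔ 0#} g (x≤y⊔x ν 0#)
          index≤k : ∀ (p : Fin 1) → k ℕ.+ toℕ p ℕ.≤ k
          index≤k Fin.zero = ℕ.≤-reflexive (ℕ.+-identityʳ k)
          X₀≤X : X₀ ≤ aʳ n k
          X₀≤X = ≤-trans (<⇒≤ r-large) (≤-trans r≤L (≤-respʳ (sym (a≈exp n≥1 k≤k)) (x≤exp (ℓ n k))))

      -- For a n m ≤ X < a n (m+1) the approximant of index m is used. The worst case is X near the
      -- right end, about Q^(S (m+1)), against an error of about Q^(- η (m+1)).
      ω̂₁-lower : ∀ {T} → 0# < T → (∀ m → 1 ℕ.≤ m → m ℕ.≤ k → T * S m ≤ η m) → [ T ] ≤± ω̂ ζ 1
      ω̂₁-lower {T} T>0 T-bound = ≤-ω̂ ζ 1 bound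
        where
        module _ (ν : ℝ) (ν<T : ν < T) where
          ν⁺ : ℝ
          ν⁺ = ν ⊔ 0#
          ν⁺≥0 : 0# ≤ ν⁺
          ν⁺≥0 = proj₁ (nonneg-part T>0 ν<T)
          ν⁺<T : ν⁺ < T
          ν⁺<T = proj₂ (nonneg-part T>0 ν<T)
          choice = tolerance (*-pos (<-diff ν⁺<T) η₁>0)
            (<-respʳ (+-comm 2# ν⁺) (+-pos-nonneg 0<2 ν⁺≥0))
          ε : ℝ
          ε = proj₁ choice
          room : ε * (ν⁺ + 2#) ≤ (T - ν⁺) * σ
          room = proj₂ (proj₂ (proj₂ choice))
          eventually = good ε 0# 0# (proj₁ (proj₂ choice))
          N = proj₁ eventually

          present : ∀ {n} → Good ε 0# 0# n → ∀ {X} → 1# ≤ X → ℓ n 0 ≤ log X → log X < ℓ n k →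
            HasIndependentSolutions ζ 1 X ν
          present {n} g {X} X≥1 lower upper =
            let (m , _ , m<k , p , s) = crossing (ℓ n) 0 k lower upper in
            solutions-antitone ζ 1 X≥1 (x≤x⊔y ν 0#)
              (many m (<-≤-trans 0<1 X≥1) (λ r → ≡.subst (ℕ._≤ k) (index m r) (ℕ.<⇒≤ m<k))
                (λ r → ≤-respˡ (reflexive (≡.cong (ℓ n) (index m r))) p)
                (λ r _ → ≡.subst (λ l → ν⁺ * log X + log4 ≤ ℓ n (suc l) - ℓ n l) (index m r)
                  (inner-room {T = T} {m = suc m} (T-bound (suc m) (ℕ.s≤s ℕ.z≤n) m<k) (<⇒≤ ν⁺<T)
                    room (ℕ.s≤s ℕ.z≤n) m<k m<k (<⇒≤ s)))
                (λ r m≡k → ⊥-elim (ℕ.<⇒≢ m<k (≡.trans (index m r) m≡k))))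
            where
            open Block g hiding (r)
            open Room {ν = ν⁺} g ν⁺≥0
            index : ∀ m (r : Fin 1) → m ≡ m ℕ.+ toℕ r
            index m Fin.zero = ≡.sym (ℕ.+-identityʳ m)

          bound : ∃ λ X₀ → ∀ X → X₀ ≤ X → HasIndependentSolutions ζ 1 X ν
          bound = exp (ℓ N 0) , λ X h →
            let (N′ , beyond)    = ℓ₀-large (log X)
                (n , N≤n , _ , p , s) = crossing (λ n → ℓ n 0) N N′
                  (≤-respˡ (log-exp (ℓ N 0)) (log-mono-≤ (exp-pos _) h))
                    (beyond (N ℕ.+ N′) (ℕ.m≤n+m N′ N))
            in present (proj₂ eventually n N≤n) (≤-trans X₀≥1 h) p s
            where
            open Block (proj₂ eventually N ℕ.≤-refl)
            X₀≥1 : 1# ≤ exp (ℓ N 0)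
            X₀≥1 = ≤-respˡ exp-0 (exp-mono-≤ (<⇒≤ r>0))

      -- For ν < 0 it is enough to reach error X^0 = 1. The approximants of block 1 do so for all X
      -- ≥ a 1 k at once, because consecutive denominators at least double.
      ω̂-lower-zero : ∀ j → j ℕ.≤ suc k → [ 0# ] ≤± ω̂ ζ j
      ω̂-lower-zero j j≤1+k = ≤-ω̂ ζ j λ ν ν<0 → aʳ 1 k , λ X h →
        solutions-antitone ζ j (≤-trans (1≤fromℕ (a-pos ℕ.≤-refl k≤k)) h) (<⇒≤ ν<0)
          (approximants-solve ℕ.≤-refl 0 index≤k
            (λ p → ≤-trans (aʳ-mono ℕ.≤-refl (index≤k p) k≤k) h)
            (λ p l<k → scaled X (double {a 1 (toℕ p)} {a 1 (suc (toℕ p))}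
              (proper-multiple (a-∣-step ℕ.≤-refl (toℕ p) l<k) (a-<-step ℕ.≤-refl (toℕ p) l<k))))
            (λ p _ → scaled X (double {a 1 k} {a 2 1}
              (proper-multiple (next-∣ 2 (ℕ.s≤s ℕ.z≤n)) (next-< 2 (ℕ.s≤s ℕ.z≤n))))))
        where
        index≤k : ∀ (p : Fin j) → toℕ p ℕ.≤ k
        index≤k p = ℕ.≤-pred (ℕ.<-≤-trans (Fin.toℕ<n p) j≤1+k)
        double : ∀ {b c} → 2 ℕ.* b ℕ.≤ c → 2# * fromℕ b ≤ fromℕ c
        double {b} h = ≤-respˡ (trans (fromℕ-* 2 b)
          (*-congʳ (solve 0 (κ 1 :+ (κ 1 :+ κ 0) := κ 2) []))) (fromℕ-mono-≤ h)
        scaled : ∀ X {x y} → x ≤ y → x ≤ X ^ʳ (- 0#) * y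
        scaled X {x} {y} h = ≤-respʳ (trans (sym (*-identityˡ y))
          (*-congʳ (sym (trans (exp-cong (solve 1 (λ a → :- (κ 0) :* a := κ 0) ((log X) ∷ [])))
          exp-0)))) h

      -- The values of the constants

      -- F is left open up to pointwise equality so that different ways of writing the index of η
      -- can be served without function extensionality.
      ω-value : ∀ j′ (F : ℕ → ℝ) → (∀ m → F m ≡ η (m ∸ j′) / S m) → suc j′ ℕ.≤ k →
        ω ζ (suc (suc j′)) ≈± [ max[ suc j′ , k ] F ]
      ω-value j′ F F≡ j′<k = ≤±-antisym (ω-upper j′ T≥0 T-bound) (attained (max-attained F j′<k))
        where
        T : ℝ
        T = max[ suc j′ , k ] F
        F≥0 : 0# ≤ F k
        F≥0 = ≡.subst (0# ≤_) (≡.sym (F≡ k)) (/-nonneg (η-nonneg (ℕ.m<n⇒0<n∸m j′<k) (ℕ.m∸n≤m k j′))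
          (S-pos (ℕ.s≤s ℕ.z≤n) k≤k))
        T≥0 : 0# ≤ T
        T≥0 = ≤-trans F≥0 (≤-max F j′<k ℕ.≤-refl)
        T-bound : ∀ m → j′ ℕ.< m → m ℕ.≤ k → η (m ∸ j′) ≤ T * S m
        T-bound m j′<m m≤k = ≤-respˡ (x/z*z S>0)
          (≤-by (*-nonneg (≤-diff (≡.subst (_≤ T) (F≡ m) (≤-max F j′<m m≤k))) (<⇒≤ S>0))
            (solve 3 (λ T a x → T :* a :- x :* a := (T :- x) :* a) (T ∷ (S m) ∷ x ∷ [])))
          where
          x = η (m ∸ j′) / S m
          S>0 : 0# < S m
          S>0 = S-pos (ℕ.≤-trans (ℕ.s≤s ℕ.z≤n) j′<m) m≤k
        attained : (∃ λ m → suc j′ ℕ.≤ m × m ℕ.≤ k × T ≈ F m) → [ T ] ≤± ω ζ (suc (suc j′))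
        attained (m , j′<m , m≤k , e) = ≤±-trans [ ≤-reflexive (trans e (reflexive (F≡ m))) ]≤
          (ω-lower j′ m j′<m m≤k)

      ω-last-value : ω ζ (suc k) ≈± [ η 1 / S k ]
      ω-last-value = ≡.subst (λ x → ω ζ (suc k) ≈± [ x ]) single
        (ω-value k′ (λ m → η (m ∸ k′) / S m) (λ _ → ≡.refl) ℕ.≤-refl)
        where
        single : max[ k , k ] (λ m → η (m ∸ k′) / S m) ≡ η 1 / S k
        single = ≡.trans (≡.cong (λ d → maxFrom k d (λ m → η (m ∸ k′) / S m)) (ℕ.n∸n≡0 k))
          (≡.cong (λ i → η i / S k) (ℕ.m+n∸n≡m 1 k′))

      ω̂₁-value : ω̂ ζ 1 ≈± [ min[ 1 , k ] (λ m → η m / S m) ]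
      ω̂₁-value = ≤±-antisym upper (ω̂₁-lower T>0 T-bound)
        where
        F : ℕ → ℝ
        F m = η m / S m
        T : ℝ
        T = min[ 1 , k ] F
        attained = min-attained F (ℕ.s≤s ℕ.z≤n)
        m = proj₁ attained
        m≥1 = proj₁ (proj₂ attained)
        m≤k = proj₁ (proj₂ (proj₂ attained))
        T≈F : T ≈ F m
        T≈F = proj₂ (proj₂ (proj₂ attained))
        T>0 : 0# < T
        T>0 = <-respʳ (sym T≈F) (/-pos (<-≤-trans η₁>0 (η-mono ℕ.≤-refl m≥1 m≤k)) (S-pos m≥1 m≤k))
        T-bound : ∀ m → 1 ℕ.≤ m → m ℕ.≤ k → T * S m ≤ η m
        T-bound m m≥1 m≤k = ≤-respʳ (x/z*z (S-pos m≥1 m≤k))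
          (≤-by (*-nonneg (≤-diff (min-≤ F m≥1 m≤k)) (<⇒≤ (S-pos m≥1 m≤k)))
            (solve 3 (λ a b T → a :* b :- T :* b := (a :- T) :* b) ((F m) ∷ (S m) ∷ T ∷ [])))
        upper : ω̂ ζ 1 ≤± [ T ]
        upper = ≤±-trans (ω̂₁-upper m m≥1 m≤k) [ ≤-reflexive (sym T≈F) ]≤

      ω̂-value : ∀ j′ → suc j′ ℕ.≤ k → ω̂ ζ (suc (suc j′)) ≈± [ 0# ]
      ω̂-value j′ j′<k = ≤±-antisym (ω̂-upper-zero j′) (ω̂-lower-zero (suc (suc j′)) (ℕ.s≤s j′<k))

theorem2p5 :
  (em : ExcludedMiddle 0ℓ) (𝔽 : CompleteOrderedField) →
  let open Analysis em 𝔽 in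
  (k : ℕ) → 1 ℕ.≤ k →
  (q : ℕ → ℕ → ℕ) (η : ℕ → ℝ) →
  (∀ n j → 1 ℕ.≤ n → 1 ℕ.≤ j → j ℕ.< k → q n j ℕ.< q n (suc j)) →
  (∀ n → 1 ℕ.≤ n → q n k ℕ.< q (suc n) 1) →
  (∀ n j → 1 ℕ.≤ n → 1 ℕ.≤ j → j ℕ.< k → q n j ∣ q n (suc j)) →
  (∀ n → 1 ℕ.≤ n → q n k ∣ q (suc n) 1) →
  (λ n → (log (fromℕ (q (suc n) 1)) - log (fromℕ (q n k))) / log (fromℕ (q (suc n) k))) ⟶ η 1 →
  (∀ i → 2 ℕ.≤ i → i ℕ.≤ k →
    (λ n → (log (fromℕ (q (suc n) i)) - log (fromℕ (q (suc n) (i ∸ 1)))) / log (fromℕ (q (suc n) k))) ⟶ η i) →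
  (λ n → log (fromℕ (q (suc n) 1)) / log (fromℕ (q n k))) ⟶∞ →
  Σ₁ k η ≈ 1# →
  (∀ i → 1 ℕ.≤ i → i ℕ.< k → η i ≤ η (suc i)) →
  0# < η 1 →
  let ζ : Fin k → ℝ
      ζ i = series₁ (λ n → 1# / fromℕ (q n (suc (toℕ i))))
  in
  ω ζ 1 ≈± ⊤±
  × (∀ j → 2 ℕ.≤ j → j ℕ.≤ suc k →
      ω ζ j ≈± [ max[ j ∸ 1 , k ] (λ m → η (m ℕ.+ 2 ∸ j) / Σ₁ m η) ])
  × ω̂ ζ 1 ≈± [ min[ 1 , k ] (λ m → η m / Σ₁ m η) ]
  × (∀ j → 2 ℕ.≤ j → j ℕ.≤ suc k → ω̂ ζ j ≈± [ 0# ])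
  × ω ζ 2 ≈± [ max[ 1 , k ] (λ m → η m / Σ₁ m η) ]
  × ω ζ (suc k) ≈± [ η 1 / Σ₁ k η ]
theorem2p5 em 𝔽 (suc k′) _ q η row-< next-< row-∣ next-∣ lim₁ lims lim∞ _ η-step η₁>0 =
  ω₁-infinite ,
  (λ where
    (suc zero) (ℕ.s≤s ()) _
    (suc (suc j′)) _ (ℕ.s≤s j′<k) → ω-value j′ _ (λ m → index m j′) j′<k) ,
  ω̂₁-value ,
  (λ where
    (suc zero) (ℕ.s≤s ()) _
    (suc (suc j′)) _ (ℕ.s≤s j′<k) → ω̂-value j′ j′<k) ,
  ω-value 0 _ (λ _ → ≡.refl) (ℕ.s≤s ℕ.z≤n) ,
  ω-last-value
  where
  open Analysis em 𝔽
  open Development em 𝔽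
  open Denominators k′ q row-< next-< row-∣ next-∣

  increments : ∀ m → m ℕ.< suc k′ → (λ n → (ℓ n (suc m) - ℓ n m) / ℓ n (suc k′)) ⟶ η (suc m)
  increments zero    _   = lim₁
  increments (suc m) m<k = lims (suc (suc m)) (ℕ.s≤s (ℕ.s≤s ℕ.z≤n)) m<k

  open Asymptotics η increments lim∞ η-step η₁>0

  index : ∀ m j′ → η (m ℕ.+ 2 ∸ suc (suc j′)) / Σ₁ m η ≡ η (m ∸ j′) / Σ₁ m η
  index m j′ = ≡.cong (λ i → η (i ∸ suc (suc j′)) / Σ₁ m η) (ℕ.+-comm m 2)
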